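{- For every real number $\varepsilon$ with $0<\varepsilon\le 1$, we have $B_\varepsilon\ge \frac{1}{\varepsilon}-1$.
   Context: Graphs are finite and simple. For an $n$-vertex graph $G$, a set $X\subseteq V(G)$ is a balanced separator if each component of $G-X$ has at most $2n/3$ vertices; $s(G)$ denotes the minimum size of a balanced separator in $G$. For a class $\mathcal{G}$ of graphs, $s_{\mathcal{G}}:\mathbb{N}\to\mathbb{N}$ is defined by $s_{\mathcal{G}}(n)=\max\{s(G):G\in\mathcal{G},\ |V(G)|\le n\}$. A class of graphs is hereditary if it is closed under taking induced subgraphs. For a graph $G$ and an integer $r\ge 0$, an $r$-shallow minor of $G$ is any graph obtained from a subgraph of $G$ by contracting pairwise vertex-disjoint subgraphs, each of radius at most $r$ (in particular, each connected). The density of a graph $H$ is $|E(H)|/|V(H)|$. Let $\nabla_r(G)$ be the maximum density of an $r$-shallow minor of $G$, and for a class $\mathcal{G}$ of graphs let $\nabla_{\mathcal{G}}:\mathbb{N}\to\mathbb{R}\cup\{\infty\}$ be defined by $\nabla_{\mathcal{G}}(r)=\sup\{\nabla_r(G):G\in\mathcal{G}\}$. For $0<\varepsilon\le 1$, $B_\varepsilon$ denotes the infimum of real numbers $B$ for which every hereditary class $\mathcal{G}$ of graphs such that $s_{\mathcal{G}}(n)=\Theta(n^{1-\varepsilon})$ satisfies $\nabla_{\mathcal{G}}(r)=O(r^B)$. Asymptotic notation is with respect to $n\to\infty$ and $r\to\infty$; the implied constants may depend on the class and on $\varepsilon$. -}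

module Defs where

open import Algebra.Bundles using (module CommutativeRing)
open import Data.Bool.Base using (Bool; T; false)
open import Data.Fin.Base as Fin using (Fin)
open import Data.Fin.Properties as Fin using ()
open import Data.Fin.Subset using (Subset; _∈_; _∉_; ∣_∣)
open import Data.Integer.Base as ℤ using (ℤ; +_; -[1+_])
open import Data.List.Base using (List; allFin; cartesianProduct; filter; length)
open import Data.Nat.Base as ℕ using (ℕ; zero; suc)
open import Data.Product.Base using (Σ; ∃; ∃-syntax; Σ-syntax; _×_; _,_; proj₁; proj₂)
open import Data.Rational.Base as ℚ using (ℚ; 0ℚ; 1ℚ; _<_; 1/_; ↥_; ↧ₙ_)
import Data.Rational.Properties as ℚ
open import Data.Sum.Base using (_⊎_; inj₁; inj₂; swap)
open import Function.Base using (_∘_)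
open import Function.Bundles using (_⇔_)
open import Function.Definitions using (Injective)
open import Level using (Level; _⊔_; 0ℓ) renaming (suc to lsuc)
open import Relation.Binary.Construct.Closure.ReflexiveTransitive using (Star)
open import Relation.Binary.Definitions using (tri<; tri≈; tri>)
open import Relation.Binary.PropositionalEquality using (_≡_; _≢_; refl; sym; subst)
open import Relation.Nullary.Decidable using (_×-dec_; T?)
open import Relation.Nullary.Negation using (¬_)

open import Algebra.Properties.Semiring.Exp (CommutativeRing.semiring ℚ.+-*-commutativeRing) using () renaming (_^_ to _^ℚ_)

private
  variable
    i ℓ ℓ′ : Level

record ℝ : Set₁ where
  field
    lower upper : ℚ → Set
    lower-inhabited : ∃ lower
    upper-inhabited : ∃ upper
    lower-closed : ∀ {p q} → p < q → lower q → lower p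
    upper-closed : ∀ {p q} → p < q → upper p → upper q
    lower-open : ∀ {p} → lower p → ∃[ q ] (p < q × lower q)
    upper-open : ∀ {q} → upper q → ∃[ p ] (p < q × upper p)
    disjoint : ∀ {q} → ¬ (lower q × upper q)
    located : ∀ {p q} → p < q → lower p ⊎ upper q

open ℝ public

private
  pred< : ∀ q → q ℚ.- 1ℚ < q
  pred< q = subst (q ℚ.- 1ℚ <_) (ℚ.+-identityʳ q)
              (ℚ.+-monoʳ-< q (ℚ.negative⁻¹ (ℚ.- 1ℚ)))

  <suc : ∀ q → q < q ℚ.+ 1ℚ
  <suc q = subst (_< q ℚ.+ 1ℚ) (ℚ.+-identityʳ q)
             (ℚ.+-monoʳ-< q (ℚ.positive⁻¹ 1ℚ))

fromℚ : ℚ → ℝ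
fromℚ r = record
  { lower = _< r
  ; upper = r <_
  ; lower-inhabited = r ℚ.- 1ℚ , pred< r
  ; upper-inhabited = r ℚ.+ 1ℚ , <suc r
  ; lower-closed = ℚ.<-trans
  ; upper-closed = λ p<q r<p → ℚ.<-trans r<p p<q
  ; lower-open = λ p<r → let m , p<m , m<r = ℚ.<-dense p<r in m , p<m , m<r
  ; upper-open = λ r<q → let m , r<m , m<q = ℚ.<-dense r<q in m , m<q , r<m
  ; disjoint = λ (q<r , r<q) → ℚ.<-asym q<r r<q
  ; located = loc
  }
  where
  loc : ∀ {p q} → p < q → p < r ⊎ r < q
  loc {p} {q} p<q with ℚ.<-cmp p r
  ... | tri< p<r _ _ = inj₁ p<r
  ... | tri≈ _ refl _ = inj₂ p<q
  ... | tri> _ _ r<p = inj₂ (ℚ.<-trans r<p p<q)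

0ℝ 1ℝ : ℝ
0ℝ = fromℚ 0ℚ
1ℝ = fromℚ 1ℚ

infix 4 _<ℝ_ _≤ℝ_

_<ℝ_ : ℝ → ℝ → Set
x <ℝ y = ∃[ q ] (upper x q × lower y q)

_≤ℝ_ : ℝ → ℝ → Set
x ≤ℝ y = ∀ {q} → lower x q → lower y q

private
  flip-flip : ∀ q → 1ℚ ℚ.- (1ℚ ℚ.- q) ≡ q
  flip-flip q = begin
    1ℚ ℚ.+ ℚ.- (1ℚ ℚ.+ ℚ.- q)           ≡⟨ cong (1ℚ ℚ.+_) (ℚ.neg-distrib-+ 1ℚ (ℚ.- q)) ⟩
    1ℚ ℚ.+ (ℚ.- 1ℚ ℚ.+ ℚ.- (ℚ.- q))     ≡⟨ sym (ℚ.+-assoc 1ℚ (ℚ.- 1ℚ) (ℚ.- (ℚ.- q))) ⟩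
    0ℚ ℚ.+ ℚ.- (ℚ.- q)                  ≡⟨ ℚ.+-identityˡ (ℚ.- (ℚ.- q)) ⟩
    ℚ.- (ℚ.- q)                         ≡⟨ ⁻¹-involutive q ⟩
    q                                   ∎
    where
    open import Relation.Binary.PropositionalEquality using (cong; module ≡-Reasoning)
    open import Algebra.Properties.Group ℚ.+-0-group using (⁻¹-involutive)
    open ≡-Reasoning

  flip-< : ∀ {p q} → p < q → 1ℚ ℚ.- q < 1ℚ ℚ.- p
  flip-< p<q = ℚ.+-monoʳ-< 1ℚ (ℚ.neg-antimono-< p<q)

infix 8 1-_

1-_ : ℝ → ℝ
1- x = record
  { lower = λ q → upper x (1ℚ ℚ.- q)
  ; upper = λ q → lower x (1ℚ ℚ.- q)
  ; lower-inhabited = let q , u = upper-inhabited x in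
      1ℚ ℚ.- q , subst (upper x) (sym (flip-flip q)) u
  ; upper-inhabited = let q , l = lower-inhabited x in
      1ℚ ℚ.- q , subst (lower x) (sym (flip-flip q)) l
  ; lower-closed = λ p<q → upper-closed x (flip-< p<q)
  ; upper-closed = λ p<q → lower-closed x (flip-< p<q)
  ; lower-open = λ {p} u → let q , q<1-p , u′ = upper-open x u in
      1ℚ ℚ.- q
      , subst (_< 1ℚ ℚ.- q) (flip-flip p) (flip-< q<1-p)
      , subst (upper x) (sym (flip-flip q)) u′
  ; upper-open = λ {q} l → let p , 1-q<p , l′ = lower-open x l in
      1ℚ ℚ.- p
      , subst (1ℚ ℚ.- p <_) (flip-flip q) (flip-< 1-q<p)
      , subst (lower x) (sym (flip-flip p)) l′
  ; disjoint = λ (u , l) → disjoint x (l , u)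
  ; located = λ p<q → swap (located x (flip-< p<q))
  }

-- An element of ℝ ∪ {-∞, +∞} is given by the rationals strictly below
-- it: none for -∞, all for +∞.  Unlike Dedekind cuts, these are closed
-- under arbitrary suprema and infima.

record ℝ̄ (ℓ : Level) : Set (lsuc ℓ) where
  field
    below : ℚ → Set ℓ
    below-closed : ∀ {p q} → p < q → below q → below p
    below-open : ∀ {p} → below p → ∃[ q ] (p < q × below q)

open ℝ̄ public

infix 4 _≤_

_≤_ : ℝ̄ ℓ → ℝ̄ ℓ′ → Set (ℓ ⊔ ℓ′)
x ≤ y = ∀ {q} → below x q → below y q

⌊_⌋ : ℝ → ℝ̄ 0ℓ
⌊ x ⌋ = record
  { below = lower x ; below-closed = lower-closed x ; below-open = lower-open x }

fromℚ̄ : ℚ → ℝ̄ 0ℓ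
fromℚ̄ q = ⌊ fromℚ q ⌋

fromℕ : ℕ → ℚ
fromℕ n = + n ℚ./ 1

sup : {I : Set i} → (I → ℝ̄ ℓ) → ℝ̄ (i ⊔ ℓ)
sup {I = I} f = record
  { below = λ q → Σ[ k ∈ I ] below (f k) q
  ; below-closed = λ p<q (k , b) → k , below-closed (f k) p<q b
  ; below-open = λ (k , b) → let q , p<q , b′ = below-open (f k) b in q , p<q , k , b′
  }

inf : {I : Set i} → (I → ℝ̄ ℓ) → ℝ̄ (i ⊔ ℓ)
inf {I = I} f = sup {I = Σ[ t ∈ ℚ ] (∀ (k : I) → fromℚ̄ t ≤ f k)} (fromℚ̄ ∘ proj₁)

sup-upper : {I : Set i} (f : I → ℝ̄ ℓ) → ∀ k → f k ≤ sup f
sup-upper f k b = k , b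

sup-least : {I : Set i} (f : I → ℝ̄ ℓ) (x : ℝ̄ ℓ′) → (∀ k → f k ≤ x) → sup f ≤ x
sup-least f x f≤x (k , b) = f≤x k b

inf-lower : {I : Set i} (f : I → ℝ̄ ℓ) → ∀ k → inf f ≤ f k
inf-lower f k ((t , t≤f) , q<t) = t≤f k q<t

inf-greatest : {I : Set i} (f : I → ℝ̄ ℓ) (x : ℝ̄ ℓ′) → (∀ k → x ≤ f k) → x ≤ inf f
inf-greatest f x x≤f b =
  let t , q<t , b′ = below-open x b
  in (t , λ k p<t → x≤f k (below-closed x p<t b′)) , q<t

infixl 7 _·_
infixl 6 _-ℚ_

-- Only for c > 0.
_·_ : ℚ → ℝ̄ ℓ → ℝ̄ ℓ
c · x = sup {I = Σ[ t ∈ ℚ ] below x t} λ (t , _) → fromℚ̄ (c ℚ.* t)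

_-ℚ_ : ℝ̄ ℓ → ℚ → ℝ̄ ℓ
x -ℚ r = sup {I = Σ[ t ∈ ℚ ] below x t} λ (t , _) → fromℚ̄ (t ℚ.- r)

-- Only for x > 0: 1/x is the supremum of 1/t over rational t > x.
inv : ℝ → ℝ̄ 0ℓ
inv x = sup {I = Σ[ t ∈ ℚ ] (ℚ.Positive t × upper x t)}
  λ (t , t>0 , _) → fromℚ̄ ((1/ t) {{ℚ.pos⇒nonZero t {{t>0}}}})

-- RootBound n p t says t ^ b ≤ n ^ a, where p = a / b in lowest terms
-- and b > 0; for t ≥ 0 and n ≥ 1, this means t ≤ n ^ p.
RootBound : ℕ → ℚ → ℚ → Set
RootBound n p t = bound (↥ p)
  where
  bound : ℤ → Set
  bound (+ k)    = t ^ℚ (↧ₙ p) ℚ.≤ fromℕ (n ℕ.^ k)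
  bound -[1+ k ] = t ^ℚ (↧ₙ p) ℚ.* fromℕ (n ℕ.^ suc k) ℚ.≤ 1ℚ

-- n ^ x for n ≥ 1, as the supremum of n ^ p over rational p < x.  The
-- value at n = 0 is irrelevant to asymptotic statements.
pow : ℕ → ℝ → ℝ̄ 0ℓ
pow n x = sup
  {I = Σ[ t ∈ ℚ ] (0ℚ ℚ.≤ t × Σ[ p ∈ ℚ ] (lower x p × RootBound n p t))}
  (fromℚ̄ ∘ proj₁)

-- Rational constants suffice: any positive real constant lies between
-- two positive rationals.

IsO[n^_] : ℝ → (ℕ → ℝ̄ ℓ) → Set ℓ
IsO[n^ x ] f = Σ[ c ∈ ℚ ] 0ℚ < c × ∃[ N ] ∀ n → N ℕ.≤ n → f n ≤ c · pow n x

IsΩ[n^_] : ℝ → (ℕ → ℝ̄ ℓ) → Set ℓ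
IsΩ[n^ x ] f = Σ[ c ∈ ℚ ] 0ℚ < c × ∃[ N ] ∀ n → N ℕ.≤ n → c · pow n x ≤ f n

IsΘ[n^_] : ℝ → (ℕ → ℝ̄ ℓ) → Set ℓ
IsΘ[n^ x ] f = IsO[n^ x ] f × IsΩ[n^ x ] f

record Graph : Set where
  field
    order : ℕ
    adj : Fin order → Fin order → Bool
    adj-sym : ∀ u v → adj u v ≡ adj v u
    adj-irrefl : ∀ v → adj v v ≡ false

open Graph public

Vertex : Graph → Set
Vertex G = Fin (order G)

Adj : (G : Graph) → Vertex G → Vertex G → Set
Adj G u v = T (adj G u v)

edges : (G : Graph) → List (Vertex G × Vertex G)
edges G = filter (λ (u , v) → (u Fin.<? v) ×-dec T? (adj G u v))
                 (cartesianProduct (allFin (order G)) (allFin (order G)))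

density : (G : Graph) → .{{ℕ.NonZero (order G)}} → ℚ
density G = + length (edges G) ℚ./ order G

-- H is isomorphic to a subgraph of G; likewise for induced subgraphs.
IsSubgraph : Graph → Graph → Set
IsSubgraph H G = Σ[ f ∈ (Vertex H → Vertex G) ]
  Injective _≡_ _≡_ f × (∀ u v → Adj H u v → Adj G (f u) (f v))

IsInducedSubgraph : Graph → Graph → Set
IsInducedSubgraph H G = Σ[ f ∈ (Vertex H → Vertex G) ]
  Injective _≡_ _≡_ f × (∀ u v → adj H u v ≡ adj G (f u) (f v))

Class : Set₁
Class = Graph → Set

-- Since induced subgraphs are taken up to isomorphism, this includes
-- closure under isomorphism.
Hereditary : Class → Set
Hereditary 𝒢 = ∀ G H → 𝒢 G → IsInducedSubgraph H G → 𝒢 H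

AdjOutside : (G : Graph) → Subset (order G) → Vertex G → Vertex G → Set
AdjOutside G X u v = u ∉ X × v ∉ X × Adj G u v

-- C is the vertex set of a component of G - X.
IsComponent : (G : Graph) → Subset (order G) → Subset (order G) → Set
IsComponent G X C =
  ∃[ v ] (v ∉ X × (∀ u → u ∈ C ⇔ Star (AdjOutside G X) v u))

IsBalancedSeparator : (G : Graph) → Subset (order G) → Set
IsBalancedSeparator G X =
  ∀ C → IsComponent G X C → 3 ℕ.* ∣ C ∣ ℕ.≤ 2 ℕ.* order G

-- The infimum is a minimum: the sizes are naturals, and V(G) itself is
-- a balanced separator.
s : Graph → ℝ̄ 0ℓ
s G = inf {I = Σ[ X ∈ Subset (order G) ] IsBalancedSeparator G X}
  λ (X , _) → fromℚ̄ (fromℕ ∣ X ∣)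

-- If 𝒢 has a graph on at most n vertices, the supremum is a maximum: it
-- is over naturals that are at most n.
sᶜ : Class → ℕ → ℝ̄ 0ℓ
sᶜ 𝒢 n = sup {I = Σ[ G ∈ Graph ] (𝒢 G × order G ℕ.≤ n)} λ (G , _) → s G

-- Within G P k u v: there is a walk of length at most k from u to v in G
-- all of whose vertices, except possibly u, satisfy P.
data Within (G : Graph) (P : Vertex G → Set) : ℕ → Vertex G → Vertex G → Set where
  stop : ∀ {k u} → Within G P k u u
  step : ∀ {k u v w} → Adj G u v → P v → Within G P k v w → Within G P (suc k) u w

-- H arises from G by contracting the fibres of φ.  Uncontracted vertices
-- are singleton fibres.  The contracted subgraphs may be taken to be
-- induced, since extra edges do not increase the radius.
record Contraction (r : ℕ) (G H : Graph) : Set where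
  field
    φ : Vertex G → Vertex H
    centre : Vertex H → Vertex G
    centre-fibre : ∀ h → φ (centre h) ≡ h
    radius : ∀ v → Within G (λ u → φ u ≡ φ v) r (centre (φ v)) v
    edge : ∀ h h′ → Adj H h h′ ⇔
      (h ≢ h′ × ∃[ u ] ∃[ v ] (φ u ≡ h × φ v ≡ h′ × Adj G u v))

IsShallowMinor : ℕ → Graph → Graph → Set
IsShallowMinor r G H = Σ[ G′ ∈ Graph ] (IsSubgraph G′ G × Contraction r G′ H)

∇ : ℕ → Graph → ℝ̄ 0ℓ
∇ r G = sup {I = Σ[ H ∈ Graph ] (IsShallowMinor r G H × ℕ.NonZero (order H))}
  λ (H , _ , nz) → fromℚ̄ (density H {{nz}})

∇ᶜ : Class → ℕ → ℝ̄ 0ℓ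
∇ᶜ 𝒢 r = sup {I = Σ[ G ∈ Graph ] 𝒢 G} λ (G , _) → ∇ r G

Admissible : ℝ → ℝ → Set₁
Admissible ε B = (𝒢 : Class) → Hereditary 𝒢 →
  IsΘ[n^ 1- ε ] (sᶜ 𝒢) → IsO[n^ B ] (∇ᶜ 𝒢)

B[_] : ℝ → ℝ̄ (lsuc 0ℓ)
B[ ε ] = inf {I = Σ[ B ∈ ℝ ] Admissible ε B} λ (B , _) → ⌊ B ⌋

-- Let x = 1 - ε, and let 𝒢 consist of the graphs all of whose induced
-- subgraphs, on k vertices say, have a balanced separator of size at
-- most a fixed constant times k ^ x.  This class is hereditary and has
-- separators of size O(n ^ x).  Since n ^ x is the supremum of n ^ p over
-- rational p < x, the rest only needs graphs for each such p, as long as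
-- the constants do not depend on p.
--
-- The separators are Ω(n ^ x): for fixed d with 1 / d ≤ ε, take a
-- (d + 1)-dimensional grid with side m and subdivide its edges so that it
-- has about n vertices, where m ^ d is about n ^ p.  A subgraph is cut
-- into small boxes by removing a sparse residue class of each coordinate.
-- Walks that correct one coordinate after another use every line of the
-- grid equally often, so that less than m ^ d / 6 vertices cannot
-- separate most of the grid.
--
-- The shallow minors are dense: if p = a / (a + e) < x, then 𝒢 contains
-- the complete graph on j ^ a vertices with each edge subdivided about
-- j ^ e times.  A subgraph on n vertices is separated by n / j ^ e
-- vertices that cut each edge once, or else by all j ^ a branch vertices.
-- Contracting stars of radius r = j ^ e gives back the complete graph, of
-- density about r ^ (a / e), and a / e tends to 1 / ε - 1 as p tends to x.

module Submission where

open import Defs hiding (_≤_)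
open import Algebra.Bundles using (module CommutativeRing)
open import Data.Bool.Base using (Bool; true; false; T; _∧_; _∨_; not)
open import Data.Bool.Properties using (T-∧; T-∨; T-≡; ∨-comm)
open import Data.Empty using (⊥; ⊥-elim)
open import Data.Fin.Base as Fin using (Fin; zero; suc; toℕ; fromℕ<; combine; remQuot; _↑ˡ_; _↑ʳ_)
import Data.Fin.Properties as Fin
open import Data.Fin.Subset using (Subset; _∈_; _∉_; ∣_∣)
open import Data.Fin.Subset.Properties using (∣p∣≤n)
open import Data.Integer.Base as ℤ using (ℤ; -[1+_])
import Data.Integer.Properties as ℤ
open import Data.List.Base as List using (List; length; filter; cartesianProduct; _++_)
import Data.List.Properties as List
open import Data.Nat.Base
open import Data.Nat.Coprimality using (Coprime; 1-coprimeTo)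
open import Data.Nat.DivMod
open import Data.Nat.Divisibility using (_∣_; divides; ∣m+n∣m⇒∣n; ∣⇒≤; m%n≡0⇒n∣m)
open import Data.Nat.Properties
open import Data.Nat.Tactic.RingSolver using (solve-∀)
open import Data.Product.Base using (∃; ∃-syntax; Σ-syntax; _×_; _,_; proj₁; proj₂)
open import Data.Product.Properties using (,-injective)
open import Data.Rational.Base as ℚ using (ℚ; mkℚ; 0ℚ; 1ℚ; ½; ↥_; ↧ₙ_)
import Data.Rational.Properties as ℚ
open import Data.Rational.Solver using (module +-*-Solver)
import Data.Rational.Unnormalised as ℚᵘ
import Data.Rational.Unnormalised.Properties as ℚᵘ
open import Data.Sum.Base using (_⊎_; inj₁; inj₂; [_,_]′)
open import Data.Unit.Base using (tt)
open import Data.Vec.Base as Vec using (Vec; []; _∷_; lookup; tabulate; insertAt; removeAt)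
open import Data.Vec.Properties as Vec using (lookup∘tabulate; []=⇒lookup; lookup⇒[]=; map-insertAt; insertAt-removeAt; removeAt-insertAt)
open import Function.Base using (_∘_; id)
open import Function.Bundles using (_↔_; Inverse; Equivalence; mk↔ₛ′; mk⇔)
open import Relation.Binary.Construct.Closure.ReflexiveTransitive using (Star; _◅_; _◅◅_; reverse) renaming (ε to stay)
open import Relation.Binary.Definitions using (tri<; tri≈; tri>; Decidable)
open import Relation.Binary.PropositionalEquality
open import Relation.Nullary.Decidable using (Dec; yes; no; isYes; toWitness; fromWitness; _×-dec_; _⊎-dec_; ¬?; T?; does; ¬¬-excluded-middle)
open import Relation.Nullary.Negation using (¬_; contradiction)

open import Algebra.Properties.Semiring.Exp (CommutativeRing.semiring ℚ.+-*-commutativeRing) using () renaming (_^_ to _^ℚ_)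
open import Algebra.Properties.CommutativeSemiring.Exp (CommutativeRing.commutativeSemiring ℚ.+-*-commutativeRing) using () renaming (^-distrib-* to ^ℚ-distrib-*)
open import Algebra.Properties.Semiring.Sum +-*-semiring
  using (sum; sum-syntax; sum-cong-≗; ∑-distrib-+; ∑-comm; *-distribˡ-sum)

-- Sums and counting over finite types

-- Both families are tight only at full size, yet membership asks for small separators of every
-- induced subgraph. In a grid with subdivision length `L`, boxes of side `j` give the requirement
-- that `j ^ d` is at most about `(L * j ^ (d + 1)) ^ p`. Since `p ≤ d / (d + 1)`, the ratio of the
-- two sides grows with `j`, so the full side `m` is the worst case; this is why `d` must be large
-- compared with `1 / ε`. In a subdivided complete graph the full number of branch vertices is the
-- worst case in the same way. Whether `1 - ε` is zero or positive is never decided. Membership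
-- therefore has a separate clause for separators of constant size, and the lower bound falls back
-- on a grid of side 1 when the exponent `p` is not positive. Roots are avoided throughout: bounds
-- with a rational exponent `a / b` are compared as integer powers.

∑-mono : ∀ {n} {f g : Fin n → ℕ} → (∀ i → f i ≤ g i) → sum f ≤ sum g
∑-mono {zero} f≤g = z≤n
∑-mono {suc n} f≤g = +-mono-≤ (f≤g zero) (∑-mono (f≤g ∘ suc))

∑-const : ∀ n c → ∑[ i < n ] c ≡ n * c
∑-const zero c = refl
∑-const (suc n) c = cong (_+_ c) (∑-const n c)

term≤∑ : ∀ {n} (f : Fin n → ℕ) i → f i ≤ sum f
term≤∑ f zero = m≤m+n _ _
term≤∑ f (suc i) = ≤-trans (term≤∑ (f ∘ suc) i) (m≤n+m _ (f zero))

minimum : ∀ {n} .{{_ : NonZero n}} (f : Fin n → ℕ) → ∃[ k ] ∀ i → f k ≤ f i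
minimum {suc zero} f = zero , λ { zero → ≤-refl }
minimum {suc (suc n)} f with k , k-min ← minimum (f ∘ suc) | ≤-total (f zero) (f (suc k))
... | inj₁ le = zero , λ { zero → ≤-refl ; (suc i) → ≤-trans le (k-min i) }
... | inj₂ ge = suc k , λ { zero → ge ; (suc i) → k-min i }

average : ∀ {n} .{{_ : NonZero n}} (f : Fin n → ℕ) → ∃[ k ] n * f k ≤ sum f
average {n} f with k , k-min ← minimum f =
  k , subst (_≤ sum f) (∑-const n (f k)) (∑-mono k-min)

∑-↑ : ∀ m n (f : Fin (m + n) → ℕ) →
  sum f ≡ ∑[ i < m ] f (i ↑ˡ n) + ∑[ j < n ] f (m ↑ʳ j)
∑-↑ zero n f = refl
∑-↑ (suc m) n f = trans (cong (_+_ (f zero)) (∑-↑ m n (f ∘ suc))) (sym (+-assoc (f zero) _ _))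

∑-combine : ∀ m n (f : Fin (m * n) → ℕ) → sum f ≡ ∑[ i < m ] ∑[ j < n ] f (combine i j)
∑-combine zero n f = refl
∑-combine (suc m) n f = trans (∑-↑ n (m * n) f)
  (cong (_+_ (∑[ j < n ] f (j ↑ˡ (m * n)))) (∑-combine m n (f ∘ (n ↑ʳ_))))

⟦_⟧ : Bool → ℕ
⟦ false ⟧ = 0
⟦ true ⟧ = 1

⟦⟧-mono : ∀ {a b} → (T a → T b) → ⟦ a ⟧ ≤ ⟦ b ⟧
⟦⟧-mono {false} imp = z≤n
⟦⟧-mono {true} {true} imp = ≤-refl
⟦⟧-mono {true} {false} imp = ⊥-elim (imp tt)

⟦⟧-T : ∀ {b} → T b → ⟦ b ⟧ ≡ 1
⟦⟧-T {true} _ = refl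

⟦⟧-¬T : ∀ {b} → ¬ T b → ⟦ b ⟧ ≡ 0
⟦⟧-¬T {false} _ = refl
⟦⟧-¬T {true} ¬t = ⊥-elim (¬t tt)

⟦⟧-∨ : ∀ a b → ⟦ a ∨ b ⟧ ≤ ⟦ a ⟧ + ⟦ b ⟧
⟦⟧-∨ false b = ≤-refl
⟦⟧-∨ true b = m≤m+n 1 _

∑-none : ∀ {n} (P : Fin n → Bool) → (∀ i → ¬ T (P i)) → ∑[ i < n ] ⟦ P i ⟧ ≡ 0
∑-none {zero} P none = refl
∑-none {suc n} P none rewrite ⟦⟧-¬T (none zero) = ∑-none (P ∘ suc) (none ∘ suc)

∑-some : ∀ {n} (P : Fin n → Bool) → 1 ≤ ∑[ i < n ] ⟦ P i ⟧ → ∃ (T ∘ P)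
∑-some {n} P pos with Fin.any? (λ i → T? (P i))
... | yes found = found
... | no ¬found = contradiction (sym (∑-none P (λ i p → ¬found (i , p)))) (<⇒≢ pos)

∑-unique : ∀ {n} (P : Fin n → Bool) → (∀ i j → T (P i) → T (P j) → i ≡ j) →
  ∑[ i < n ] ⟦ P i ⟧ ≤ 1
∑-unique {zero} P unique = z≤n
∑-unique {suc n} P unique with T? (P zero)
... | yes p rewrite ⟦⟧-T p
    | ∑-none (P ∘ suc) (λ i q → contradiction (unique zero (suc i) p q) λ ()) = ≤-refl
... | no ¬p rewrite ⟦⟧-¬T ¬p = ∑-unique (P ∘ suc) (λ i j p q → Fin.suc-injective (unique (suc i) (suc j) p q))

-- Double counting of the pairs of a vertex and its code: each vertex in `P` contributes at least
-- one, each code at most one.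
∑-pigeonhole : ∀ {n K} (P : Fin n → Bool) (code : Fin n → Fin K) →
  (∀ u v → T (P u) → T (P v) → code u ≡ code v → u ≡ v) → ∑[ v < n ] ⟦ P v ⟧ ≤ K
∑-pigeonhole {n} {K} P code inj = begin
  ∑[ v < n ] ⟦ P v ⟧                     ≤⟨ ∑-mono (λ v → ≤-trans (⟦⟧-mono (at v)) (term≤∑ (λ k → ⟦ hit v k ⟧) (code v))) ⟩
  ∑[ v < n ] ∑[ k < K ] ⟦ hit v k ⟧      ≡⟨ ∑-comm (λ v k → ⟦ hit v k ⟧) ⟩
  ∑[ k < K ] ∑[ v < n ] ⟦ hit v k ⟧      ≤⟨ ∑-mono (λ k → ∑-unique (λ v → hit v k) (unique k)) ⟩
  ∑[ k < K ] 1                           ≡⟨ ∑-const K 1 ⟩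
  K * 1                                  ≡⟨ *-identityʳ K ⟩
  K                                      ∎
  where
  open ≤-Reasoning
  hit : Fin n → Fin K → Bool
  hit v k = P v ∧ isYes (code v Fin.≟ k)
  at : ∀ v → T (P v) → T (hit v (code v))
  at v p = Equivalence.from T-∧ (p , fromWitness refl)
  unique : ∀ k u v → T (hit u k) → T (hit v k) → u ≡ v
  unique k u v hu hv =
    let pu , cu = Equivalence.to T-∧ hu
        pv , cv = Equivalence.to T-∧ hv
    in inj u v pu pv (trans (toWitness cu) (sym (toWitness cv)))

infix 4 _∈ᵇ_

_∈ᵇ_ : ∀ {n} → Fin n → Subset n → Bool
v ∈ᵇ p = lookup p v

∈⇒∈ᵇ : ∀ {n} {v : Fin n} {p} → v ∈ p → T (v ∈ᵇ p)
∈⇒∈ᵇ v∈p = Equivalence.from T-≡ ([]=⇒lookup v∈p)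

∈ᵇ⇒∈ : ∀ {n} {v : Fin n} {p} → T (v ∈ᵇ p) → v ∈ p
∈ᵇ⇒∈ {v = v} {p} t = lookup⇒[]= v p (Equivalence.to T-≡ t)

∈-tabulate : ∀ {n} (f : Fin n → Bool) {v} → T (f v) → v ∈ tabulate f
∈-tabulate f {v} t = ∈ᵇ⇒∈ (subst T (sym (lookup∘tabulate f v)) t)

∈-tabulate⁻ : ∀ {n} (f : Fin n → Bool) {v} → v ∈ tabulate f → T (f v)
∈-tabulate⁻ f {v} v∈ = subst T (lookup∘tabulate f v) (∈⇒∈ᵇ v∈)

∣∣-∑ : ∀ {n} (p : Subset n) → ∣ p ∣ ≡ ∑[ v < n ] ⟦ v ∈ᵇ p ⟧
∣∣-∑ [] = refl
∣∣-∑ (true ∷ p) = cong suc (∣∣-∑ p)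
∣∣-∑ (false ∷ p) = ∣∣-∑ p

∣tabulate∣ : ∀ {n} (f : Fin n → Bool) → ∣ tabulate f ∣ ≡ ∑[ v < n ] ⟦ f v ⟧
∣tabulate∣ f = trans (∣∣-∑ (tabulate f)) (sum-cong-≗ (λ v → cong ⟦_⟧ (lookup∘tabulate f v)))

∣∣-pigeonhole : ∀ {n K} (p : Subset n) (code : Fin n → Fin K) →
  (∀ {u v} → u ∈ p → v ∈ p → code u ≡ code v → u ≡ v) → ∣ p ∣ ≤ K
∣∣-pigeonhole p code inj = subst (_≤ _) (sym (∣∣-∑ p))
  (∑-pigeonhole (_∈ᵇ p) code (λ _ _ u∈ v∈ → inj (∈ᵇ⇒∈ u∈) (∈ᵇ⇒∈ v∈)))

total : ∀ {A : Set} {n} → Fin n ↔ A → (A → ℕ) → ℕ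
total e f = sum (f ∘ Inverse.to e)

_×ᶠ_ : ∀ {A B : Set} {m n} → Fin m ↔ A → Fin n ↔ B → Fin (m * n) ↔ (A × B)
_×ᶠ_ {m = m} {n} e e′ = mk↔ₛ′
  (λ k → let i , j = remQuot {m} n k in Inverse.to e i , Inverse.to e′ j)
  (λ (a , b) → combine (Inverse.from e a) (Inverse.from e′ b))
  (λ (a , b) → cong₂ _,_
    (trans (cong (Inverse.to e ∘ proj₁) (Fin.remQuot-combine {m} {n} _ _)) (Inverse.strictlyInverseˡ e a))
    (trans (cong (Inverse.to e′ ∘ proj₂) (Fin.remQuot-combine {m} {n} _ _)) (Inverse.strictlyInverseˡ e′ b)))
  (λ k → trans
    (cong₂ combine (Inverse.strictlyInverseʳ e _) (Inverse.strictlyInverseʳ e′ _))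
    (Fin.combine-remQuot {m} n k))

total-×ᶠ : ∀ {A B : Set} {m n} (e : Fin m ↔ A) (e′ : Fin n ↔ B) (f : A × B → ℕ) →
  total (e ×ᶠ e′) f ≡ total e (λ a → total e′ (λ b → f (a , b)))
total-×ᶠ {m = m} {n} e e′ f = trans (∑-combine m n _)
  (sum-cong-≗ λ i → sum-cong-≗ λ j →
    cong (λ (i , j) → f (Inverse.to e i , Inverse.to e′ j)) (Fin.remQuot-combine {m} {n} i j))

Finᶠ : ∀ n → Fin n ↔ Fin n
Finᶠ n = mk↔ₛ′ id id (λ _ → refl) (λ _ → refl)

Vecᶠ : ∀ m d → Fin (m ^ d) ↔ Vec (Fin m) d
Vecᶠ m zero = mk↔ₛ′ (λ _ → []) (λ _ → zero) (λ { [] → refl }) (λ { zero → refl })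
Vecᶠ m (suc d) = mk↔ₛ′
  (λ k → let a , u = Inverse.to e k in a ∷ u)
  (λ { (a ∷ u) → Inverse.from e (a , u) })
  (λ { (a ∷ u) → cong (λ (a , u) → a ∷ u) (Inverse.strictlyInverseˡ e (a , u)) })
  (Inverse.strictlyInverseʳ e)
  where
  e : Fin (m * m ^ d) ↔ (Fin m × Vec (Fin m) d)
  e = Finᶠ m ×ᶠ Vecᶠ m d

total-Vecᶠ : ∀ m d (f : Vec (Fin m) (suc d) → ℕ) →
  total (Vecᶠ m (suc d)) f ≡ ∑[ a < m ] total (Vecᶠ m d) (λ u → f (a ∷ u))
total-Vecᶠ m d f = total-×ᶠ (Finᶠ m) (Vecᶠ m d) (λ (a , u) → f (a ∷ u))

-- Graphs on finite types and their separators

to-injective : ∀ {A B : Set} (e : A ↔ B) {a b} → Inverse.to e a ≡ Inverse.to e b → a ≡ b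
to-injective e {a} {b} eq = trans (sym (Inverse.strictlyInverseʳ e a))
  (trans (cong (Inverse.from e) eq) (Inverse.strictlyInverseʳ e b))

from-injective : ∀ {A B : Set} (e : A ↔ B) {a b} → Inverse.from e a ≡ Inverse.from e b → a ≡ b
from-injective e {a} {b} eq = trans (sym (Inverse.strictlyInverseˡ e a))
  (trans (cong (Inverse.to e) eq) (Inverse.strictlyInverseˡ e b))

T-does : ∀ {P : Set} (P? : Dec P) → T (does P?) → P
T-does (yes p) _ = p

does-T : ∀ {P : Set} (P? : Dec P) → P → T (does P?)
does-T (yes _) _ = tt
does-T (no ¬p) p = ¬p p

module _ {A : Set} (Step : A → A → Set) where

  -- Non-adjacency is forgotten: bounding the separators of an induced subgraph from above only
  -- needs that its edges are steps.
  record Embedding (H : Graph) : Set where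
    field
      pos : Vertex H → A
      pos-injective : ∀ {u v} → pos u ≡ pos v → u ≡ v
      pos-step : ∀ u v → Adj H u v → Step (pos u) (pos v) ⊎ Step (pos v) (pos u)

  module _ {n} (e : Fin n ↔ A) (step? : Decidable Step) (step-irrefl : ∀ a → ¬ Step a a) where

    symmetricGraph : Graph
    symmetricGraph = record
      { order = n
      ; adj = λ u v → does (step? (to u) (to v)) ∨ does (step? (to v) (to u))
      ; adj-sym = λ u v → ∨-comm (does (step? (to u) (to v))) _
      ; adj-irrefl = λ v → irrefl (step? (to v) (to v)) (step-irrefl (to v))
      }
      where
      open Inverse e using (to)
      irrefl : ∀ {P : Set} (P? : Dec P) → ¬ P → does P? ∨ does P? ≡ false
      irrefl (yes p) ¬p = contradiction p ¬p
      irrefl (no _) _ = refl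

    Adj⇒Step : ∀ {u v} → Adj symmetricGraph u v →
      Step (Inverse.to e u) (Inverse.to e v) ⊎ Step (Inverse.to e v) (Inverse.to e u)
    Adj⇒Step t with Equivalence.to T-∨ t
    ... | inj₁ p = inj₁ (T-does (step? _ _) p)
    ... | inj₂ p = inj₂ (T-does (step? _ _) p)

    Step⇒Adj : ∀ {a b} → Step a b ⊎ Step b a →
      Adj symmetricGraph (Inverse.from e a) (Inverse.from e b)
    Step⇒Adj {a} {b} st rewrite Inverse.strictlyInverseˡ e a | Inverse.strictlyInverseˡ e b
      with st
    ... | inj₁ p = Equivalence.from T-∨ (inj₁ (does-T (step? _ _) p))
    ... | inj₂ p = Equivalence.from T-∨ (inj₂ (does-T (step? _ _) p))

    induced⇒Embedding : ∀ {H} → IsInducedSubgraph H symmetricGraph → Embedding H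
    induced⇒Embedding (f , f-inj , f-adj) = record
      { pos = Inverse.to e ∘ f
      ; pos-injective = f-inj ∘ to-injective e
      ; pos-step = λ u v uv → Adj⇒Step (subst T (f-adj u v) uv)
      }

  -- A label that is constant along steps avoiding the cut is constant on each component, so a
  -- component is no larger than a label class. Components need not be determined exactly.
  module Cut {H : Graph} (E : Embedding H) (cut : A → Bool) {L : Set} (label : A → L)
    (preserve : ∀ {a b} → Step a b → ¬ T (cut a) → ¬ T (cut b) → label a ≡ label b) where
    open Embedding E

    cutset : Subset (order H)
    cutset = tabulate (cut ∘ pos)

    outside : ∀ {v} → v ∉ cutset → ¬ T (cut (pos v))
    outside v∉ t = v∉ (∈-tabulate (cut ∘ pos) t)

    walk-label : ∀ {u v} → Star (AdjOutside H cutset) u v → label (pos u) ≡ label (pos v)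
    walk-label stay = refl
    walk-label {u} (_◅_ {j = v} (u∉ , v∉ , uv) walk) with pos-step u v uv
    ... | inj₁ st = trans (preserve st (outside u∉) (outside v∉)) (walk-label walk)
    ... | inj₂ st = trans (sym (preserve st (outside v∉) (outside u∉))) (walk-label walk)

    component-label : ∀ {C} ((v , _) : IsComponent H cutset C) {u} → u ∈ C → label (pos u) ≡ label (pos v)
    component-label (v , _ , reach) u∈ = sym (walk-label (Equivalence.to (reach _) u∈))

    component≤ : ∀ {B : Set} {K} (e : Fin K ↔ B) (code : A → B) {C} ((v , _) : IsComponent H cutset C) →
      (∀ {a b} → label a ≡ label (pos v) → label b ≡ label (pos v) → code a ≡ code b → a ≡ b) → ∣ C ∣ ≤ K
    component≤ e code {C} comp inj = ∣∣-pigeonhole C (Inverse.from e ∘ code ∘ pos)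
      (λ u∈ v∈ eq → pos-injective (inj (component-label comp u∈) (component-label comp v∈)
        (from-injective e eq)))

  order≤ : ∀ {H K} (e : Fin K ↔ A) → Embedding H → order H ≤ K
  order≤ e E = Fin.injective⇒≤ {f = Inverse.from e ∘ pos} (λ eq → pos-injective (from-injective e eq))
    where
    open Embedding E

-- Cutting paths at a residue class

suc/ : ∀ y w .{{_ : NonZero w}} → ¬ suc y % w ≡ 0 → y / w ≡ suc y / w
suc/ y w ≢0 = sym (begin
  suc y / w                              ≡⟨ cong (λ t → suc t / w) (m≡m%n+[m/n]*n y w) ⟩
  (suc (y % w) + y / w * w) / w          ≡⟨ +-distrib-/-∣ʳ (suc (y % w)) (divides (y / w) refl) ⟩
  suc (y % w) / w + (y / w * w) / w      ≡⟨ cong₂ _+_ (m<n⇒m/n≡0 (≤∧≢⇒< (m%n<n y w) ≢w)) (m*n/n≡m (y / w) w) ⟩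
  y / w                                  ∎)
  where
  open ≡-Reasoning
  ≢w : suc (y % w) ≢ w
  ≢w eq = ≢0 (begin
    suc y % w                      ≡⟨ cong (λ t → suc t % w) (m≡m%n+[m/n]*n y w) ⟩
    (suc (y % w) + y / w * w) % w  ≡⟨ [m+kn]%n≡m%n (suc (y % w)) (y / w) w ⟩
    suc (y % w) % w                ≡⟨ cong (_% w) eq ⟩
    w % w                          ≡⟨ n%n≡0 w ⟩
    0                              ∎)

multiple<⇒≡0 : ∀ {w t} → w ∣ t → t < w → t ≡ 0
multiple<⇒≡0 {t = zero} _ _ = refl
multiple<⇒≡0 {t = suc t} w∣t t<w = contradiction (∣⇒≤ w∣t) (<⇒≱ t<w)

residue-unique : ∀ y {w} .{{_ : NonZero w}} {r r′} → r < w → r′ < w →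
  (y + r) % w ≡ 0 → (y + r′) % w ≡ 0 → r ≡ r′
residue-unique y {w} {r} {r′} r< r′< eq eq′ =
  [ (λ le → ordered le r′< eq eq′) , (λ ge → sym (ordered ge r< eq′ eq)) ]′ (≤-total r r′)
  where
  ordered : ∀ {a b} → a ≤ b → b < w → (y + a) % w ≡ 0 → (y + b) % w ≡ 0 → a ≡ b
  ordered {a} {b} a≤b b<w ea eb = ≤-antisym a≤b (m∸n≡0⇒m≤n
    (multiple<⇒≡0
      (∣m+n∣m⇒∣n (subst (w ∣_) (sym (trans (+-assoc y a (b ∸ a)) (cong (y +_) (m+[n∸m]≡n a≤b)))) (m%n≡0⇒n∣m (y + b) w eb))
        (m%n≡0⇒n∣m (y + a) w ea))
      (≤-<-trans (m∸n≤m b a) b<w)))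

-- The shift starts at `suc z` rather than `z` so that, on an arm of length at least `w`, offset 0
-- has quotient 0 unless it is removed, while the last offset always has a positive quotient.
residueCut : ∀ (w : ℕ) .{{_ : NonZero w}} → Fin w → ℕ → Bool
residueCut w r z = does ((suc z + toℕ r) % w ≟ 0)

-- The `w` residue classes are disjoint, so an average one has at most `n / w` elements.
thin-residue : ∀ {n} (z : Fin n → ℕ) w .{{_ : NonZero w}} →
  ∃[ r ] w * ∑[ v < n ] ⟦ residueCut w r (z v) ⟧ ≤ n
thin-residue {n} z w with r , small ← average (λ r → ∑[ v < n ] ⟦ residueCut w r (z v) ⟧) = r , (begin
  w * ∑[ v < n ] ⟦ residueCut w r (z v) ⟧       ≤⟨ small ⟩
  ∑[ r < w ] ∑[ v < n ] ⟦ residueCut w r (z v) ⟧ ≡⟨ ∑-comm (λ r v → ⟦ residueCut w r (z v) ⟧) ⟩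
  ∑[ v < n ] ∑[ r < w ] ⟦ residueCut w r (z v) ⟧ ≤⟨ ∑-mono (λ v → ∑-unique (λ r → residueCut w r (z v)) (unique v)) ⟩
  ∑[ v < n ] 1                                  ≡⟨ ∑-const n 1 ⟩
  n * 1                                         ≡⟨ *-identityʳ n ⟩
  n                                             ∎)
  where
  open ≤-Reasoning
  unique : ∀ v r r′ → T (residueCut w r (z v)) → T (residueCut w r′ (z v)) → r ≡ r′
  unique v r r′ t t′ = Fin.toℕ-injective (residue-unique (suc (z v)) (Fin.toℕ<n r) (Fin.toℕ<n r′)
    (T-does (_ ≟ 0) t) (T-does (_ ≟ 0) t′))

-- Subdivided grids

insertAt-injective : ∀ {A : Set} {n} {xs ys : Vec A n} {x y} i →
  insertAt xs i x ≡ insertAt ys i y → xs ≡ ys × x ≡ y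
insertAt-injective {xs = xs} {ys} {x} {y} i eq =
  trans (sym (removeAt-insertAt xs i x)) (trans (cong (λ v → removeAt v i) eq) (removeAt-insertAt ys i y)) ,
  trans (sym (Vec.insertAt-lookup xs i x)) (trans (cong (λ v → lookup v i) eq) (Vec.insertAt-lookup ys i y))

map-jointly-injective : ∀ {A B C : Set} (f : A → B) (g : A → C) →
  (∀ {a b} → f a ≡ f b → g a ≡ g b → a ≡ b) →
  ∀ {n} {u v : Vec A n} → Vec.map f u ≡ Vec.map f v → Vec.map g u ≡ Vec.map g v → u ≡ v
map-jointly-injective f g inj {u = []} {[]} _ _ = refl
map-jointly-injective f g inj {u = a ∷ u} {b ∷ v} fe ge =
  let f₀ , fs = Vec.∷-injective fe
      g₀ , gs = Vec.∷-injective ge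
  in cong₂ _∷_ (inj f₀ g₀) (map-jointly-injective f g inj fs gs)

%/-injective : ∀ w .{{_ : NonZero w}} {a b} → a / w ≡ b / w → a % w ≡ b % w → a ≡ b
%/-injective w {a} {b} q r = trans (m≡m%n+[m/n]*n a w)
  (trans (cong₂ (λ r q → r + q * w) r q) (sym (m≡m%n+[m/n]*n b w)))

quotient-cancel : ∀ L .{{_ : NonZero L}} {q q′ t t′} → t < L → t′ < L → t + q * L ≡ t′ + q′ * L → q ≡ q′
quotient-cancel L t< t′< eq = trans (sym (quot t<)) (trans (cong (_/ L) eq) (quot t′<))
  where
  quot : ∀ {q t} → t < L → (t + q * L) / L ≡ q
  quot {q} {t} t< = trans (+-distrib-/-∣ʳ t (divides q refl)) (cong₂ _+_ (m<n⇒m/n≡0 t<) (m*n/n≡m q L))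

-- The hypotheses place `c + L * q` and `c + L * q′` less than `L` apart, while their difference is
-- a multiple of `L`. To avoid subtraction, the remaining parts of both numbers are added to each
-- side.
block-injective : ∀ w L c .{{_ : NonZero w}} .{{_ : NonZero L}} {q q′} →
  (c + L * q) / w ≡ (c + L * q′) / w → (c + L * q) % w / L ≡ (c + L * q′) % w / L → q ≡ q′
block-injective w L c {q} {q′} block sub =
  quotient-cancel L (m%n<n ρ′ L) (m%n<n ρ L) (+-cancelˡ-≡ c _ _ (+-cancelʳ-≡ (ρ % L + (ρ / L * L + B)) _ _ (begin
    (c + (ρ′ % L + q * L)) + (ρ % L + (ρ / L * L + B))    ≡⟨ shuffle c (ρ′ % L) (q * L) _ ⟩
    (c + q * L) + (ρ′ % L + (ρ % L + (ρ / L * L + B)))    ≡⟨ cong (_+ (ρ′ % L + (ρ % L + (ρ / L * L + B)))) (trans (cong (c +_) (*-comm q L)) (expand q)) ⟩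
    (ρ % L + (ρ / L * L + B)) + (ρ′ % L + (ρ % L + (ρ / L * L + B)))
      ≡⟨ cong (λ t → (ρ % L + (ρ / L * L + B)) + t) (swap (ρ′ % L) (ρ % L) _) ⟩
    (ρ % L + (ρ / L * L + B)) + (ρ % L + (ρ′ % L + (ρ / L * L + B)))
      ≡⟨ cong₂ (λ e B′ → (ρ % L + (ρ / L * L + B)) + (ρ % L + (ρ′ % L + (e * L + B′ * w)))) sub block ⟩
    (ρ % L + (ρ / L * L + B)) + (ρ % L + (ρ′ % L + (ρ′ / L * L + (c + L * q′) / w * w)))
      ≡⟨ cong (λ t → (ρ % L + (ρ / L * L + B)) + (ρ % L + t)) (sym (trans (cong (c +_) (*-comm q′ L)) (expand q′))) ⟩
    (ρ % L + (ρ / L * L + B)) + (ρ % L + (c + q′ * L))    ≡⟨ rotate _ (ρ % L) c (q′ * L) ⟩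
    (c + (ρ % L + q′ * L)) + (ρ % L + (ρ / L * L + B))    ∎)))
  where
  open ≡-Reasoning
  ρ = (c + L * q) % w
  ρ′ = (c + L * q′) % w
  B = (c + L * q) / w * w
  expand : ∀ q → c + L * q ≡ (c + L * q) % w % L + ((c + L * q) % w / L * L + (c + L * q) / w * w)
  expand q = trans (m≡m%n+[m/n]*n (c + L * q) w)
    (trans (cong (_+ (c + L * q) / w * w) (m≡m%n+[m/n]*n ((c + L * q) % w) L))
      (+-assoc ((c + L * q) % w % L) _ _))
  shuffle : ∀ a b c d → (a + (b + c)) + d ≡ (a + c) + (b + d)
  shuffle = solve-∀
  swap : ∀ a b c → a + (b + c) ≡ b + (a + c)
  swap = solve-∀
  rotate : ∀ x a b c → x + (a + (b + c)) ≡ (b + (a + c)) + x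
  rotate = solve-∀

-- The d+1-dimensional grid with side m, each edge subdivided into L
-- edges, and each branch vertex expanded into a clique with one vertex
-- for each direction.  Then the axis-parallel lines are disjoint paths:
-- (i , ρ , z) is the z-th vertex of the line in direction i whose other
-- coordinates are ρ.
module Grid (d m L : ℕ) where

  Position : Set
  Position = Fin (suc d) × Vec (Fin m) d × Fin (m * L)

  positions : Fin (suc d * (m ^ d * (m * L))) ↔ Position
  positions = Finᶠ (suc d) ×ᶠ (Vecᶠ m d ×ᶠ Finᶠ (m * L))

  -- A height is `q * L + o`, with `q` the last branch vertex passed and `o` the offset from it. The
  -- `L - 1` heights after the last branch vertex of a line form a pendant path, which keeps
  -- `Position` a product.
  point : Position → Vec (Fin m) (suc d)
  point (i , ρ , z) = insertAt ρ i (proj₁ (remQuot {m} L z))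

  offset : Position → ℕ
  offset (i , ρ , z) = toℕ (proj₂ (remQuot {m} L z))

  Along Turn Step : Position → Position → Set
  Along (i , ρ , z) (i′ , ρ′ , z′) = i ≡ i′ × ρ ≡ ρ′ × toℕ z′ ≡ suc (toℕ z)
  Turn a b = proj₁ a ≢ proj₁ b × offset a ≡ 0 × offset b ≡ 0 × point a ≡ point b
  Step a b = Along a b ⊎ Turn a b

  step? : Decidable Step
  step? a@(i , ρ , z) b@(i′ , ρ′ , z′) =
    ((i Fin.≟ i′) ×-dec Vec.≡-dec Fin._≟_ ρ ρ′ ×-dec (toℕ z′ ≟ suc (toℕ z))) ⊎-dec
    (¬? (i Fin.≟ i′) ×-dec (offset a ≟ 0) ×-dec (offset b ≟ 0) ×-dec Vec.≡-dec Fin._≟_ (point a) (point b))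

  step-irrefl : ∀ a → ¬ Step a a
  step-irrefl a (inj₁ (_ , _ , eq)) = 1+n≢n (sym eq)
  step-irrefl a (inj₂ (i≢i , _)) = i≢i refl

  grid : Graph
  grid = symmetricGraph Step positions step? step-irrefl

  position-value : ∀ (z : Fin (m * L)) →
    toℕ z ≡ L * toℕ (proj₁ (remQuot {m} L z)) + toℕ (proj₂ (remQuot {m} L z))
  position-value z = trans (cong toℕ (sym (Fin.combine-remQuot {m} L z)))
    (Fin.toℕ-combine (proj₁ (remQuot {m} L z)) _)

  module _ .{{_ : NonZero L}} {H} (E : Embedding Step H) (w J : ℕ) .{{_ : NonZero w}} (w≤JL : w ≤ J * L) where
    open Embedding E

    height : Position → ℕ
    height (_ , _ , z) = toℕ z

    module _ (r : Fin w) where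

      shift block : ℕ → ℕ
      shift y = suc y + toℕ r
      block y = shift y / w

      label : Position → Vec ℕ (suc d)
      label (i , ρ , z) = insertAt (Vec.map (λ q → block (L * toℕ q)) ρ) i (block (toℕ z))

      preserve : ∀ {a b} → Step a b → ¬ T (residueCut w r (height a)) → ¬ T (residueCut w r (height b)) →
        label a ≡ label b
      preserve {i , ρ , z} {_ , _ , z′} (inj₁ (refl , refl , eq)) _ z′∉ =
        cong (insertAt _ i) (trans (suc/ (shift (toℕ z)) w λ eq0 → z′∉ (does-T (_ ≟ 0) (subst (λ y → shift y % w ≡ 0) (sym eq) eq0)))
          (cong block (sym eq)))
      -- At offset 0 the label depends on the point alone, whatever the direction, so turns never
      -- have to be cut.
      preserve {a} {b} (inj₂ (_ , oa , ob , eq)) _ _ = trans (label-point a oa) (trans (cong (Vec.map _) eq) (sym (label-point b ob)))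
        where
        label-point : ∀ a → offset a ≡ 0 → label a ≡ Vec.map (λ q → block (L * toℕ q)) (point a)
        label-point (i , ρ , z) o≡0 = trans
          (cong (insertAt _ i ∘ block) (trans (position-value z) (trans (cong (_+_ _) o≡0) (+-identityʳ _))))
          (sym (map-insertAt (λ q → block (L * toℕ q)) _ ρ i))

      -- Branch heights are `L` apart, so a block of `w ≤ J * L` heights meets at most `J` of them.
      column : Fin m → Fin J
      column q = fromℕ< (m<n*o⇒m/o<n {shift (L * toℕ q) % w} {J} {L} (<-≤-trans (m%n<n _ w) w≤JL))

      code : Position → Fin (suc d) × Fin w × Vec (Fin J) d
      code (i , ρ , z) = i , fromℕ< (m%n<n (shift (toℕ z)) w) , Vec.map column ρ

      code-injective : ∀ {a b} → label a ≡ label b → code a ≡ code b → a ≡ b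
      code-injective {i , ρ , z} {i′ , ρ′ , z′} le ce with ,-injective ce
      ... | refl , ce′ with ,-injective ce′ | insertAt-injective i le
      ... | residue , columns | blocks , same =
        cong₂ (λ ρ z → i , ρ , z)
          (map-jointly-injective _ column column-injective blocks columns)
          (Fin.toℕ-injective (suc-injective (+-cancelʳ-≡ (toℕ r) _ _ (%/-injective w same (Fin.fromℕ<-injective _ _ _ _ residue)))))
        where
        commute : ∀ q → shift (L * toℕ q) ≡ (suc (toℕ r)) + L * toℕ q
        commute q = cong suc (+-comm _ (toℕ r))
        column-injective : ∀ {q q′} → block (L * toℕ q) ≡ block (L * toℕ q′) → column q ≡ column q′ → q ≡ q′
        column-injective {q} {q′} be ce = Fin.toℕ-injective (block-injective w L (suc (toℕ r))
          (subst₂ (λ a b → a / w ≡ b / w) (commute q) (commute q′) be)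
          (subst₂ (λ a b → a % w / L ≡ b % w / L) (commute q) (commute q′) (Fin.fromℕ<-injective _ _ _ _ ce)))

    -- Within a box, a vertex is determined by its direction, its height modulo `w` and one of `J`
    -- columns for each of the `d` other coordinates; the hypothesis bounds the product of these
    -- numbers. The same residue serves all directions, so a single averaging over all heights
    -- bounds the cut.
    grid-separator : 3 * (suc d * (w * J ^ d)) ≤ 2 * order H →
      ∃[ X ] (IsBalancedSeparator H X × w * ∣ X ∣ ≤ order H)
    grid-separator small with r , thin ← thin-residue (height ∘ pos) w =
      cutset ,
      (λ C comp → ≤-trans (*-monoʳ-≤ 3 (component≤ (Finᶠ (suc d) ×ᶠ (Finᶠ w ×ᶠ Vecᶠ J d)) (code r) comp
        (λ la lb → code-injective r (trans la (sym lb))))) small) ,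
      subst (λ t → w * t ≤ order H) (sym (∣tabulate∣ (residueCut w r ∘ height ∘ pos))) thin
      where open Cut Step E (residueCut w r ∘ height) (label r) (preserve r)

-- Lower bound for separators of grids

-- cost f u v adds up f over the directions k and the points where the
-- walk from u to v that corrects the coordinates in increasing order
-- is about to correct coordinate k.
cost : ∀ {m D} → (Fin D → Vec (Fin m) D → ℕ) → Vec (Fin m) D → Vec (Fin m) D → ℕ
cost f [] [] = 0
cost f (a ∷ u) (b ∷ v) = f zero (a ∷ u) + cost (λ k w → f (suc k) (b ∷ w)) u v

total-cost : ∀ m D (f : Fin D → Vec (Fin m) D → ℕ) →
  total (Vecᶠ m D) (λ u → total (Vecᶠ m D) (cost f u)) ≡ m ^ D * ∑[ k < D ] total (Vecᶠ m D) (f k)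
total-cost m zero f = refl
total-cost m (suc D) f = begin
  total V′ (λ u → total V′ (cost f u))
    ≡⟨ trans (total-Vecᶠ m D (λ u → total V′ (cost f u))) (sum-cong-≗ λ a → sum-cong-≗ λ u → total-Vecᶠ m D (cost f (a ∷ Inverse.to V u))) ⟩
  ∑[ a < m ] total V (λ u → ∑[ b < m ] total V (λ v → f zero (a ∷ u) + cost (f′ b) u v))
    ≡⟨ sum-cong-≗ (λ a → trans (sum-cong-≗ (λ u → split a (Inverse.to V u)))
         (∑-distrib-+ (λ u → m * (m ^ D * f zero (a ∷ Inverse.to V u))) (λ u → c (Inverse.to V u)))) ⟩
  ∑[ a < m ] (total V (λ u → m * (m ^ D * f zero (a ∷ u))) + total V c)
    ≡⟨ ∑-distrib-+ {m} (λ a → total V (λ u → m * (m ^ D * f zero (a ∷ u)))) (λ _ → total V c) ⟩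
  ∑[ a < m ] total V (λ u → m * (m ^ D * f zero (a ∷ u))) + ∑[ a < m ] total V c
    ≡⟨ cong₂ _+_ first second ⟩
  m ^ suc D * total V′ (f zero) + m ^ suc D * ∑[ k < D ] total V′ (f (suc k))
    ≡⟨ *-distribˡ-+ (m ^ suc D) _ _ ⟨
  m ^ suc D * (total V′ (f zero) + ∑[ k < D ] total V′ (f (suc k))) ∎
  where
  open ≡-Reasoning
  V = Vecᶠ m D
  V′ = Vecᶠ m (suc D)
  f′ : Fin m → Fin D → Vec (Fin m) D → ℕ
  f′ b k w = f (suc k) (b ∷ w)
  c : Vec (Fin m) D → ℕ
  c u = ∑[ b < m ] total V (cost (f′ b) u)
  split : ∀ a u → ∑[ b < m ] total V (λ v → f zero (a ∷ u) + cost (f′ b) u v) ≡ m * (m ^ D * f zero (a ∷ u)) + c u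
  split a u = begin
    ∑[ b < m ] total V (λ v → f₀ + cost (f′ b) u v)
      ≡⟨ sum-cong-≗ (λ b → trans (∑-distrib-+ (λ _ → f₀) (cost (f′ b) u ∘ Inverse.to V)) (cong (_+ total V (cost (f′ b) u)) (∑-const (m ^ D) f₀))) ⟩
    ∑[ b < m ] (m ^ D * f₀ + total V (cost (f′ b) u))
      ≡⟨ ∑-distrib-+ {m} (λ _ → m ^ D * f₀) (λ b → total V (cost (f′ b) u)) ⟩
    ∑[ b < m ] (m ^ D * f₀) + c u
      ≡⟨ cong (_+ c u) (∑-const m (m ^ D * f₀)) ⟩
    m * (m ^ D * f₀) + c u ∎
    where f₀ = f zero (a ∷ u)
  first : ∑[ a < m ] total V (λ u → m * (m ^ D * f zero (a ∷ u))) ≡ m ^ suc D * total V′ (f zero)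
  first = begin
    ∑[ a < m ] total V (λ u → m * (m ^ D * f zero (a ∷ u)))
      ≡⟨ sum-cong-≗ (λ a → trans (sum-cong-≗ (λ u → sym (*-assoc m (m ^ D) (f zero (a ∷ Inverse.to V u))))) (sym (*-distribˡ-sum (m ^ suc D) (λ u → f zero (a ∷ Inverse.to V u))))) ⟩
    ∑[ a < m ] (m ^ suc D * total V (λ u → f zero (a ∷ u))) ≡⟨ *-distribˡ-sum {m} (m ^ suc D) (λ a → total V (λ u → f zero (a ∷ u))) ⟨
    m ^ suc D * ∑[ a < m ] total V (λ u → f zero (a ∷ u))   ≡⟨ cong (m ^ suc D *_) (total-Vecᶠ m D (f zero)) ⟨
    m ^ suc D * total V′ (f zero) ∎
  second : ∑[ a < m ] total V c ≡ m ^ suc D * ∑[ k < D ] total V′ (f (suc k))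
  second = begin
    ∑[ a < m ] total V c
      ≡⟨ ∑-const m (total V c) ⟩
    m * total V c
      ≡⟨ cong (m *_) (∑-comm (λ u b → total V (cost (f′ b) (Inverse.to V u)))) ⟩
    m * ∑[ b < m ] total V (λ u → total V (cost (f′ b) u))
      ≡⟨ cong (m *_) (sum-cong-≗ λ b → total-cost m D (f′ b)) ⟩
    m * ∑[ b < m ] (m ^ D * ∑[ k < D ] total V (f′ b k))
      ≡⟨ cong (m *_) (*-distribˡ-sum {m} (m ^ D) (λ b → ∑[ k < D ] total V (f′ b k))) ⟨
    m * (m ^ D * ∑[ b < m ] ∑[ k < D ] total V (f′ b k))
      ≡⟨ *-assoc m (m ^ D) _ ⟨
    m ^ suc D * ∑[ b < m ] ∑[ k < D ] total V (f′ b k)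
      ≡⟨ cong (m ^ suc D *_) (∑-comm (λ b k → total V (f′ b k))) ⟩
    m ^ suc D * ∑[ k < D ] ∑[ b < m ] total V (f′ b k)
      ≡⟨ cong (m ^ suc D *_) (sum-cong-≗ λ k → total-Vecᶠ m D (f (suc k))) ⟨
    m ^ suc D * ∑[ k < D ] total V′ (f (suc k)) ∎

total-insertAt : ∀ m d (k : Fin (suc d)) (h : Vec (Fin m) (suc d) → ℕ) →
  total (Vecᶠ m (suc d)) h ≡ total (Vecᶠ m d) (λ ρ → ∑[ q < m ] h (insertAt ρ k q))
total-insertAt m d zero h = trans (total-Vecᶠ m d h) (∑-comm (λ a ρ → h (a ∷ Inverse.to (Vecᶠ m d) ρ)))
total-insertAt m (suc d) (suc k) h = trans (total-Vecᶠ m (suc d) h)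
  (trans (sum-cong-≗ λ a → total-insertAt m d k (h ∘ (a ∷_)))
    (sym (total-Vecᶠ m d (λ ρ → ∑[ q < m ] h (insertAt ρ (suc k) q)))))

total-removeAt : ∀ m d (k : Fin (suc d)) (g : Vec (Fin m) d → ℕ) →
  total (Vecᶠ m (suc d)) (λ a → g (removeAt a k)) ≡ m * total (Vecᶠ m d) g
total-removeAt m d k g = trans (total-insertAt m d k (λ a → g (removeAt a k)))
  (trans (sum-cong-≗ λ ρ → trans (sum-cong-≗ {m} λ q → cong g (removeAt-insertAt (Inverse.to (Vecᶠ m d) ρ) k q)) (∑-const m _))
    (sym (*-distribˡ-sum m (g ∘ Inverse.to (Vecᶠ m d)))))

removeAt-update : ∀ {A : Set} {d} (a : Vec A (suc d)) k c → removeAt (a Vec.[ k ]≔ c) k ≡ removeAt a k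
removeAt-update (x ∷ a) zero c = refl
removeAt-update (x ∷ y ∷ a) (suc zero) c = refl
removeAt-update (x ∷ y ∷ a) (suc (suc k)) c = cong (x ∷_) (removeAt-update (y ∷ a) (suc k) c)

¬¬-∀ : ∀ {n} {P : Fin n → Set} → (∀ i → ¬ ¬ P i) → ¬ ¬ (∀ i → P i)
¬¬-∀ {zero} _ k = k λ ()
¬¬-∀ {suc n} nn k = nn zero λ p → ¬¬-∀ (nn ∘ suc) λ ps → k λ { zero → p ; (suc i) → ps i }

-- An inequality between naturals is stable under double negation, so reachability may be assumed
-- decidable, and the component of `b` becomes a subset to which the balance condition applies.
reachable-set-small : ∀ G X → IsBalancedSeparator G X → ∀ {b} → b ∉ X → (P : Vertex G → Bool) →
  (∀ v → T (P v) → Star (AdjOutside G X) b v) → 3 * ∑[ v < order G ] ⟦ P v ⟧ ≤ 2 * order G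
reachable-set-small G X balanced {b} b∉ P reach = ≮⇒≥ λ too-big →
  ¬¬-∀ (λ v → ¬¬-excluded-middle) λ (reach? : ∀ v → Dec (Star (AdjOutside G X) b v)) →
  let C = tabulate (does ∘ reach?) in
  <⇒≱ too-big (≤-trans
    (*-monoʳ-≤ 3 (≤-trans (∑-mono λ v → ⟦⟧-mono {P v} (does-T (reach? v) ∘ reach v)) (≤-reflexive (sym (∣tabulate∣ (does ∘ reach?))))))
    (balanced C (b , b∉ , λ v → mk⇔ (T-does (reach? v) ∘ ∈-tabulate⁻ (does ∘ reach?)) (∈-tabulate (does ∘ reach?) ∘ does-T (reach? v)))))

module _ (d m L : ℕ) .{{_ : NonZero m}} .{{_ : NonZero L}} (X : Subset (order (Grid.grid d m L))) where
  open Grid d m L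

  private
    n = order grid
    V = Vecᶠ m (suc d)
    Point = Vec (Fin m) (suc d)
    vertex = Inverse.from positions

    Free : Position → Set
    Free a = vertex a ∉ X

    Reach : Position → Position → Set
    Reach a b = Star (AdjOutside grid X) (vertex a) (vertex b)

    step⇒Reach : ∀ a b → Free a → Free b → Step a b → Reach a b
    step⇒Reach a b fa fb st = (fa , fb , Step⇒Adj Step positions step? step-irrefl {a} {b} (inj₁ st)) ◅ stay

    Reach-sym : ∀ a b → Reach a b → Reach b a
    Reach-sym _ _ = reverse λ {u} {v} (u∉ , v∉ , uv) → v∉ , u∉ , subst T (adj-sym grid u v) uv

    line-forward : ∀ k ρ → (∀ z → Free (k , ρ , z)) → ∀ t {z z′} → toℕ z′ ≡ t + toℕ z → Reach (k , ρ , z) (k , ρ , z′)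
    line-forward k ρ free zero {z} eq = subst (λ z′ → Reach (k , ρ , z) (k , ρ , z′)) (sym (Fin.toℕ-injective eq)) stay
    line-forward k ρ free (suc t) {z} {z′} eq =
      line-forward k ρ free t (Fin.toℕ-fromℕ< t+z<) ◅◅
      step⇒Reach (k , ρ , fromℕ< t+z<) (k , ρ , z′) (free _) (free _) (inj₁ (refl , refl , trans eq (cong suc (sym (Fin.toℕ-fromℕ< t+z<)))))
      where
      t+z< : t + toℕ z < m * L
      t+z< = ≤-trans (≤-reflexive (sym eq)) (<⇒≤ (Fin.toℕ<n z′))

    line : ∀ k ρ → (∀ z → Free (k , ρ , z)) → ∀ z z′ → Reach (k , ρ , z) (k , ρ , z′)
    line k ρ free z z′ with ≤-total (toℕ z) (toℕ z′)
    ... | inj₁ le = line-forward k ρ free (toℕ z′ ∸ toℕ z) (sym (m∸n+n≡m le))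
    ... | inj₂ ge = Reach-sym (k , ρ , z′) (k , ρ , z) (line-forward k ρ free (toℕ z ∸ toℕ z′) (sym (m∸n+n≡m ge)))

    hits : Fin (suc d) → Vec (Fin m) d → ℕ
    hits k ρ = ∑[ z < m * L ] ⟦ vertex (k , ρ , z) ∈ᵇ X ⟧

    f : Fin (suc d) → Point → ℕ
    f k a = hits k (removeAt a k)

    unhit : ∀ k ρ → hits k ρ ≡ 0 → ∀ z → Free (k , ρ , z)
    unhit k ρ h z z∈ = contradiction
      (subst₂ _≤_ (⟦⟧-T (∈⇒∈ᵇ z∈)) h (term≤∑ (λ z → ⟦ vertex (k , ρ , z) ∈ᵇ X ⟧) z)) λ ()

    hub : Fin (suc d) → Point → Position
    hub k a = k , removeAt a k , combine (lookup a k) (fromℕ< (>-nonZero⁻¹ L))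

    hub-offset : ∀ k a → offset (hub k a) ≡ 0
    hub-offset k a = trans (cong (toℕ ∘ proj₂) (Fin.remQuot-combine (lookup a k) _)) (Fin.toℕ-fromℕ< _)

    hub-point : ∀ k a → point (hub k a) ≡ a
    hub-point k a = trans (cong (insertAt (removeAt a k) k ∘ proj₁) (Fin.remQuot-combine (lookup a k) _)) (insertAt-removeAt a k)

    turn : ∀ i j a → f i a ≡ 0 → f j a ≡ 0 → Reach (hub i a) (hub j a)
    turn i j a fi fj with i Fin.≟ j
    ... | yes refl = stay
    ... | no i≢j = step⇒Reach (hub i a) (hub j a) (unhit i _ fi _) (unhit j _ fj _)
      (inj₂ (i≢j , hub-offset i a , hub-offset j a , trans (hub-point i a) (sym (hub-point j a))))

    slide : ∀ k a c → f k a ≡ 0 → Reach (hub k a) (hub k (a Vec.[ k ]≔ c))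
    slide k a c fk = subst (λ ρ → Reach (hub k a) (k , ρ , proj₂ (proj₂ (hub k (a Vec.[ k ]≔ c))))) (sym (removeAt-update a k c)) (line k (removeAt a k) (unhit k (removeAt a k) fk) _ _)

    -- The induction runs over the coordinates still to be corrected: `g` restores those already
    -- replaced, and `e` gives the true direction of a remaining coordinate. Cost 0 means that every
    -- line used avoids `X`.
    travel : ∀ {D} (e : Fin D → Fin (suc d)) (g : Vec (Fin m) D → Point) →
      (∀ k w c → g (w Vec.[ k ]≔ c) ≡ g w Vec.[ e k ]≔ c) →
      ∀ u v → cost (λ k w → f (e k) (g w)) u v ≡ 0 →
      ∀ i j → f i (g u) ≡ 0 → f j (g v) ≡ 0 → Reach (hub i (g u)) (hub j (g v))
    travel e g update [] [] _ i j fi fj = turn i j (g []) fi fj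
    travel e g update (a ∷ u) (b ∷ v) c≡0 i j fi fj =
      turn i (e zero) (g (a ∷ u)) fi f₀ ◅◅
      subst (λ p → Reach (hub (e zero) (g (a ∷ u))) (hub (e zero) p)) (sym moved) (slide (e zero) (g (a ∷ u)) b f₀) ◅◅
      travel (e ∘ suc) (g ∘ (b ∷_)) (λ k w → update (suc k) (b ∷ w)) u v
        (m+n≡0⇒n≡0 (f (e zero) (g (a ∷ u))) c≡0) (e zero) j
        (trans (cong (f (e zero)) moved) (trans (cong (hits (e zero)) (removeAt-update (g (a ∷ u)) (e zero) b)) f₀)) fj
      where
      f₀ = m+n≡0⇒m≡0 (f (e zero) (g (a ∷ u))) c≡0
      moved : g (b ∷ u) ≡ g (a ∷ u) Vec.[ e zero ]≔ b
      moved = update zero (a ∷ u) b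

    -- Each vertex lies on exactly one line, and each line passes through `m` points.
    total-hits : ∑[ k < suc d ] total V (f k) ≡ m * ∣ X ∣
    total-hits = begin
      ∑[ k < suc d ] total V (f k)                            ≡⟨ sum-cong-≗ (λ k → total-removeAt m d k (hits k)) ⟩
      ∑[ k < suc d ] (m * total (Vecᶠ m d) (hits k))          ≡⟨ *-distribˡ-sum m (λ k → total (Vecᶠ m d) (hits k)) ⟨
      m * ∑[ k < suc d ] total (Vecᶠ m d) (hits k)            ≡⟨ cong (m *_) (trans (total-×ᶠ (Finᶠ (suc d)) (Vecᶠ m d ×ᶠ Finᶠ (m * L)) χ)
                                                                   (sum-cong-≗ λ k → total-×ᶠ (Vecᶠ m d) (Finᶠ (m * L)) (λ b → χ (k , b)))) ⟨
      m * total positions χ                                   ≡⟨ cong (m *_) (sum-cong-≗ λ v → cong (λ v → ⟦ v ∈ᵇ X ⟧) (Inverse.strictlyInverseʳ positions v)) ⟩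
      m * ∑[ v < n ] ⟦ v ∈ᵇ X ⟧                               ≡⟨ cong (m *_) (∣∣-∑ X) ⟨
      m * ∣ X ∣                                               ∎
      where
      open ≡-Reasoning
      χ : Position → ℕ
      χ a = ⟦ vertex a ∈ᵇ X ⟧

    -- The second summand accounts for the last leg, from the point of `a` along the line of `a` to
    -- `a` itself.
    bad : Point → Position → ℕ
    bad u a = cost f u (point a) + f (proj₁ a) (point a)

    -- `bad u` sees only the direction and the point of a position, and each such pair belongs to
    -- `L` positions.
    total-bad : ∀ u → total positions (bad u) ≡ L * (suc d * total V (cost f u) + m * ∣ X ∣)
    total-bad u = begin
      total positions (bad u)
        ≡⟨ trans (total-×ᶠ (Finᶠ (suc d)) (Vecᶠ m d ×ᶠ Finᶠ (m * L)) (bad u))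
             (sum-cong-≗ λ k → total-×ᶠ (Vecᶠ m d) (Finᶠ (m * L)) (λ b → bad u (k , b))) ⟩
      ∑[ k < suc d ] total (Vecᶠ m d) (λ ρ → ∑[ z < m * L ] bad u (k , ρ , z))
        ≡⟨ sum-cong-≗ (λ k → sum-cong-≗ λ ρ → trans (∑-combine m L (λ z → bad u (k , Inverse.to (Vecᶠ m d) ρ , z))) (sum-cong-≗ {m} λ q →
             trans (sum-cong-≗ {L} λ o → cong (λ qo → b k (insertAt (Inverse.to (Vecᶠ m d) ρ) k (proj₁ qo))) (Fin.remQuot-combine q o))
               (∑-const L _))) ⟩
      ∑[ k < suc d ] total (Vecᶠ m d) (λ ρ → ∑[ q < m ] (L * b k (insertAt ρ k q)))
        ≡⟨ sum-cong-≗ (λ k → total-insertAt m d k (λ p → L * b k p)) ⟨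
      ∑[ k < suc d ] total V (λ p → L * b k p)
        ≡⟨ sum-cong-≗ (λ k → *-distribˡ-sum L (b k ∘ Inverse.to V)) ⟨
      ∑[ k < suc d ] (L * total V (b k))
        ≡⟨ *-distribˡ-sum L (λ k → total V (b k)) ⟨
      L * ∑[ k < suc d ] total V (b k)
        ≡⟨ cong (L *_) (trans (sum-cong-≗ (λ k → ∑-distrib-+ (cost f u ∘ Inverse.to V) (f k ∘ Inverse.to V)))
             (trans (∑-distrib-+ {suc d} (λ _ → total V (cost f u)) (λ k → total V (f k))) (cong₂ _+_ (∑-const (suc d) _) total-hits))) ⟩
      L * (suc d * total V (cost f u) + m * ∣ X ∣) ∎
      where
      open ≡-Reasoning
      b : Fin (suc d) → Point → ℕ
      b k p = cost f u p + f k p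

    cheap-start : ∃[ u ] total V (cost f u) ≤ m * ∣ X ∣
    cheap-start with k , small ← average {m ^ suc d} {{m^n≢0 m (suc d)}} (λ k → total V (cost f (Inverse.to V k))) =
      Inverse.to V k , *-cancelˡ-≤ (m ^ suc d) {{m^n≢0 m (suc d)}}
        (≤-trans small (≤-reflexive (trans (total-cost m (suc d) f) (cong (m ^ suc d *_) total-hits))))

    good : Point → Position → Bool
    good u a = bad u a ≡ᵇ 0

    good⇒reachable : ∀ u a → T (good u a) → f zero u ≡ 0 × Reach (hub zero u) a
    good⇒reachable u@(_ ∷ _) a@(i , ρ , z) t = f₀ , travel id id (λ _ _ _ → refl) u p c≡0 zero i f₀ fᵢ ◅◅
      subst (λ ρ → Reach (hub i p) (i , ρ , z)) (removeAt-insertAt ρ i _) (line i (removeAt p i) (unhit i (removeAt p i) fᵢ) _ z)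
      where
      p = point a
      bad≡0 = ≡ᵇ⇒≡ (bad u a) 0 t
      c≡0 = m+n≡0⇒m≡0 (cost f u p) bad≡0
      fᵢ = m+n≡0⇒n≡0 (cost f u p) bad≡0
      f₀ : f zero u ≡ 0
      f₀ = cost₀ p c≡0
        where
        cost₀ : ∀ p → cost f u p ≡ 0 → f zero u ≡ 0
        cost₀ (_ ∷ _) c≡0 = m+n≡0⇒m≡0 (f zero u) c≡0

  -- From an average start, the walks and the last legs together are hit at most
  -- `2 * L * suc d * m * ∣ X ∣` times. If `6 * ∣ X ∣ < m ^ d`, this is less than a third of the
  -- order, so more than two thirds of the vertices are reached from one hub.
  grid-separator-large : IsBalancedSeparator grid X → m ^ d ≤ 6 * ∣ X ∣
  grid-separator-large balanced = ≮⇒≥ impossible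
    where
    u = proj₁ cheap-start
    x = ∣ X ∣
    B = total positions (bad u)
    G = ∑[ v < n ] ⟦ good u (Inverse.to positions v) ⟧

    n≤G+B : n ≤ G + B
    n≤G+B = begin
      n                ≡⟨ trans (sym (*-identityʳ n)) (sym (∑-const n 1)) ⟩
      ∑[ v < n ] 1     ≤⟨ ∑-mono (λ v → good-or-bad (bad u (Inverse.to positions v))) ⟩
      ∑[ v < n ] (⟦ good u (Inverse.to positions v) ⟧ + bad u (Inverse.to positions v)) ≡⟨ ∑-distrib-+ {n} _ _ ⟩
      G + B            ∎
      where
      open ≤-Reasoning
      good-or-bad : ∀ c → 1 ≤ ⟦ c ≡ᵇ 0 ⟧ + c
      good-or-bad zero = s≤s z≤n
      good-or-bad (suc c) = s≤s z≤n

    B≤ : B ≤ L * (suc d * (m * x) + m * x)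
    B≤ = ≤-trans (≤-reflexive (total-bad u)) (*-monoʳ-≤ L (+-monoˡ-≤ (m * x) (*-monoʳ-≤ (suc d) (proj₂ cheap-start))))

    impossible : 6 * x < m ^ d → ⊥
    impossible small = <⇒≱ 3B<n (+-cancelˡ-≤ (2 * n) n (3 * B) (begin
      2 * n + n          ≡⟨ expand n ⟩
      3 * n              ≤⟨ *-monoʳ-≤ 3 n≤G+B ⟩
      3 * (G + B)        ≡⟨ *-distribˡ-+ 3 G B ⟩
      3 * G + 3 * B      ≤⟨ +-monoˡ-≤ (3 * B) 3G≤2n ⟩
      2 * n + 3 * B      ∎))
      where
      open ≤-Reasoning
      expand : ∀ n → 2 * n + n ≡ 3 * n
      expand = solve-∀
      regroup : ∀ L D m x → 3 * (L * (D * (m * x) + D * (m * x))) ≡ D * (m * L) * (6 * x)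
      regroup = solve-∀
      order-eq : ∀ D p m L → D * (m * L) * p ≡ D * (p * (m * L))
      order-eq = solve-∀
      3B<n : 3 * B < n
      3B<n = begin-strict
        3 * B                                             ≤⟨ *-monoʳ-≤ 3 B≤ ⟩
        3 * (L * (suc d * (m * x) + m * x))               ≤⟨ *-monoʳ-≤ 3 (*-monoʳ-≤ L (+-monoʳ-≤ (suc d * (m * x)) (m≤n*m (m * x) (suc d)))) ⟩
        3 * (L * (suc d * (m * x) + suc d * (m * x)))     ≡⟨ regroup L (suc d) m x ⟩
        suc d * (m * L) * (6 * x)                         <⟨ *-monoʳ-< (suc d * (m * L)) {{m*n≢0 (suc d) (m * L) {{_}} {{m*n≢0 m L}}}} small ⟩
        suc d * (m * L) * m ^ d                           ≡⟨ order-eq (suc d) (m ^ d) m L ⟩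
        n                                                 ∎
      -- A good vertex is needed to know that the starting hub avoids `X`: the cost of its walk
      -- includes the hits on the line through `u` in direction `zero`.
      some-good : 1 ≤ G
      some-good = n≢0⇒n>0 λ G≡0 → <⇒≱ 3B<n (begin
        n           ≤⟨ n≤G+B ⟩
        G + B       ≡⟨ cong (_+ B) G≡0 ⟩
        B           ≤⟨ m≤n*m B 3 ⟩
        3 * B       ∎)
      start-unhit : f zero u ≡ 0
      start-unhit = let v , t = ∑-some _ some-good in proj₁ (good⇒reachable u (Inverse.to positions v) t)
      3G≤2n : 3 * G ≤ 2 * n
      3G≤2n = reachable-set-small grid X balanced (unhit zero (removeAt u zero) start-unhit _) (good u ∘ Inverse.to positions)
        λ v t → subst (Star (AdjOutside grid X) (vertex (hub zero u))) (Inverse.strictlyInverseʳ positions v)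
          (proj₂ (good⇒reachable u (Inverse.to positions v) t))

-- Subdivided complete graphs

m⊓n,m⊔n-injective : ∀ {a b c d} → a ⊓ b ≡ c ⊓ d → a ⊔ b ≡ c ⊔ d → (a ≤ᵇ b) ≡ (c ≤ᵇ d) → a ≡ c × b ≡ d
m⊓n,m⊔n-injective {a} {b} {c} {d} lo hi side with a ≤? b | c ≤? d
... | yes a≤b | yes c≤d =
  trans (sym (m≤n⇒m⊓n≡m a≤b)) (trans lo (m≤n⇒m⊓n≡m c≤d)) ,
  trans (sym (m≤n⇒m⊔n≡n a≤b)) (trans hi (m≤n⇒m⊔n≡n c≤d))
... | no a≰b | no c≰d =
  trans (sym (m≥n⇒m⊔n≡m (≰⇒≥ a≰b))) (trans hi (m≥n⇒m⊔n≡m (≰⇒≥ c≰d))) ,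
  trans (sym (m≥n⇒m⊓n≡n (≰⇒≥ a≰b))) (trans lo (m≥n⇒m⊓n≡n (≰⇒≥ c≰d)))
... | yes a≤b | no c≰d = contradiction (≤ᵇ⇒≤ c d (subst T side (≤⇒≤ᵇ a≤b))) c≰d
... | no a≰b | yes c≤d = contradiction (≤ᵇ⇒≤ a b (subst T (sym side) (≤⇒≤ᵇ c≤d))) a≰b

-- The complete graph on k branch vertices, each edge subdivided into
-- two arms of L edges: (i , j , o) is the o-th vertex on the arm from
-- branch vertex i towards j.  The branch vertex i itself is (i , i , 0),
-- the start of a pendant arm.
module Clique (k L : ℕ) where

  Position : Set
  Position = Fin k × Fin k × Fin L

  positions : Fin (k * (k * L)) ↔ Position
  positions = Finᶠ k ×ᶠ (Finᶠ k ×ᶠ Finᶠ L)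

  Along Spoke Bridge Step : Position → Position → Set
  Along (i , j , o) (i′ , j′ , o′) = i ≡ i′ × j ≡ j′ × toℕ o′ ≡ suc (toℕ o)
  Spoke (i , j , o) (i′ , j′ , o′) = i ≡ i′ × i ≡ j × i ≢ j′ × toℕ o ≡ 0 × toℕ o′ ≡ 0
  Bridge (i , j , o) (i′ , j′ , o′) = i ≢ j × i ≡ j′ × j ≡ i′ × suc (toℕ o) ≡ L × suc (toℕ o′) ≡ L
  Step a b = Along a b ⊎ Spoke a b ⊎ Bridge a b

  step? : Decidable Step
  step? (i , j , o) (i′ , j′ , o′) =
    ((i Fin.≟ i′) ×-dec (j Fin.≟ j′) ×-dec (toℕ o′ ≟ suc (toℕ o))) ⊎-dec
    ((i Fin.≟ i′) ×-dec (i Fin.≟ j) ×-dec ¬? (i Fin.≟ j′) ×-dec (toℕ o ≟ 0) ×-dec (toℕ o′ ≟ 0)) ⊎-dec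
    (¬? (i Fin.≟ j) ×-dec (i Fin.≟ j′) ×-dec (j Fin.≟ i′) ×-dec (suc (toℕ o) ≟ L) ×-dec (suc (toℕ o′) ≟ L))

  step-irrefl : ∀ a → ¬ Step a a
  step-irrefl a (inj₁ (_ , _ , eq)) = 1+n≢n (sym eq)
  step-irrefl a (inj₂ (inj₁ (_ , i≡j , i≢j , _))) = i≢j i≡j
  step-irrefl a (inj₂ (inj₂ (i≢j , i≡j , _))) = i≢j i≡j

  subdividedClique : Graph
  subdividedClique = symmetricGraph Step positions step? step-irrefl

  module _ {H} (E : Embedding Step H) where
    open Embedding E

    private
      n = order H

    starSize : Fin k → ℕ
    starSize i = ∑[ v < n ] ⟦ does (proj₁ (pos v) Fin.≟ i) ⟧

    isBranch : Position → Bool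
    isBranch (i , j , o) = does ((i Fin.≟ j) ×-dec (toℕ o ≟ 0))

    -- Common frame of the two separators. `β` numbers the pieces of an arm, and `big` marks the
    -- branch vertices to remove. Piece 0 is labelled by its star while the branch vertex stays; all
    -- other pieces are labelled as parts of an edge. `β-end` keeps bridges away from the star
    -- labels.
    module ArmCut (big : Fin k → Bool) (β : ℕ → ℕ) (cutOffset : ℕ → Bool)
      (β-suc : ∀ o → ¬ T (cutOffset (suc o)) → β o ≡ β (suc o))
      (β-zero : ∀ i → ¬ T (big i) → ¬ T (cutOffset 0) → β 0 ≡ 0)
      (β-end : ∀ o → suc o ≡ L → β o ≢ 0)
      (star-small : ∀ i → ¬ T (big i) → 3 * starSize i ≤ 2 * n)
      {W} (code : Fin L → Fin W)
      (code-injective : ∀ {o o′} → β (toℕ o) ≡ β (toℕ o′) → code o ≡ code o′ → o ≡ o′)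
      (arm-small : 3 * (2 * W) ≤ 2 * n) where

      cut : Position → Bool
      cut a@(i , j , o) = cutOffset (toℕ o) ∨ (isBranch a ∧ big i)

      Arm : Set
      Arm = ℕ × ℕ × ℕ

      -- Symmetric in `i` and `j`, so that a bridge preserves it. Mirror-image pieces of the two
      -- arms share a value even where they are not joined, which costs at most the factor 2 in
      -- `arm-small`.
      arm : Position → Arm
      arm (i , j , o) = β (toℕ o) , toℕ i ⊓ toℕ j , toℕ i ⊔ toℕ j

      InStar : Position → Set
      InStar (i , j , o) = β (toℕ o) ≡ 0 × ¬ T (big i)

      inStar? : ∀ a → Dec (InStar a)
      inStar? (i , j , o) = (β (toℕ o) ≟ 0) ×-dec ¬? (T? (big i))

      label′ : ∀ a → Dec (InStar a) → Fin k ⊎ Arm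
      label′ a (yes _) = inj₁ (proj₁ a)
      label′ a (no _) = inj₂ (arm a)

      label : Position → Fin k ⊎ Arm
      label a = label′ a (inStar? a)

      label-star : ∀ a → InStar a → label a ≡ inj₁ (proj₁ a)
      label-star a p with inStar? a
      ... | yes _ = refl
      ... | no ¬p = contradiction p ¬p

      label-arm : ∀ a → ¬ InStar a → label a ≡ inj₂ (arm a)
      label-arm a ¬p with inStar? a
      ... | yes p = contradiction p ¬p
      ... | no _ = refl

      label⁻-star : ∀ a {i} → label a ≡ inj₁ i → InStar a × proj₁ a ≡ i
      label⁻-star a eq with inStar? a
      label⁻-star a refl | yes p = p , refl

      label⁻-arm : ∀ a {x} → label a ≡ inj₂ x → arm a ≡ x
      label⁻-arm a eq with inStar? a
      label⁻-arm a refl | no _ = refl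

      preserve : ∀ {a b} → Step a b → ¬ T (cut a) → ¬ T (cut b) → label a ≡ label b
      preserve {a@(i , j , o)} {b@(_ , _ , o′)} (inj₁ (refl , refl , eq)) _ b∉ = by-β (trans
        (β-suc (toℕ o) λ t → b∉ (Equivalence.from T-∨ (inj₁ (subst (T ∘ cutOffset) (sym eq) t)))) (cong β (sym eq)))
        where
        by-β : β (toℕ o) ≡ β (toℕ o′) → label a ≡ label b
        by-β eq with inStar? a
        ... | yes (β≡0 , ¬big) = sym (label-star b (trans (sym eq) β≡0 , ¬big))
        ... | no ¬star = trans (cong (λ x → inj₂ (x , toℕ i ⊓ toℕ j , toℕ i ⊔ toℕ j)) eq)
          (sym (label-arm b λ (β≡0 , ¬big) → ¬star (trans eq β≡0 , ¬big)))
      preserve {a@(i , j , o)} {b} (inj₂ (inj₁ (refl , i≡j , _ , o≡0 , o′≡0))) a∉ _ =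
        trans (label-star a (trans (cong β o≡0) β0 , ¬big)) (sym (label-star b (trans (cong β o′≡0) β0 , ¬big)))
        where
        ¬big : ¬ T (big i)
        ¬big t = a∉ (Equivalence.from T-∨ (inj₂ (Equivalence.from T-∧ (does-T ((i Fin.≟ j) ×-dec (toℕ o ≟ 0)) (i≡j , o≡0) , t))))
        β0 : β 0 ≡ 0
        β0 = β-zero i ¬big λ t → a∉ (Equivalence.from T-∨ (inj₁ (subst (T ∘ cutOffset) (sym o≡0) t)))
      preserve {a@(i , j , o)} {b@(_ , _ , o′)} (inj₂ (inj₂ (_ , refl , refl , end , end′))) _ _ =
        trans (label-arm a λ (β≡0 , _) → β-end (toℕ o) end β≡0)
          (trans (cong inj₂ (cong₂ _,_ (cong β (suc-injective (trans end (sym end′)))) (cong₂ _,_ (⊓-comm (toℕ i) _) (⊔-comm (toℕ i) _))))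
            (sym (label-arm b λ (β≡0 , _) → β-end (toℕ o′) end′ β≡0)))

      open Cut Step E cut label preserve public

      side : Bool → Fin 2
      side false = zero
      side true = suc zero

      side-injective : ∀ {a b} → side a ≡ side b → a ≡ b
      side-injective {false} {false} _ = refl
      side-injective {true} {true} _ = refl

      armCode : Position → Fin 2 × Fin W
      armCode (i , j , o) = side (toℕ i ≤ᵇ toℕ j) , code o

      armCode-injective : ∀ {a b} → arm a ≡ arm b → armCode a ≡ armCode b → a ≡ b
      armCode-injective {i , j , o} {i′ , j′ , o′} ae ce =
        let β≡ , ends = ,-injective ae
            lo , hi = ,-injective ends
            s≡ , c≡ = ,-injective ce
            i≡ , j≡ = m⊓n,m⊔n-injective lo hi (side-injective s≡)
        in cong₂ _,_ (Fin.toℕ-injective i≡) (cong₂ _,_ (Fin.toℕ-injective j≡) (code-injective β≡ c≡))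

      cutset-balanced : IsBalancedSeparator H cutset
      cutset-balanced C comp@(v , _) = by-label (label (pos v)) refl
        where
        by-label : ∀ l → label (pos v) ≡ l → 3 * ∣ C ∣ ≤ 2 * n
        by-label (inj₁ i) eq = ≤-trans (*-monoʳ-≤ 3 (≤-trans (≤-reflexive (∣∣-∑ C)) (∑-mono λ u → ⟦⟧-mono {u ∈ᵇ C} λ u∈ →
          does-T (proj₁ (pos u) Fin.≟ i) (proj₂ (label⁻-star (pos u) (trans (component-label comp (∈ᵇ⇒∈ u∈)) eq))))))
          (star-small i (subst (¬_ ∘ T ∘ big) (proj₂ star) (proj₂ (proj₁ star))))
          where star = label⁻-star (pos v) eq
        by-label (inj₂ x) eq = ≤-trans (*-monoʳ-≤ 3 (component≤ (Finᶠ 2 ×ᶠ Finᶠ W) armCode comp λ {a} {b} la lb →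
          armCode-injective (trans (label⁻-arm a (trans la eq)) (sym (label⁻-arm b (trans lb eq)))))) arm-small

      cutset-size : ∣ cutset ∣ ≤ ∑[ v < n ] ⟦ cutOffset (toℕ (proj₂ (proj₂ (pos v)))) ⟧ + ∑[ v < n ] ⟦ isBranch (pos v) ∧ big (proj₁ (pos v)) ⟧
      cutset-size = ≤-trans (≤-reflexive (∣tabulate∣ (cut ∘ pos))) (≤-trans
        (∑-mono λ v → ⟦⟧-∨ (cutOffset (toℕ (proj₂ (proj₂ (pos v))))) _) (≤-reflexive (∑-distrib-+ {n} _ _)))

    branch-unique : ∀ {a b} → T (isBranch a) → T (isBranch b) → proj₁ a ≡ proj₁ b → a ≡ b
    branch-unique {i , j , o} {i′ , j′ , o′} ta tb refl =
      let i≡j , o≡0 = T-does ((i Fin.≟ j) ×-dec (toℕ o ≟ 0)) ta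
          i≡j′ , o′≡0 = T-does ((i Fin.≟ j′) ×-dec (toℕ o′ ≟ 0)) tb
      in cong₂ (λ j o → i , j , o) (trans (sym i≡j) i≡j′) (Fin.toℕ-injective (trans o≡0 (sym o′≡0)))

    two-stars : ∀ {i i′} → i ≢ i′ → starSize i + starSize i′ ≤ n
    two-stars {i} {i′} i≢i′ = begin
      starSize i + starSize i′   ≡⟨ ∑-distrib-+ {n} _ _ ⟨
      ∑[ v < n ] (⟦ does (proj₁ (pos v) Fin.≟ i) ⟧ + ⟦ does (proj₁ (pos v) Fin.≟ i′) ⟧)  ≤⟨ ∑-mono (λ v → at-most-one (proj₁ (pos v))) ⟩
      ∑[ v < n ] 1               ≡⟨ trans (∑-const n 1) (*-identityʳ n) ⟩
      n                          ∎
      where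
      open ≤-Reasoning
      at-most-one : ∀ x → ⟦ does (x Fin.≟ i) ⟧ + ⟦ does (x Fin.≟ i′) ⟧ ≤ 1
      at-most-one x with x Fin.≟ i | x Fin.≟ i′
      ... | yes refl | yes refl = contradiction refl i≢i′
      ... | yes _ | no _ = ≤-refl
      ... | no _ | yes _ = ≤-refl
      ... | no _ | no _ = z≤n

    -- Cutting every arm leaves pieces of edges and pieces of stars. Stars are disjoint, so at most
    -- one has more than two thirds of the vertices; its branch vertex is removed too, which is the
    -- `+ 1`.
    thin-separator : ∀ w .{{_ : NonZero w}} → w ≤ L → 3 * w ≤ n →
      ∃[ X ] (IsBalancedSeparator H X × ∃[ c ] (w * c ≤ n × ∣ X ∣ ≤ c + 1))
    thin-separator w w≤L 3w≤n with r , thin ← thin-residue (λ v → toℕ (proj₂ (proj₂ (pos v)))) w =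
      cutset , cutset-balanced , _ , thin ,
      ≤-trans cutset-size
        (+-monoʳ-≤ _ (∑-unique _ λ u v tu tv → pos-injective (one-big (pos u) (pos v) (Equivalence.to T-∧ tu) (Equivalence.to T-∧ tv))))
      where
      β : ℕ → ℕ
      β o = (suc o + toℕ r) / w
      big : Fin k → Bool
      big i = does (2 * n <? 3 * starSize i)
      β-suc : ∀ o → ¬ T (residueCut w r (suc o)) → β o ≡ β (suc o)
      β-suc o ¬cut = suc/ (suc o + toℕ r) w (¬cut ∘ does-T (_ ≟ 0))
      β-zero : ∀ i → ¬ T (big i) → ¬ T (residueCut w r 0) → β 0 ≡ 0
      -- `suc (toℕ r)` reaches `w` only if `r` is the last residue, and then offset 0 is itself
      -- removed.
      β-zero _ _ ¬cut = m<n⇒m/n≡0 (≤∧≢⇒< (Fin.toℕ<n r) λ eq → ¬cut (does-T (_ ≟ 0) (trans (cong (_% w) eq) (n%n≡0 w))))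
      β-end : ∀ o → suc o ≡ L → β o ≢ 0
      β-end o end β≡0 = <⇒≱ (m≥n⇒m/n>0 {suc o + toℕ r} {w} (≤-trans w≤L (≤-trans (≤-reflexive (sym end)) (m≤m+n (suc o) _)))) (≤-reflexive β≡0)
      star-small : ∀ i → ¬ T (big i) → 3 * starSize i ≤ 2 * n
      star-small i ¬big = ≮⇒≥ (¬big ∘ does-T (_ <? _))
      code : Fin L → Fin w
      code o = fromℕ< (m%n<n (suc (toℕ o) + toℕ r) w)
      code-injective : ∀ {o o′} → β (toℕ o) ≡ β (toℕ o′) → code o ≡ code o′ → o ≡ o′
      code-injective β≡ c≡ = Fin.toℕ-injective (suc-injective (+-cancelʳ-≡ (toℕ r) _ _ (%/-injective w β≡ (Fin.fromℕ<-injective _ _ _ _ c≡))))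
      arm-small : 3 * (2 * w) ≤ 2 * n
      arm-small = ≤-trans (≤-reflexive (swap w)) (*-monoʳ-≤ 2 3w≤n)
        where
        swap : ∀ w → 3 * (2 * w) ≡ 2 * (3 * w)
        swap = solve-∀
      open ArmCut big β (residueCut w r) β-suc β-zero β-end star-small code code-injective arm-small
      one-big : ∀ a b → T (isBranch a) × T (big (proj₁ a)) → T (isBranch b) × T (big (proj₁ b)) → a ≡ b
      one-big a b (ba , Ba) (bb , Bb) with proj₁ a Fin.≟ proj₁ b
      ... | yes eq = branch-unique ba bb eq
      ... | no neq = contradiction (begin-strict
        3 * n                                             ≤⟨ *-monoˡ-≤ n (s≤s (s≤s (s≤s (z≤n {1})))) ⟩
        4 * n                                             ≡⟨ double n ⟩
        2 * n + 2 * n                                     <⟨ +-mono-< (T-does (2 * n <? 3 * starSize (proj₁ a)) Ba) (T-does (2 * n <? 3 * starSize (proj₁ b)) Bb) ⟩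
        3 * starSize (proj₁ a) + 3 * starSize (proj₁ b)   ≡⟨ *-distribˡ-+ 3 (starSize (proj₁ a)) _ ⟨
        3 * (starSize (proj₁ a) + starSize (proj₁ b))     ≤⟨ *-monoʳ-≤ 3 (two-stars neq) ⟩
        3 * n                                             ∎) (<-irrefl refl)
        where
        open ≤-Reasoning
        double : ∀ n → 4 * n ≡ 2 * n + 2 * n
        double = solve-∀

    -- Once all branch vertices are gone, a component lies on the two arms of one edge. The constant
    -- piece number 1 leaves no position with a star label.
    branch-separator : 3 * L ≤ n → ∃[ X ] (IsBalancedSeparator H X × ∣ X ∣ ≤ k)
    branch-separator 3L≤n =
      cutset , cutset-balanced ,
      ≤-trans cutset-size
        (+-mono-≤ (≤-reflexive (∑-none {n} (λ _ → false) λ _ ()))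
          (∑-pigeonhole (λ v → isBranch (pos v) ∧ true) (proj₁ ∘ pos) λ u v tu tv eq →
            pos-injective (branch-unique (proj₁ (Equivalence.to (T-∧ {y = true}) tu)) (proj₁ (Equivalence.to (T-∧ {y = true}) tv)) eq)))
      where
      β-suc : ∀ o → ¬ T false → 1 ≡ 1
      β-suc _ _ = refl
      β-zero : ∀ i → ¬ T true → ¬ T false → 1 ≡ 0
      β-zero _ ¬true _ = contradiction tt ¬true
      β-end : ∀ o → suc o ≡ L → 1 ≢ 0
      β-end _ _ ()
      star-small : ∀ i → ¬ T true → 3 * starSize i ≤ 2 * n
      star-small _ ¬true = contradiction tt ¬true
      code-injective : ∀ {o o′ : Fin L} → 1 ≡ 1 → o ≡ o′ → o ≡ o′
      code-injective _ eq = eq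
      arm-small : 3 * (2 * L) ≤ 2 * n
      arm-small = ≤-trans (≤-reflexive (swap L)) (*-monoʳ-≤ 2 3L≤n)
        where
        swap : ∀ w → 3 * (2 * w) ≡ 2 * (3 * w)
        swap = solve-∀
      open ArmCut (λ _ → true) (λ _ → 1) (λ _ → false) β-suc β-zero β-end star-small id code-injective arm-small

-- Complete graphs as dense shallow minors

length-filter-tabulate : ∀ {A : Set} {P : A → Set} (P? : ∀ a → Dec (P a)) {n} (f : Fin n → A) →
  length (filter P? (List.tabulate f)) ≡ ∑[ i < n ] ⟦ does (P? (f i)) ⟧
length-filter-tabulate P? {zero} f = refl
length-filter-tabulate P? {suc n} f with does (P? (f zero))
... | true = cong suc (length-filter-tabulate P? (f ∘ suc))
... | false = length-filter-tabulate P? (f ∘ suc)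

length-filter-cartesianProduct : ∀ {A B : Set} {P : A × B → Set} (P? : ∀ ab → Dec (P ab)) {m n} (f : Fin m → A) (g : Fin n → B) →
  length (filter P? (cartesianProduct (List.tabulate f) (List.tabulate g))) ≡ ∑[ i < m ] ∑[ j < n ] ⟦ does (P? (f i , g j)) ⟧
length-filter-cartesianProduct P? {zero} f g = refl
length-filter-cartesianProduct {A} {B} P? {suc m} {n} f g = begin
  length (filter P? (List.map (f zero ,_) (List.tabulate g) ++ rest))
    ≡⟨ cong length (List.filter-++ P? (List.map (f zero ,_) (List.tabulate g)) rest) ⟩
  length (filter P? (List.map (f zero ,_) (List.tabulate g)) ++ filter P? rest)
    ≡⟨ List.length-++ (filter P? (List.map (f zero ,_) (List.tabulate g))) ⟩
  length (filter P? (List.map (f zero ,_) (List.tabulate g))) + length (filter P? rest)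
    ≡⟨ cong₂ _+_ (trans (cong (length ∘ filter P?) (List.map-tabulate g (f zero ,_))) (length-filter-tabulate P? (λ j → f zero , g j)))
         (length-filter-cartesianProduct P? (f ∘ suc) g) ⟩
  ∑[ j < n ] ⟦ does (P? (f zero , g j)) ⟧ + ∑[ i < m ] ∑[ j < n ] ⟦ does (P? (f (suc i) , g j)) ⟧ ∎
  where
  open ≡-Reasoning
  rest : List (A × B)
  rest = cartesianProduct (List.tabulate (f ∘ suc)) (List.tabulate g)

complete : ℕ → Graph
complete k = record
  { order = k
  ; adj = λ u v → not (does (u Fin.≟ v))
  ; adj-sym = symmetric
  ; adj-irrefl = irreflexive
  }
  where
  symmetric : ∀ u v → not (does (u Fin.≟ v)) ≡ not (does (v Fin.≟ u))
  symmetric u v with u Fin.≟ v | v Fin.≟ u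
  ... | yes _ | yes _ = refl
  ... | no _ | no _ = refl
  ... | yes eq | no neq = contradiction (sym eq) neq
  ... | no neq | yes eq = contradiction (sym eq) neq
  irreflexive : ∀ v → not (does (v Fin.≟ v)) ≡ false
  irreflexive v with v Fin.≟ v
  ... | yes _ = refl
  ... | no neq = contradiction refl neq

complete-adj⇒≢ : ∀ {k} {u v : Fin k} → T (not (does (u Fin.≟ v))) → u ≢ v
complete-adj⇒≢ {u = u} {v} t with u Fin.≟ v
... | no neq = neq

≢⇒complete-adj : ∀ {k} {u v : Fin k} → u ≢ v → T (not (does (u Fin.≟ v)))
≢⇒complete-adj {u = u} {v} neq with u Fin.≟ v
... | yes eq = neq eq
... | no _ = tt

complete-edges : ∀ k → k * k ≤ 2 * length (edges (complete k)) + k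
complete-edges k = begin
  k * k                                     ≡⟨ trans (∑-const k (k * 1)) (cong (k *_) (*-identityʳ k)) ⟨
  ∑[ u < k ] (k * 1)                        ≡⟨ sum-cong-≗ {k} (λ u → ∑-const k 1) ⟨
  ∑[ u < k ] ∑[ v < k ] 1                   ≤⟨ ∑-mono {k} (λ u → ∑-mono {k} (λ v → comparable u v)) ⟩
  ∑[ u < k ] ∑[ v < k ] (lt u v + (lt v u + eq u v))
    ≡⟨ trans (sum-cong-≗ {k} λ u → trans (∑-distrib-+ (lt u) (λ v → lt v u + eq u v)) (cong (_+_ (sum (lt u))) (∑-distrib-+ (λ v → lt v u) (eq u))))
         (trans (∑-distrib-+ (λ u → sum (lt u)) (λ u → sum (λ v → lt v u) + sum (eq u)))
           (cong (_+_ S) (∑-distrib-+ (λ u → sum (λ v → lt v u)) (λ u → sum (eq u))))) ⟩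
  S + (∑[ u < k ] ∑[ v < k ] lt v u + ∑[ u < k ] ∑[ v < k ] eq u v)
    ≤⟨ +-monoʳ-≤ S (+-mono-≤ (≤-reflexive (∑-comm (λ u v → lt v u))) diagonal) ⟩
  S + (S + k)                               ≡⟨ regroup S k ⟩
  2 * S + k                                 ≤⟨ +-monoˡ-≤ k (*-monoʳ-≤ 2 S≤edges) ⟩
  2 * length (edges (complete k)) + k       ∎
  where
  open ≤-Reasoning
  lt eq : Fin k → Fin k → ℕ
  lt u v = ⟦ does (u Fin.<? v) ⟧
  eq u v = ⟦ does (u Fin.≟ v) ⟧
  S = ∑[ u < k ] ∑[ v < k ] lt u v
  regroup : ∀ S k → S + (S + k) ≡ 2 * S + k
  regroup = solve-∀
  comparable : ∀ u v → 1 ≤ lt u v + (lt v u + eq u v)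
  comparable u v with Fin.<-cmp u v
  ... | tri< u<v _ _ = m≤n⇒m≤n+o _ (≤-reflexive (sym (⟦⟧-T (does-T (u Fin.<? v) u<v))))
  ... | tri≈ _ u≡v _ = m≤n⇒m≤o+n (lt u v) (m≤n⇒m≤o+n (lt v u) (≤-reflexive (sym (⟦⟧-T (does-T (u Fin.≟ v) u≡v)))))
  ... | tri> _ _ v<u = m≤n⇒m≤o+n (lt u v) (m≤n⇒m≤n+o _ (≤-reflexive (sym (⟦⟧-T (does-T (v Fin.<? u) v<u)))))
  diagonal : ∑[ u < k ] ∑[ v < k ] eq u v ≤ k
  diagonal = ≤-trans (∑-mono {k} λ u → ∑-unique (λ v → does (u Fin.≟ v)) λ v w tv tw → trans (sym (T-does (u Fin.≟ v) tv)) (T-does (u Fin.≟ w) tw))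
    (≤-reflexive (trans (∑-const k 1) (*-identityʳ k)))
  edge? : (uv : Fin k × Fin k) → Dec (proj₁ uv Fin.< proj₂ uv × T (adj (complete k) (proj₁ uv) (proj₂ uv)))
  edge? (u , v) = (u Fin.<? v) ×-dec T? (adj (complete k) u v)
  S≤edges : S ≤ length (edges (complete k))
  S≤edges = ≤-trans (∑-mono {k} λ u → ∑-mono {k} λ v → ⟦⟧-mono λ t → does-T (edge? (u , v))
      (T-does (u Fin.<? v) t , ≢⇒complete-adj (Fin.<⇒≢ (T-does (u Fin.<? v) t))))
    (≤-reflexive (sym (length-filter-cartesianProduct edge? {k} {k} id id)))

/-mono-< : ∀ {a b c d} .{{_ : NonZero b}} .{{_ : NonZero d}} → a * d < c * b → ℤ.+ a ℚ./ b ℚ.< ℤ.+ c ℚ./ d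
/-mono-< {a} {b@(suc b-1)} {c} {d@(suc d-1)} ad<cb = ℚ.toℚᵘ-cancel-<
  (ℚᵘ.<-respˡ-≃ (ℚᵘ.≃-sym (ℚ.toℚᵘ-fromℚᵘ (ℚᵘ.mkℚᵘ (ℤ.+ a) b-1)))
    (ℚᵘ.<-respʳ-≃ (ℚᵘ.≃-sym (ℚ.toℚᵘ-fromℚᵘ (ℚᵘ.mkℚᵘ (ℤ.+ c) d-1)))
      (ℚᵘ.*<* (subst₂ ℤ._<_ (ℤ.pos-* a d) (ℤ.pos-* c b) (ℤ.+<+ ad<cb)))))

-- The density is `(k - 1) / 2`, which exceeds `k / 4` exactly when `k` is greater than 2.
complete-density : ∀ k .{{_ : NonZero k}} → 3 ≤ k → ℤ.+ k ℚ./ 4 ℚ.< density (complete k)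
complete-density k@(suc _) 3≤k = /-mono-< {k} {4} {E} {k} k*k<E*4
  where
  E = length (edges (complete k))
  open ≤-Reasoning
  regroup : ∀ e k → 2 * (2 * e + k) ≡ e * 4 + 2 * k
  regroup = solve-∀
  split : ∀ k → 2 * (k * k) ≡ k * k + k * k
  split = solve-∀
  k*k<E*4 : k * k < E * 4
  k*k<E*4 = +-cancelʳ-< (2 * k) _ _ (begin-strict
    k * k + 2 * k        <⟨ +-monoʳ-< (k * k) (*-monoˡ-< k 3≤k) ⟩
    k * k + k * k        ≡⟨ split k ⟨
    2 * (k * k)          ≤⟨ *-monoʳ-≤ 2 (complete-edges k) ⟩
    2 * (2 * E + k)      ≡⟨ regroup E k ⟩
    E * 4 + 2 * k        ∎)

Within-mono : ∀ {G P a b u v} → a ≤ b → Within G P a u v → Within G P b u v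
Within-mono a≤b stop = stop
Within-mono (s≤s a≤b) (step uv p w) = step uv p (Within-mono a≤b w)

module _ (k L : ℕ) .{{_ : NonZero L}} where
  open Clique k L

  private
    vertex = Inverse.from positions
    position = Inverse.to positions

    branch : Vertex subdividedClique → Fin k
    branch v = proj₁ (position v)

    branch-vertex : ∀ a → branch (vertex a) ≡ proj₁ a
    branch-vertex a = cong proj₁ (Inverse.strictlyInverseˡ positions a)

    step⇒Adj : ∀ a b → Step a b → Adj subdividedClique (vertex a) (vertex b)
    step⇒Adj a b st = Step⇒Adj Step positions step? step-irrefl {a} {b} (inj₁ st)

    pred< : pred L < L
    pred< = ≤-reflexive (suc-pred L)

    origin last : Fin L
    origin = fromℕ< (>-nonZero⁻¹ L)
    last = fromℕ< pred<

    suc-last : suc (toℕ last) ≡ L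
    suc-last = trans (cong suc (Fin.toℕ-fromℕ< pred<)) (suc-pred L)

    OnBranch : Fin k → Vertex subdividedClique → Set
    OnBranch i v = branch v ≡ i

    along-arm : ∀ i j t {z z′} → toℕ z′ ≡ t + toℕ z →
      Within subdividedClique (OnBranch i) t (vertex (i , j , z)) (vertex (i , j , z′))
    along-arm i j zero {z} eq = subst (λ z′ → Within subdividedClique (OnBranch i) 0 (vertex (i , j , z)) (vertex (i , j , z′)))
      (sym (Fin.toℕ-injective eq)) stop
    along-arm i j (suc t) {z} {z′} eq =
      step (step⇒Adj (i , j , z) (i , j , next) (inj₁ (refl , refl , toℕ-next))) (branch-vertex (i , j , next))
        (along-arm i j t (trans eq (trans (sym (+-suc t _)) (cong (t +_) (sym toℕ-next)))))
      where
      next< : suc (toℕ z) < L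
      next< = ≤-<-trans (≤-trans (s≤s (m≤n+m (toℕ z) t)) (≤-reflexive (sym eq))) (Fin.toℕ<n z′)
      next = fromℕ< next<
      toℕ-next : toℕ next ≡ suc (toℕ z)
      toℕ-next = Fin.toℕ-fromℕ< next<

    toℕ-origin : toℕ origin ≡ 0
    toℕ-origin = Fin.toℕ-fromℕ< (>-nonZero⁻¹ L)

    from-origin : ∀ (z : Fin L) → toℕ z ≡ toℕ z + toℕ origin
    from-origin z = trans (sym (+-identityʳ _)) (cong (_+_ (toℕ z)) (sym toℕ-origin))

    -- Entering another arm costs one spoke and offsets are at most `L - 1`, so the radius is `L`.
    from-branch : ∀ a → Within subdividedClique (OnBranch (proj₁ a)) L (vertex (proj₁ a , proj₁ a , origin)) (vertex a)
    from-branch (i , j , z) with i Fin.≟ j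
    ... | yes refl = Within-mono (<⇒≤ (Fin.toℕ<n z)) (along-arm i i (toℕ z) (from-origin z))
    ... | no i≢j = Within-mono (Fin.toℕ<n z)
      (step (step⇒Adj (i , i , origin) (i , j , origin) (inj₂ (inj₁ (refl , refl , i≢j , toℕ-origin , toℕ-origin))))
        (branch-vertex (i , j , origin)) (along-arm i j (toℕ z) (from-origin z)))

  clique-minor : ∀ {r} → L ≤ r → IsShallowMinor r subdividedClique (complete k)
  clique-minor {r} L≤r = subdividedClique , (id , id , λ _ _ uv → uv) , record
    { φ = branch
    ; centre = λ h → vertex (h , h , origin)
    ; centre-fibre = λ h → branch-vertex (h , h , origin)
    ; radius = λ v → Within-mono L≤r (subst
        (Within subdividedClique (OnBranch (branch v)) L (vertex (branch v , branch v , origin)))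
        (Inverse.strictlyInverseʳ positions v) (from-branch (position v)))
    ; edge = λ h h′ → mk⇔
        (λ t → let h≢h′ = complete-adj⇒≢ {k} {h} {h′} t in h≢h′ ,
          vertex (h , h′ , last) , vertex (h′ , h , last) , branch-vertex (h , h′ , last) , branch-vertex (h′ , h , last) ,
          step⇒Adj (h , h′ , last) (h′ , h , last) (inj₂ (inj₂ (h≢h′ , refl , refl , suc-last , suc-last))))
        (λ (h≢h′ , _) → ≢⇒complete-adj {k} {h} {h′} h≢h′)
    }

-- Sizes of separators in the two families

last-true : ∀ {P : ℕ → Set} → (∀ m → Dec (P m)) → P 0 → ∀ N → ¬ P N → ∃[ m ] (P m × ¬ P (suc m))
last-true P? P0 zero ¬PN = contradiction P0 ¬PN
last-true P? P0 (suc N) ¬PN with P? N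
... | yes PN = N , PN , ¬PN
... | no ¬PN′ = last-true P? P0 N ¬PN′

^-distribʳ-* : ∀ x y n → (x * y) ^ n ≡ x ^ n * y ^ n
^-distribʳ-* x y zero = refl
^-distribʳ-* x y (suc n) = trans (cong (x * y *_) (^-distribʳ-* x y n)) (exchange x y (x ^ n) (y ^ n))
  where
  exchange : ∀ a b c d → a * b * (c * d) ≡ a * c * (b * d)
  exchange = solve-∀

^-cancelˡ-≤ : ∀ n .{{_ : NonZero n}} {x y} → x ^ n ≤ y ^ n → x ≤ y
^-cancelˡ-≤ n xⁿ≤yⁿ = ≮⇒≥ λ y<x → <⇒≱ (^-monoˡ-< n y<x) xⁿ≤yⁿ

-- `y` is an integer stand-in for the power of the order. The clause `y ≡ 1` admits separators of
-- constant size even when `Φ` offers no exponent, as happens for real exponent 0.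
SmallSeparator : ℕ → (ℕ → ℕ → Set) → Graph → Set
SmallSeparator K Φ H = ∃[ X ] (IsBalancedSeparator H X ×
  ∃[ y ] (1 ≤ y × ∣ X ∣ ≤ K * y × (y ≡ 1 ⊎ Φ y (order H))))

PowerBound : ℕ → ℕ → ℕ → ℕ → Set
PowerBound a b y n = y ^ b ≤ n ^ a

constant-separator : ∀ {K} Φ H X → IsBalancedSeparator H X → ∣ X ∣ ≤ K → SmallSeparator K Φ H
constant-separator {K} Φ H X balanced ≤K = X , balanced , 1 , ≤-refl , ≤-trans ≤K (≤-reflexive (sym (*-identityʳ K))) , inj₁ refl

small-order : ∀ {K} Φ H → order H ≤ K → SmallSeparator K Φ H
small-order Φ H ≤K = constant-separator Φ H everything
  (λ C (v , v∉ , _) → contradiction (∈-tabulate (λ _ → true) tt) v∉)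
  (≤-trans (∣p∣≤n everything) ≤K)
  where
  everything : Subset (order H)
  everything = tabulate λ _ → true

-- `suc d` counts the directions, and `2 ^ suc d` pays for rounding the side of a box down to an
-- integer `j`, since `suc j ≤ 2 * j`.
gridConstant : ℕ → ℕ
gridConstant d = 6 * (suc d * 2 ^ suc d)

module _ (d m L a b : ℕ) .{{_ : NonZero d}} .{{_ : NonZero m}} .{{_ : NonZero L}}
  (sparse : ∀ j → j ≤ m → (j ^ d) ^ b ≤ (2 * (L * j ^ suc d)) ^ a) where
  open Grid d m L

  -- Boxes are made as large as balance allows. If they are no longer than a subdivided edge,
  -- boundedly many vertices cut `H`. Otherwise a box of side `j` has about `L * j ^ suc d` vertices
  -- per direction, and blocks of `j * L` heights need about `order H / (j * L)` cut vertices, which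
  -- is of the order of `j ^ d`.
  grid-small-separator : ∀ {H} → Embedding Step H → SmallSeparator (gridConstant d) (PowerBound a b) H
  grid-small-separator {H} E = by-size (q ≟ 0) (q ≤? L)
    where
    open ≤-Reasoning
    n = order H
    D = suc d
    -- The largest value of `w * J ^ d` that `grid-separator` accepts.
    q = 2 * n / (3 * D)

    6D≤K : 6 * D ≤ gridConstant d
    6D≤K = *-monoʳ-≤ 6 (m≤m*n D (2 ^ D) {{m^n≢0 2 D}})

    3Dq≤2n : 3 * D * q ≤ 2 * n
    3Dq≤2n = ≤-trans (≤-reflexive (*-comm (3 * D) q)) (m/n*n≤m (2 * n) (3 * D))

    2n< : 2 * n < 3 * D * suc q
    2n< = begin-strict
      2 * n                              ≡⟨ m≡m%n+[m/n]*n (2 * n) (3 * D) ⟩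
      2 * n % (3 * D) + q * (3 * D)      <⟨ +-monoˡ-< (q * (3 * D)) (m%n<n (2 * n) (3 * D)) ⟩
      suc q * (3 * D)                    ≡⟨ *-comm (suc q) (3 * D) ⟩
      3 * D * suc q                      ∎

    n≤3Dq : 1 ≤ q → n ≤ 3 * D * q
    n≤3Dq 1≤q = *-cancelˡ-≤ 2 (begin
      2 * n               ≤⟨ <⇒≤ 2n< ⟩
      3 * D * suc q       ≤⟨ *-monoʳ-≤ (3 * D) (+-monoˡ-≤ q 1≤q) ⟩
      3 * D * (q + q)     ≡⟨ double (3 * D) q ⟩
      2 * (3 * D * q)     ∎)
      where
      double : ∀ x q → x * (q + q) ≡ 2 * (x * q)
      double = solve-∀

    2q≤n : 2 * q ≤ n
    2q≤n = *-cancelˡ-≤ 2 (begin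
      2 * (2 * q)     ≡⟨ *-assoc 2 2 q ⟨
      4 * q           ≤⟨ *-monoˡ-≤ q (≤-trans (m≤n+m 4 2) (*-monoʳ-≤ 3 (s≤s (>-nonZero⁻¹ d)))) ⟩
      3 * D * q       ≤⟨ 3Dq≤2n ⟩
      2 * n           ∎)

    regroup : ∀ D w J → 3 * (D * (w * J)) ≡ 3 * D * (w * J)
    regroup = solve-∀

    by-size : Dec (q ≡ 0) → Dec (q ≤ L) → SmallSeparator (gridConstant d) (PowerBound a b) H
    by-size (yes q≡0) _ = small-order (PowerBound a b) H (≤-trans (*-cancelˡ-≤ 2 (begin
      2 * n               ≤⟨ <⇒≤ 2n< ⟩
      3 * D * suc q       ≡⟨ cong (λ q → 3 * D * suc q) q≡0 ⟩
      3 * D * 1           ≤⟨ *-monoʳ-≤ (3 * D) (s≤s z≤n) ⟩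
      3 * D * 4           ≡⟨ shuffle D ⟩
      2 * (6 * D)         ∎)) 6D≤K)
      where
      shuffle : ∀ D → 3 * D * 4 ≡ 2 * (6 * D)
      shuffle = solve-∀
    by-size (no q≢0) (yes q≤L) = constant-separator (PowerBound a b) H X balanced (≤-trans (*-cancelˡ-≤ q (begin
      q * ∣ X ∣         ≤⟨ thin ⟩
      n                 ≤⟨ n≤3Dq (n≢0⇒n>0 q≢0) ⟩
      3 * D * q         ≤⟨ *-monoˡ-≤ q (*-monoˡ-≤ D (m≤m+n 3 3)) ⟩
      6 * D * q         ≡⟨ *-comm (6 * D) q ⟩
      q * (6 * D)       ∎)) 6D≤K)
      where
      instance
        q-nonZero : NonZero q
        q-nonZero = ≢-nonZero q≢0
      separator = grid-separator E q 1 (≤-trans q≤L (≤-reflexive (sym (*-identityˡ L)))) (begin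
        3 * (D * (q * 1 ^ d))    ≡⟨ regroup D q (1 ^ d) ⟩
        3 * D * (q * 1 ^ d)      ≡⟨ cong (3 * D *_) (trans (cong (q *_) (^-zeroˡ d)) (*-identityʳ q)) ⟩
        3 * D * q                ≤⟨ 3Dq≤2n ⟩
        2 * n                    ∎)
      X = proj₁ separator
      balanced = proj₁ (proj₂ separator)
      thin = proj₂ (proj₂ separator)
    by-size (no q≢0) (no q≰L) = by-scale (last-true fits? fits-0 (suc q) ¬fits)
      where
      Fits : ℕ → Set
      Fits j = L * j ^ D ≤ q
      fits? : ∀ j → Dec (Fits j)
      fits? j = L * j ^ D ≤? q
      fits-0 : Fits 0
      fits-0 = ≤-trans (≤-reflexive (*-zeroʳ L)) z≤n
      ¬fits : ¬ Fits (suc q)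
      ¬fits le = <⇒≱ (n<1+n q) (begin
        suc q              ≡⟨ ^-identityʳ (suc q) ⟨
        suc q ^ 1          ≤⟨ ^-monoʳ-≤ (suc q) {1} {D} (s≤s z≤n) ⟩
        suc q ^ D          ≤⟨ m≤n*m (suc q ^ D) L ⟩
        L * suc q ^ D      ≤⟨ le ⟩
        q                  ∎)
      by-scale : ∃[ j ] (Fits j × ¬ Fits (suc j)) → SmallSeparator (gridConstant d) (PowerBound a b) H
      by-scale (zero , _ , ¬fits-1) = contradiction
        (≤-trans (≤-reflexive (trans (cong (L *_) (^-zeroˡ D)) (*-identityʳ L))) (<⇒≤ (≰⇒> q≰L))) ¬fits-1
      by-scale (j@(suc _) , fits , ¬fits-suc) = X , balanced , j ^ d , m^n>0 j d , *-cancelˡ-≤ (j * L) (begin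
          j * L * ∣ X ∣                             ≤⟨ thin ⟩
          n                                         ≤⟨ n≤3Dq (n≢0⇒n>0 q≢0) ⟩
          3 * D * q                                 ≤⟨ *-monoʳ-≤ (3 * D) (<⇒≤ (≰⇒> ¬fits-suc)) ⟩
          3 * D * (L * suc j ^ D)                   ≤⟨ *-monoʳ-≤ (3 * D) (*-monoʳ-≤ L (^-monoˡ-≤ D (+-monoˡ-≤ j (s≤s z≤n)))) ⟩
          3 * D * (L * (j + j) ^ D)                 ≡⟨ cong (λ t → 3 * D * (L * t)) (trans (cong (_^ D) (double j)) (^-distribʳ-* 2 j D)) ⟩
          3 * D * (L * (2 ^ D * (j * j ^ d)))       ≤⟨ *-monoˡ-≤ (L * (2 ^ D * (j * j ^ d))) (*-monoˡ-≤ D (m≤m+n 3 3)) ⟩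
          6 * D * (L * (2 ^ D * (j * j ^ d)))       ≡⟨ shuffle D L (2 ^ D) j (j ^ d) ⟩
          j * L * (gridConstant d * j ^ d)          ∎) , inj₂ (begin
          (j ^ d) ^ b                               ≤⟨ sparse j j≤m ⟩
          (2 * (L * j ^ D)) ^ a                     ≤⟨ ^-monoˡ-≤ a (≤-trans (*-monoʳ-≤ 2 fits) 2q≤n) ⟩
          n ^ a                                     ∎)
        where
        instance
          jL≢0 : NonZero (j * L)
          jL≢0 = m*n≢0 j L
        Lm≢0 : NonZero (L * m ^ D)
        Lm≢0 = m*n≢0 L (m ^ D)
          where
          instance
            mᴰ≢0 : NonZero (m ^ D)
            mᴰ≢0 = m^n≢0 m D
        double : ∀ j → j + j ≡ 2 * j
        double = solve-∀
        shuffle : ∀ D L t j p → 6 * D * (L * (t * (j * p))) ≡ j * L * (6 * (D * t) * p)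
        shuffle = solve-∀
        scale : ∀ L j p → j * L * p ≡ L * (j * p)
        scale = solve-∀
        -- `sparse` is available only up to `m`. Boxes of side `j` take at most two thirds of the
        -- order of the host grid, so `j` cannot exceed `m`.
        j≤m : j ≤ m
        j≤m = ≮⇒≥ λ m<j → <⇒≱ (*-monoʳ-< (D * (L * m ^ D)) {{m*n≢0 D (L * m ^ D) {{record {}}} {{Lm≢0}}}} (n<1+n 2)) (begin
          D * (L * m ^ D) * 3              ≤⟨ *-monoˡ-≤ 3 (*-monoʳ-≤ D (*-monoʳ-≤ L (^-monoˡ-≤ D (<⇒≤ m<j)))) ⟩
          D * (L * j ^ D) * 3              ≤⟨ *-monoˡ-≤ 3 (*-monoʳ-≤ D fits) ⟩
          D * q * 3                        ≡⟨ rotate D q ⟩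
          3 * D * q                        ≤⟨ 3Dq≤2n ⟩
          2 * n                            ≤⟨ *-monoʳ-≤ 2 (order≤ Step positions E) ⟩
          2 * (D * (m ^ d * (m * L)))      ≡⟨ collect D m L (m ^ d) ⟩
          D * (L * m ^ D) * 2              ∎)
          where
          rotate : ∀ D q → D * q * 3 ≡ 3 * D * q
          rotate = solve-∀
          collect : ∀ D m L p → 2 * (D * (p * (m * L))) ≡ D * (L * (m * p)) * 2
          collect = solve-∀
        separator = grid-separator E (j * L) j ≤-refl (begin
          3 * (D * (j * L * j ^ d))     ≡⟨ regroup D (j * L) (j ^ d) ⟩
          3 * D * (j * L * j ^ d)       ≡⟨ cong (3 * D *_) (scale L j (j ^ d)) ⟩
          3 * D * (L * j ^ D)           ≤⟨ *-monoʳ-≤ (3 * D) fits ⟩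
          3 * D * q                     ≤⟨ 3Dq≤2n ⟩
          2 * n                         ∎)
        X = proj₁ separator
        balanced = proj₁ (proj₂ separator)
        thin = proj₂ (proj₂ separator)

module _ (k L a b : ℕ) .{{_ : NonZero k}} .{{_ : NonZero L}} (sparse : ∀ y → y ≤ k → y ^ b ≤ (y * L) ^ a) where
  open Clique k L

  -- The 7 arises when `order H / 3` is at most `L`: cutting at that distance takes at most 6
  -- vertices, and one more breaks the largest star. For larger `H`, the smaller of `n / L` and `k`
  -- serves as `y`.
  clique-small-separator : ∀ {K H} → 7 ≤ K → Embedding Step H → SmallSeparator K (PowerBound a b) H
  clique-small-separator {K} {H} 7≤K E = by-size (q ≟ 0) (q ≤? L)
    where
    open ≤-Reasoning
    n = order H
    q = n / 3

    3q≤n : 3 * q ≤ n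
    3q≤n = ≤-trans (≤-reflexive (*-comm 3 q)) (m/n*n≤m n 3)

    n< : n < 3 * suc q
    n< = begin-strict
      n                  ≡⟨ m≡m%n+[m/n]*n n 3 ⟩
      n % 3 + q * 3      <⟨ +-monoˡ-< (q * 3) (m%n<n n 3) ⟩
      suc q * 3          ≡⟨ *-comm (suc q) 3 ⟩
      3 * suc q          ∎

    by-size : Dec (q ≡ 0) → Dec (q ≤ L) → SmallSeparator K (PowerBound a b) H
    by-size (yes q≡0) _ = small-order (PowerBound a b) H (begin
      n            ≤⟨ <⇒≤ n< ⟩
      3 * suc q    ≡⟨ cong (λ q → 3 * suc q) q≡0 ⟩
      3            ≤⟨ m≤m+n 3 4 ⟩
      7            ≤⟨ 7≤K ⟩
      K            ∎)
    by-size (no q≢0) (yes q≤L) = let X , balanced , c , qc≤n , X≤ = thin-separator E q q≤L 3q≤n in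
      constant-separator (PowerBound a b) H X balanced (begin
        ∣ X ∣      ≤⟨ X≤ ⟩
        c + 1      ≤⟨ +-monoˡ-≤ 1 (*-cancelˡ-≤ q (≤-trans qc≤n n≤q*6)) ⟩
        7          ≤⟨ 7≤K ⟩
        K          ∎)
      where
      instance
        q-nonZero : NonZero q
        q-nonZero = ≢-nonZero q≢0
      n≤q*6 : n ≤ q * 6
      n≤q*6 = begin
        n              ≤⟨ <⇒≤ n< ⟩
        3 * suc q      ≤⟨ *-monoʳ-≤ 3 (+-monoˡ-≤ q (n≢0⇒n>0 q≢0)) ⟩
        3 * (q + q)    ≡⟨ six q ⟩
        q * 6          ∎
        where
        six : ∀ q → 3 * (q + q) ≡ q * 6
        six = solve-∀
    by-size (no q≢0) (no q≰L) = by-number (c ≤? k)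
      where
      c = n / L
      3L≤n : 3 * L ≤ n
      3L≤n = ≤-trans (*-monoʳ-≤ 3 (<⇒≤ (≰⇒> q≰L))) 3q≤n
      cL≤n : c * L ≤ n
      cL≤n = m/n*n≤m n L
      1≤c : 1 ≤ c
      1≤c = m≥n⇒m/n>0 {n} {L} (≤-trans (m≤n*m L 3) 3L≤n)
      bounded : ∀ y → y ≤ k → y ≤ c → y ^ b ≤ n ^ a
      bounded y y≤k y≤c = ≤-trans (sparse y y≤k) (^-monoˡ-≤ a (≤-trans (*-monoˡ-≤ L y≤c) cL≤n))
      by-number : Dec (c ≤ k) → SmallSeparator K (PowerBound a b) H
      by-number (yes c≤k) = let X , balanced , e , Le≤n , X≤ = thin-separator E L ≤-refl 3L≤n in
        X , balanced , c , 1≤c , (begin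
          ∣ X ∣      ≤⟨ X≤ ⟩
          e + 1      ≤⟨ +-mono-≤ (≤-trans (≤-reflexive (sym (m*n/m≡n L e))) (/-monoˡ-≤ L Le≤n)) 1≤c ⟩
          c + c      ≡⟨ double c ⟩
          2 * c      ≤⟨ *-monoˡ-≤ c (≤-trans (m≤m+n 2 5) 7≤K) ⟩
          K * c      ∎) , inj₂ (bounded c c≤k ≤-refl)
        where
        double : ∀ c → c + c ≡ 2 * c
        double = solve-∀
        m*n/m≡n : ∀ m n .{{_ : NonZero m}} → m * n / m ≡ n
        m*n/m≡n m n = trans (cong (_/ m) (*-comm m n)) (m*n/n≡m n m)
      by-number (no c≰k) = let X , balanced , X≤ = branch-separator E 3L≤n in
        X , balanced , k , >-nonZero⁻¹ k , ≤-trans X≤ (m≤n*m k K {{>-nonZero (≤-trans (s≤s z≤n) 7≤K)}}) ,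
        inj₂ (bounded k ≤-refl (<⇒≤ (≰⇒> c≰k)))

-- Equality holds at `y = j ^ a`; for smaller `y` the left side drops faster, having the larger
-- exponent of `y`.
clique-sparse : ∀ a e j y → y ≤ j ^ a → y ^ (a + e) ≤ (y * j ^ e) ^ a
clique-sparse a e j y y≤ = begin
  y ^ (a + e)               ≡⟨ ^-distribˡ-+-* y a e ⟩
  y ^ a * y ^ e             ≤⟨ *-monoʳ-≤ (y ^ a) (^-monoˡ-≤ e y≤) ⟩
  y ^ a * (j ^ a) ^ e       ≡⟨ cong (y ^ a *_) (trans (^-*-assoc j a e) (trans (cong (j ^_) (*-comm a e)) (sym (^-*-assoc j e a)))) ⟩
  y ^ a * (j ^ e) ^ a       ≡⟨ ^-distribʳ-* y (j ^ e) a ⟨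
  (y * j ^ e) ^ a           ∎
  where open ≤-Reasoning

-- For `j = m` this follows from `small` and `large`. Replacing `m` by `j` divides the left side by
-- `(m / j) ^ (b * d)` and the right side only by `(m / j) ^ (a * suc d)`.
grid-sparse : ∀ d m L a b n .{{_ : NonZero m}} → a ≤ b → a * suc d ≤ b * d →
  (suc d * m ^ d) ^ b ≤ n ^ a → n ≤ 2 * (suc d * (m ^ suc d * L)) →
  ∀ j → j ≤ m → (j ^ d) ^ b ≤ (2 * (L * j ^ suc d)) ^ a
grid-sparse d m L a b n a≤b aD≤bd small large j j≤m = *-cancelʳ-≤ _ _ (m ^ (a * D) * D ^ b) (begin
  (j ^ d) ^ b * (m ^ (a * D) * D ^ b)                        ≡⟨ cong (_* (m ^ (a * D) * D ^ b)) (split j) ⟩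
  j ^ (a * D) * j ^ e * (m ^ (a * D) * D ^ b)                ≤⟨ *-monoˡ-≤ (m ^ (a * D) * D ^ b) (*-monoʳ-≤ (j ^ (a * D)) (^-monoˡ-≤ e j≤m)) ⟩
  j ^ (a * D) * m ^ e * (m ^ (a * D) * D ^ b)                ≡⟨ regroup₁ (j ^ (a * D)) (m ^ e) (m ^ (a * D)) (D ^ b) ⟩
  j ^ (a * D) * (D ^ b * (m ^ (a * D) * m ^ e))              ≡⟨ cong (λ t → j ^ (a * D) * (D ^ b * t)) (split m) ⟨
  j ^ (a * D) * (D ^ b * (m ^ d) ^ b)                        ≡⟨ cong (j ^ (a * D) *_) (^-distribʳ-* D (m ^ d) b) ⟨
  j ^ (a * D) * (D * m ^ d) ^ b                              ≤⟨ *-monoʳ-≤ (j ^ (a * D)) (≤-trans small (^-monoˡ-≤ a large)) ⟩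
  j ^ (a * D) * (2 * (D * (m ^ D * L))) ^ a                  ≡⟨ cong (λ t → j ^ (a * D) * t ^ a) (regroup₂ D (m ^ D) L) ⟩
  j ^ (a * D) * (2 * L * m ^ D * D) ^ a                      ≡⟨ cong (j ^ (a * D) *_) (trans (^-distribʳ-* (2 * L * m ^ D) D a)
                                                                  (cong (_* D ^ a) (trans (^-distribʳ-* (2 * L) (m ^ D) a) (cong ((2 * L) ^ a *_) (power m))))) ⟩
  j ^ (a * D) * ((2 * L) ^ a * m ^ (a * D) * D ^ a)          ≤⟨ *-monoʳ-≤ (j ^ (a * D)) (*-monoʳ-≤ ((2 * L) ^ a * m ^ (a * D)) (^-monoʳ-≤ D a≤b)) ⟩
  j ^ (a * D) * ((2 * L) ^ a * m ^ (a * D) * D ^ b)          ≡⟨ regroup₃ (j ^ (a * D)) ((2 * L) ^ a) (m ^ (a * D)) (D ^ b) ⟩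
  (2 * L) ^ a * j ^ (a * D) * (m ^ (a * D) * D ^ b)          ≡⟨ cong (_* (m ^ (a * D) * D ^ b)) (trans (cong ((2 * L) ^ a *_) (sym (power j)))
                                                                  (trans (sym (^-distribʳ-* (2 * L) (j ^ D) a)) (cong (_^ a) (*-assoc 2 L (j ^ D))))) ⟩
  (2 * (L * j ^ D)) ^ a * (m ^ (a * D) * D ^ b)              ∎)
  where
  open ≤-Reasoning
  D = suc d
  e = b * d ∸ a * D
  instance
    factor≢0 : NonZero (m ^ (a * D) * D ^ b)
    factor≢0 = m*n≢0 (m ^ (a * D)) (D ^ b) {{m^n≢0 m (a * D)}} {{m^n≢0 D b}}
  split : ∀ j → (j ^ d) ^ b ≡ j ^ (a * D) * j ^ e
  split j = trans (^-*-assoc j d b) (trans (cong (j ^_) (trans (*-comm d b) (sym (m+[n∸m]≡n aD≤bd)))) (^-distribˡ-+-* j (a * D) e))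
  power : ∀ j → (j ^ D) ^ a ≡ j ^ (a * D)
  power j = trans (^-*-assoc j D a) (cong (j ^_) (*-comm D a))
  regroup₁ : ∀ x y z w → x * y * (z * w) ≡ x * (w * (z * y))
  regroup₁ = solve-∀
  regroup₂ : ∀ D x L → 2 * (D * (x * L)) ≡ 2 * L * x * D
  regroup₂ = solve-∀
  regroup₃ : ∀ x y z w → x * (y * z * w) ≡ y * x * (z * w)
  regroup₃ = solve-∀

unit-grid-small-separator : ∀ d {Φ H} → Embedding (Grid.Step d 1 1) H → SmallSeparator (gridConstant d) Φ H
unit-grid-small-separator d {Φ} {H} E = small-order Φ H (begin
  order H                        ≤⟨ order≤ (Grid.Step d 1 1) (Grid.positions d 1 1) E ⟩
  suc d * (1 ^ d * 1)            ≡⟨ cong (λ t → suc d * (t * 1)) (^-zeroˡ d) ⟩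
  suc d * 1                      ≤⟨ *-monoʳ-≤ (suc d) (m^n>0 2 (suc d)) ⟩
  suc d * 2 ^ suc d              ≤⟨ m≤n*m (suc d * 2 ^ suc d) 6 ⟩
  gridConstant d                 ∎)
  where open ≤-Reasoning

unit-grid-order : ∀ d → order (Grid.grid d 1 1) ≡ suc d
unit-grid-order d = trans (cong (λ t → suc d * (t * 1)) (^-zeroˡ d)) (*-identityʳ (suc d))

record ExtremalGrid (d n : ℕ) (Φ : ℕ → ℕ → Set) : Set where
  field
    m L : ℕ
    {{m≢0}} : NonZero m
    {{L≢0}} : NonZero L
    small : order (Grid.grid d m L) ≤ n
    separators : ∀ {H} → Embedding (Grid.Step d m L) H → SmallSeparator (gridConstant d) Φ H

  -- When `m` is the largest fitting side, this exceeds the target power of `n`: `2 ^ d` absorbs the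
  -- step from `m` to `suc m`.
  size : ℕ
  size = suc d * 2 ^ d * m ^ d

unit-grid : ∀ d n {Φ} → suc d ≤ n → ExtremalGrid d n Φ
unit-grid d n {Φ} D≤n = record
  { m = 1
  ; L = 1
  ; small = ≤-trans (≤-reflexive (unit-grid-order d)) D≤n
  ; separators = unit-grid-small-separator d {Φ}
  }

extremal-grid : ∀ d n a b .{{d≢0 : NonZero d}} .{{_ : NonZero a}} → a ≤ b → a * suc d ≤ b * d → suc d ≤ n →
  Σ[ g ∈ ExtremalGrid d n (PowerBound a b) ] n ^ a < ExtremalGrid.size g ^ b
extremal-grid d n a b {{d≢0}} a≤b aD≤bd D≤n = by-side (last-true fits? fits-0 (suc n) ¬fits)
  where
  open ≤-Reasoning
  D = suc d
  instance
    b≢0 : NonZero b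
    b≢0 = >-nonZero (≤-trans (>-nonZero⁻¹ a) a≤b)
    n≢0 : NonZero n
    n≢0 = >-nonZero (≤-trans (s≤s z≤n) D≤n)
    db≢0 : NonZero (d * b)
    db≢0 = m*n≢0 d b
  Fits : ℕ → Set
  -- The factor `D` pays for the `suc d` directions in the order of the grid, so that `grid-sparse`
  -- loses no constant depending on `a` and `b`.
  Fits m = (D * m ^ d) ^ b ≤ n ^ a
  fits? : ∀ m → Dec (Fits m)
  fits? m = (D * m ^ d) ^ b ≤? n ^ a
  fits-0 : Fits 0
  fits-0 = ≤-trans (≤-reflexive (trans (cong (_^ b) (trans (cong (D *_) (0^ d)) (*-zeroʳ D))) (0^ b))) z≤n
    where
    0^ : ∀ k .{{_ : NonZero k}} → 0 ^ k ≡ 0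
    0^ (suc k) = refl
  ¬fits : ¬ Fits (suc n)
  ¬fits le = <⇒≱ (^-monoˡ-< b (n<1+n n)) (begin
    suc n ^ b                   ≤⟨ ^-monoˡ-≤ b (≤-trans (≤-reflexive (sym (^-identityʳ (suc n)))) (^-monoʳ-≤ (suc n) {1} {d} (>-nonZero⁻¹ d))) ⟩
    (suc n ^ d) ^ b             ≤⟨ ^-monoˡ-≤ b (m≤n*m (suc n ^ d) D) ⟩
    (D * suc n ^ d) ^ b         ≤⟨ le ⟩
    n ^ a                       ≤⟨ ^-monoʳ-≤ n a≤b ⟩
    n ^ b                       ∎)
  by-side : ∃[ m ] (Fits m × ¬ Fits (suc m)) → Σ[ g ∈ ExtremalGrid d n (PowerBound a b) ] n ^ a < ExtremalGrid.size g ^ b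
  -- If not even side 1 fits, the target power of `n` is below a constant, which a grid of bounded
  -- order attains.
  by-side (zero , _ , ¬fits-1) = unit-grid d n D≤n , (begin-strict
    n ^ a                       <⟨ ≰⇒> ¬fits-1 ⟩
    (D * 1 ^ d) ^ b             ≤⟨ ^-monoˡ-≤ b (*-monoˡ-≤ (1 ^ d) (m≤m*n D (2 ^ d) {{m^n≢0 2 d}})) ⟩
    (D * 2 ^ d * 1 ^ d) ^ b     ∎)
  by-side (m@(suc _) , fits , ¬fits-suc) = grid-at , (begin-strict
    n ^ a                       <⟨ ≰⇒> ¬fits-suc ⟩
    (D * suc m ^ d) ^ b         ≤⟨ ^-monoˡ-≤ b (*-monoʳ-≤ D (^-monoˡ-≤ d (+-monoˡ-≤ m (s≤s z≤n)))) ⟩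
    (D * (m + m) ^ d) ^ b       ≡⟨ cong (λ t → (D * t) ^ b) (trans (cong (_^ d) (double m)) (^-distribʳ-* 2 m d)) ⟩
    (D * (2 ^ d * m ^ d)) ^ b   ≡⟨ cong (_^ b) (sym (*-assoc D (2 ^ d) (m ^ d))) ⟩
    (D * 2 ^ d * m ^ d) ^ b     ∎)
    where
    double : ∀ m → m + m ≡ 2 * m
    double = solve-∀
    V = D * m ^ D
    instance
      V≢0 : NonZero V
      V≢0 = m*n≢0 D (m ^ D) {{record {}}} {{m^n≢0 m D}}
    L = n / V
    -- There is room for at least one unit of subdivision: as `a / b ≤ d / suc d`, a side that fits
    -- gives an unsubdivided grid of order at most `n`.
    V≤n : V ≤ n
    V≤n = ^-cancelˡ-≤ (d * b) (begin
      (D * m ^ D) ^ (d * b)               ≡⟨ trans (^-distribʳ-* D (m ^ D) (d * b)) (cong (D ^ (d * b) *_) (^-*-assoc m D (d * b))) ⟩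
      D ^ (d * b) * m ^ (D * (d * b))     ≤⟨ *-monoˡ-≤ (m ^ (D * (d * b))) (^-monoʳ-≤ D (≤-trans (*-monoˡ-≤ b (n≤1+n d)) (≤-reflexive (*-comm D b)))) ⟩
      D ^ (b * D) * m ^ (D * (d * b))     ≡⟨ cong₂ _*_ (sym (^-*-assoc D b D)) (trans (cong (m ^_) (*-comm D (d * b))) (trans (sym (^-*-assoc m (d * b) D)) (cong (_^ D) (sym (^-*-assoc m d b))))) ⟩
      (D ^ b) ^ D * ((m ^ d) ^ b) ^ D     ≡⟨ ^-distribʳ-* (D ^ b) ((m ^ d) ^ b) D ⟨
      (D ^ b * (m ^ d) ^ b) ^ D           ≡⟨ cong (_^ D) (^-distribʳ-* D (m ^ d) b) ⟨
      ((D * m ^ d) ^ b) ^ D               ≤⟨ ^-monoˡ-≤ D fits ⟩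
      (n ^ a) ^ D                         ≡⟨ ^-*-assoc n a D ⟩
      n ^ (a * D)                         ≤⟨ ^-monoʳ-≤ n (≤-trans aD≤bd (≤-reflexive (*-comm b d))) ⟩
      n ^ (d * b)                         ∎)
    1≤L : 1 ≤ L
    1≤L = m≥n⇒m/n>0 V≤n
    n≤2VL : n ≤ 2 * (D * (m ^ D * L))
    n≤2VL = begin
      n                          ≡⟨ m≡m%n+[m/n]*n n V ⟩
      n % V + L * V              ≤⟨ +-monoˡ-≤ (L * V) (≤-trans (<⇒≤ (m%n<n n V)) (m≤n*m V L {{>-nonZero 1≤L}})) ⟩
      L * V + L * V              ≡⟨ regroup L D (m ^ D) ⟩
      2 * (D * (m ^ D * L))      ∎
      where
      regroup : ∀ L D x → L * (D * x) + L * (D * x) ≡ 2 * (D * (x * L))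
      regroup = solve-∀
    grid-at : ExtremalGrid d n (PowerBound a b)
    grid-at = record
      { m = m
      ; L = L
      ; L≢0 = >-nonZero 1≤L
      ; small = ≤-trans (≤-reflexive (regroup D (m ^ d) m L)) (m/n*n≤m n V)
      ; separators = grid-small-separator d m L a b {{d≢0}} {{record {}}} {{>-nonZero 1≤L}} (grid-sparse d m L a b n a≤b aD≤bd fits n≤2VL)
      }
      where
      regroup : ∀ D p m L → D * (p * (m * L)) ≡ L * (D * (m * p))
      regroup = solve-∀

-- Real exponents

fromℕ≃ : ∀ n → ℚ.toℚᵘ (fromℕ n) ℚᵘ.≃ ℚᵘ.mkℚᵘ (ℤ.+ n) 0
fromℕ≃ n = ℚ.toℚᵘ-fromℚᵘ (ℚᵘ.mkℚᵘ (ℤ.+ n) 0)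

fromℕ-mono-< : ∀ {m n} → m < n → fromℕ m ℚ.< fromℕ n
fromℕ-mono-< {m} {n} m<n = /-mono-< {m} {1} {n} {1} (*-monoˡ-< 1 m<n)

fromℕ-mono-≤ : ∀ {m n} → m ≤ n → fromℕ m ℚ.≤ fromℕ n
fromℕ-mono-≤ {m} {n} m≤n with m≤n⇒m<n∨m≡n m≤n
... | inj₁ m<n = ℚ.<⇒≤ (fromℕ-mono-< m<n)
... | inj₂ refl = ℚ.≤-refl

ℚ-<⇒≱ : ∀ {p q} → p ℚ.< q → ¬ q ℚ.≤ p
ℚ-<⇒≱ p<q q≤p = ℚ.<-irrefl refl (ℚ.<-≤-trans p<q q≤p)

fromℕ-cancel-≤ : ∀ {m n} → fromℕ m ℚ.≤ fromℕ n → m ≤ n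
fromℕ-cancel-≤ le = ≮⇒≥ λ n<m → ℚ-<⇒≱ (fromℕ-mono-< n<m) le

fromℕ-cancel-< : ∀ {m n} → fromℕ m ℚ.< fromℕ n → m < n
fromℕ-cancel-< lt = ≰⇒> λ n≤m → ℚ-<⇒≱ lt (fromℕ-mono-≤ n≤m)

fromℕ-* : ∀ m n → fromℕ (m * n) ≡ fromℕ m ℚ.* fromℕ n
fromℕ-* m n = ℚ.toℚᵘ-injective (begin
  ℚ.toℚᵘ (fromℕ (m * n))                            ≈⟨ fromℕ≃ (m * n) ⟩
  ℚᵘ.mkℚᵘ (ℤ.+ (m * n)) 0                           ≡⟨ cong (λ z → ℚᵘ.mkℚᵘ z 0) (ℤ.pos-* m n) ⟩
  ℚᵘ.mkℚᵘ (ℤ.+ m) 0 ℚᵘ.* ℚᵘ.mkℚᵘ (ℤ.+ n) 0          ≈⟨ ℚᵘ.*-cong (fromℕ≃ m) (fromℕ≃ n) ⟨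
  ℚ.toℚᵘ (fromℕ m) ℚᵘ.* ℚ.toℚᵘ (fromℕ n)            ≈⟨ ℚ.toℚᵘ-homo-* (fromℕ m) (fromℕ n) ⟨
  ℚ.toℚᵘ (fromℕ m ℚ.* fromℕ n)                      ∎)
  where open ℚᵘ.≃-Reasoning

fromℕ-+ : ∀ m n → fromℕ (m + n) ≡ fromℕ m ℚ.+ fromℕ n
fromℕ-+ m n = ℚ.toℚᵘ-injective (begin
  ℚ.toℚᵘ (fromℕ (m + n))                            ≈⟨ fromℕ≃ (m + n) ⟩
  ℚᵘ.mkℚᵘ (ℤ.+ (m + n)) 0                           ≡⟨ cong₂ (λ y z → ℚᵘ.mkℚᵘ (y ℤ.+ z) 0) (ℤ.*-identityʳ (ℤ.+ m)) (ℤ.*-identityʳ (ℤ.+ n)) ⟨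
  ℚᵘ.mkℚᵘ (ℤ.+ m) 0 ℚᵘ.+ ℚᵘ.mkℚᵘ (ℤ.+ n) 0          ≈⟨ ℚᵘ.+-cong (fromℕ≃ m) (fromℕ≃ n) ⟨
  ℚ.toℚᵘ (fromℕ m) ℚᵘ.+ ℚ.toℚᵘ (fromℕ n)            ≈⟨ ℚ.toℚᵘ-homo-+ (fromℕ m) (fromℕ n) ⟨
  ℚ.toℚᵘ (fromℕ m ℚ.+ fromℕ n)                      ∎)
  where open ℚᵘ.≃-Reasoning

clear-denominator : ∀ p {a} → ↥ p ≡ ℤ.+ a → p ℚ.* fromℕ (↧ₙ p) ≡ fromℕ a
clear-denominator p@(mkℚ _ b-1 _) {a} refl = ℚ.toℚᵘ-injective (begin
  ℚ.toℚᵘ (p ℚ.* fromℕ (suc b-1))                     ≈⟨ ℚ.toℚᵘ-homo-* p (fromℕ (suc b-1)) ⟩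
  ℚ.toℚᵘ p ℚᵘ.* ℚ.toℚᵘ (fromℕ (suc b-1))             ≈⟨ ℚᵘ.*-congˡ {ℚ.toℚᵘ p} (fromℕ≃ (suc b-1)) ⟩
  ℚᵘ.mkℚᵘ (ℤ.+ a) b-1 ℚᵘ.* ℚᵘ.mkℚᵘ (ℤ.+ suc b-1) 0  ≈⟨ ℚᵘ.*≡* (trans (ℤ.*-identityʳ _) (cong (λ d → ℤ.+ a ℤ.* ℤ.+ d) (sym (*-identityʳ (suc b-1))))) ⟩
  ℚᵘ.mkℚᵘ (ℤ.+ a) 0                                  ≈⟨ fromℕ≃ a ⟨
  ℚ.toℚᵘ (fromℕ a)                                   ∎)
  where open ℚᵘ.≃-Reasoning

reciprocal : ∀ n .{{_ : NonZero n}} → (ℤ.+ 1 ℚ./ n) ℚ.* fromℕ n ≡ 1ℚ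
reciprocal n@(suc n-1) = ℚ.toℚᵘ-injective (begin
  ℚ.toℚᵘ ((ℤ.+ 1 ℚ./ n) ℚ.* fromℕ n)                 ≈⟨ ℚ.toℚᵘ-homo-* (ℤ.+ 1 ℚ./ n) (fromℕ n) ⟩
  ℚ.toℚᵘ (ℤ.+ 1 ℚ./ n) ℚᵘ.* ℚ.toℚᵘ (fromℕ n)         ≈⟨ ℚᵘ.*-cong (ℚ.toℚᵘ-fromℚᵘ (ℚᵘ.mkℚᵘ (ℤ.+ 1) n-1)) (fromℕ≃ n) ⟩
  ℚᵘ.mkℚᵘ (ℤ.+ 1) n-1 ℚᵘ.* ℚᵘ.mkℚᵘ (ℤ.+ n) 0         ≈⟨ ℚᵘ.*≡* (trans (ℤ.*-identityʳ _) (cong (λ d → ℤ.+ 1 ℤ.* ℤ.+ d) (sym (*-identityʳ n)))) ⟩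
  ℚᵘ.1ℚᵘ                                             ∎)
  where open ℚᵘ.≃-Reasoning

0≤fromℕ : ∀ n → 0ℚ ℚ.≤ fromℕ n
0≤fromℕ n = fromℕ-mono-≤ {0} {n} z≤n

*-mono-≤-0 : ∀ {a b c d} → 0ℚ ℚ.≤ a → a ℚ.≤ b → 0ℚ ℚ.≤ c → c ℚ.≤ d → a ℚ.* c ℚ.≤ b ℚ.* d
*-mono-≤-0 {a} {b} {c} {d} 0≤a a≤b 0≤c c≤d = ℚ.≤-trans
  (ℚ.*-monoˡ-≤-nonNeg a {{ℚ.nonNegative 0≤a}} c≤d)
  (ℚ.*-monoʳ-≤-nonNeg d {{ℚ.nonNegative (ℚ.≤-trans 0≤c c≤d)}} a≤b)

0≤* : ∀ {a b} → 0ℚ ℚ.≤ a → 0ℚ ℚ.≤ b → 0ℚ ℚ.≤ a ℚ.* b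
0≤* {a} {b} 0≤a 0≤b = subst (ℚ._≤ a ℚ.* b) (ℚ.*-zeroʳ a) (ℚ.*-monoˡ-≤-nonNeg a {{ℚ.nonNegative 0≤a}} 0≤b)

0≤^ : ∀ {t} n → 0ℚ ℚ.≤ t → 0ℚ ℚ.≤ t ^ℚ n
0≤^ zero 0≤t = 0≤fromℕ 1
0≤^ (suc n) 0≤t = 0≤* 0≤t (0≤^ n 0≤t)

^ℚ-mono-≤ : ∀ {s t} n → 0ℚ ℚ.≤ s → s ℚ.≤ t → s ^ℚ n ℚ.≤ t ^ℚ n
^ℚ-mono-≤ zero 0≤s s≤t = ℚ.≤-refl
^ℚ-mono-≤ (suc n) 0≤s s≤t = *-mono-≤-0 0≤s s≤t (0≤^ n 0≤s) (^ℚ-mono-≤ n 0≤s s≤t)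

fromℕ-^ : ∀ y n → fromℕ (y ^ n) ≡ fromℕ y ^ℚ n
fromℕ-^ y zero = refl
fromℕ-^ y (suc n) = trans (fromℕ-* y (y ^ n)) (cong (fromℕ y ℚ.*_) (fromℕ-^ y n))

root≤ : ∀ {t} N S b → t ^ℚ b ℚ.≤ fromℕ N → N < S ^ b → t ℚ.≤ fromℕ S
root≤ {t} N S b tᵇ≤N N<Sᵇ with ℚ.≤-total t (fromℕ S)
... | inj₁ le = le
... | inj₂ ge = contradiction (fromℕ-cancel-≤ (subst (ℚ._≤ fromℕ N) (sym (fromℕ-^ S b))
  (ℚ.≤-trans (^ℚ-mono-≤ b (0≤fromℕ S) ge) tᵇ≤N))) (<⇒≱ N<Sᵇ)

lower<upper : ∀ x {p q} → lower x p → upper x q → p ℚ.< q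
lower<upper x {p} {q} lp uq with ℚ.<-cmp p q
... | tri< p<q _ _ = p<q
... | tri≈ _ refl _ = contradiction (lp , uq) (disjoint x)
... | tri> _ _ q<p = contradiction (lower-closed x q<p lp , uq) (disjoint x)

root⇒power : ∀ {r k E a b-1 t} .{c : Coprime a (suc b-1)} → 0ℚ ℚ.≤ t → fromℕ k ℚ.≤ fromℕ E ℚ.* t →
  RootBound r (mkℚ (ℤ.+ a) b-1 (λ {d} → c {d})) t → k ^ suc b-1 ≤ E ^ suc b-1 * r ^ a
root⇒power {r} {k} {E} {a} {b-1} {t} 0≤t k≤Et bound = fromℕ-cancel-≤ (begin
  fromℕ (k ^ b)                      ≡⟨ fromℕ-^ k b ⟩
  fromℕ k ^ℚ b                       ≤⟨ ^ℚ-mono-≤ b (0≤fromℕ k) k≤Et ⟩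
  (fromℕ E ℚ.* t) ^ℚ b               ≡⟨ ^ℚ-distrib-* (fromℕ E) t b ⟩
  fromℕ E ^ℚ b ℚ.* t ^ℚ b            ≤⟨ ℚ.*-monoˡ-≤-nonNeg (fromℕ E ^ℚ b) {{ℚ.nonNegative (0≤^ b (0≤fromℕ E))}} bound ⟩
  fromℕ E ^ℚ b ℚ.* fromℕ (r ^ a)     ≡⟨ cong (ℚ._* fromℕ (r ^ a)) (fromℕ-^ E b) ⟨
  fromℕ (E ^ b) ℚ.* fromℕ (r ^ a)    ≡⟨ fromℕ-* (E ^ b) (r ^ a) ⟨
  fromℕ (E ^ b * r ^ a)              ∎)
  where
  open ℚ.≤-Reasoning
  b = suc b-1

root⇒inverse-power : ∀ {r k E a b-1 t} .{c : Coprime (suc a) (suc b-1)} → 0ℚ ℚ.≤ t → fromℕ k ℚ.≤ fromℕ E ℚ.* t →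
  RootBound r (mkℚ -[1+ a ] b-1 (λ {d} → c {d})) t → k ^ suc b-1 * r ^ suc a ≤ E ^ suc b-1
root⇒inverse-power {r} {k} {E} {a} {b-1} {t} 0≤t k≤Et bound = fromℕ-cancel-≤ (begin
  fromℕ (k ^ b * R)                             ≡⟨ trans (fromℕ-* (k ^ b) R) (cong (ℚ._* fromℕ R) (fromℕ-^ k b)) ⟩
  fromℕ k ^ℚ b ℚ.* fromℕ R                      ≤⟨ ℚ.*-monoʳ-≤-nonNeg (fromℕ R) {{ℚ.nonNegative (0≤fromℕ R)}} (^ℚ-mono-≤ b (0≤fromℕ k) k≤Et) ⟩
  (fromℕ E ℚ.* t) ^ℚ b ℚ.* fromℕ R              ≡⟨ trans (cong (ℚ._* fromℕ R) (^ℚ-distrib-* (fromℕ E) t b)) (ℚ.*-assoc (fromℕ E ^ℚ b) (t ^ℚ b) (fromℕ R)) ⟩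
  fromℕ E ^ℚ b ℚ.* (t ^ℚ b ℚ.* fromℕ R)         ≤⟨ ℚ.*-monoˡ-≤-nonNeg (fromℕ E ^ℚ b) {{ℚ.nonNegative (0≤^ b (0≤fromℕ E))}} bound ⟩
  fromℕ E ^ℚ b ℚ.* 1ℚ                           ≡⟨ trans (ℚ.*-identityʳ _) (sym (fromℕ-^ E b)) ⟩
  fromℕ (E ^ b)                                 ∎)
  where
  open ℚ.≤-Reasoning
  b = suc b-1
  R = r ^ suc a

-- The class and the growth of its separators

-- The exponent has a nonnegative numerator, so the bound passes from the order of a graph to any
-- larger `n`.
RealPowerBound : ℝ → ℕ → ℕ → Set
RealPowerBound x y n = ∃[ p ] (lower x p × ∃[ a ] (↥ p ≡ ℤ.+ a × y ^ ↧ₙ p ≤ n ^ a))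

WellSeparated : ℕ → ℝ → Class
WellSeparated K x G = ∀ H → IsInducedSubgraph H G → SmallSeparator K (RealPowerBound x) H

WellSeparated-hereditary : ∀ K x → Hereditary (WellSeparated K x)
WellSeparated-hereditary K x G H G∈ (f , f-inj , f-adj) H′ (g , g-inj , g-adj) =
  G∈ H′ (f ∘ g , g-inj ∘ f-inj , λ u v → trans (g-adj u v) (f-adj (g u) (g v)))

0<½ : 0ℚ ℚ.< ½
0<½ = ℚ.positive⁻¹ ½

½*t<t : ∀ {t} → 0ℚ ℚ.< t → ½ ℚ.* t ℚ.< t
½*t<t {t} 0<t = subst (½ ℚ.* t ℚ.<_) (ℚ.*-identityˡ t)
  (ℚ.*-monoˡ-<-pos t {{ℚ.positive 0<t}} (/-mono-< {1} {2} {1} {1} (n<1+n 1)))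

-- A root bound `t` only witnesses rationals strictly below `t`; `½ * t` is one of them, and the
-- factor 2 moves into the constant.
below-pow : ∀ c n x {q} t p → lower x p → RootBound n p t → 0ℚ ℚ.< t → q ℚ.< c ℚ.* (½ ℚ.* t) →
  below (c · pow n x) q
below-pow c n x t p p<x bound 0<t q< = (½ ℚ.* t , (t , ℚ.<⇒≤ 0<t , p , p<x , bound) , ½*t<t 0<t) , q<

n≤2^1+n : ∀ n → n ≤ 2 ^ suc n
n≤2^1+n zero = z≤n
n≤2^1+n (suc n) = ≤-trans (+-mono-≤ (m^n>0 2 (suc n)) (n≤2^1+n n)) (≤-reflexive (double (2 ^ suc n)))
  where
  double : ∀ x → x + x ≡ 2 * x
  double = solve-∀

-- Where x may be 0, only negative exponents p < x are available to show
-- that constants are O(n ^ x); p = - 1 / (n + 1) is good enough.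
½-root : ∀ n → ∃[ p ] (p ℚ.< 0ℚ × RootBound n p ½)
½-root n = mkℚ -[1+ 0 ] n (1-coprimeTo (suc n)) , ℚ.negative⁻¹ _ , (begin
  ½ ^ℚ suc n ℚ.* fromℕ (n ^ 1)                ≡⟨ cong (λ m → ½ ^ℚ suc n ℚ.* fromℕ m) (^-identityʳ n) ⟩
  ½ ^ℚ suc n ℚ.* fromℕ n                      ≤⟨ ℚ.*-monoˡ-≤-nonNeg (½ ^ℚ suc n) {{ℚ.nonNegative (0≤^ (suc n) (ℚ.<⇒≤ 0<½))}} (fromℕ-mono-≤ (n≤2^1+n n)) ⟩
  ½ ^ℚ suc n ℚ.* fromℕ (2 ^ suc n)            ≡⟨ cong (½ ^ℚ suc n ℚ.*_) (fromℕ-^ 2 (suc n)) ⟩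
  ½ ^ℚ suc n ℚ.* fromℕ 2 ^ℚ suc n             ≡⟨ ^ℚ-distrib-* ½ (fromℕ 2) (suc n) ⟨
  1ℚ ^ℚ suc n                                 ≡⟨ one (suc n) ⟩
  1ℚ                                          ∎)
  where
  open ℚ.≤-Reasoning
  one : ∀ n → 1ℚ ^ℚ n ≡ 1ℚ
  one zero = refl
  one (suc n) = trans (ℚ.*-identityˡ _) (one n)

4K½ : ∀ K → fromℕ (4 * K) ℚ.* ½ ≡ fromℕ (2 * K)
4K½ K = begin
  fromℕ (4 * K) ℚ.* ½              ≡⟨ cong (ℚ._* ½) (trans (fromℕ-* 4 K) (ℚ.*-comm (fromℕ 4) (fromℕ K))) ⟩
  fromℕ K ℚ.* fromℕ 4 ℚ.* ½        ≡⟨ ℚ.*-assoc (fromℕ K) (fromℕ 4) ½ ⟩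
  fromℕ K ℚ.* fromℕ 2              ≡⟨ fromℕ-* K 2 ⟨
  fromℕ (K * 2)                    ≡⟨ cong fromℕ (*-comm K 2) ⟩
  fromℕ (2 * K)                    ∎
  where open ≡-Reasoning

2K½ : ∀ K → fromℕ (2 * K) ℚ.* ½ ≡ fromℕ K
2K½ K = begin
  fromℕ (2 * K) ℚ.* ½              ≡⟨ cong (ℚ._* ½) (trans (fromℕ-* 2 K) (ℚ.*-comm (fromℕ 2) (fromℕ K))) ⟩
  fromℕ K ℚ.* fromℕ 2 ℚ.* ½        ≡⟨ ℚ.*-assoc (fromℕ K) (fromℕ 2) ½ ⟩
  fromℕ K ℚ.* 1ℚ                   ≡⟨ ℚ.*-identityʳ (fromℕ K) ⟩
  fromℕ K                          ∎
  where open ≡-Reasoning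

module _ (K : ℕ) (x : ℝ) (x≥0 : ∀ {q} → q ℚ.< 0ℚ → lower x q) where

  -- One factor 2 pays for `below-pow`, the other for `½-root`, which supplies `½` in place of 1.
  s≤4K·pow : ∀ {H n} → order H ≤ n → SmallSeparator K (RealPowerBound x) H → s H Defs.≤ fromℕ (4 * K) · pow n x
  s≤4K·pow {H} {n} H≤n (X , balanced , y , 1≤y , X≤Ky , y-bound) {q} ((τ , τ≤) , q<τ) = by-kind y-bound
    where
    open ℚ.≤-Reasoning
    q<Ky : q ℚ.< fromℕ (K * y)
    q<Ky = ℚ.<-≤-trans (τ≤ (X , balanced) q<τ) (fromℕ-mono-≤ X≤Ky)
    by-kind : y ≡ 1 ⊎ RealPowerBound x y (order H) → below (fromℕ (4 * K) · pow n x) q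
    by-kind (inj₁ refl) = let p , p<0 , bound = ½-root n in below-pow (fromℕ (4 * K)) n x ½ p (x≥0 p<0) bound 0<½ (begin-strict
      q                                    <⟨ q<Ky ⟩
      fromℕ (K * 1)                        ≡⟨ cong fromℕ (*-identityʳ K) ⟩
      fromℕ K                              ≡⟨ 2K½ K ⟨
      fromℕ (2 * K) ℚ.* ½                  ≡⟨ cong (ℚ._* ½) (4K½ K) ⟨
      fromℕ (4 * K) ℚ.* ½ ℚ.* ½            ≡⟨ ℚ.*-assoc (fromℕ (4 * K)) ½ ½ ⟩
      fromℕ (4 * K) ℚ.* (½ ℚ.* ½)          ∎)
    by-kind (inj₂ (p@(mkℚ _ b-1 _) , p<x , a , refl , yᵇ≤nᵃ)) = below-pow (fromℕ (4 * K)) n x (fromℕ y) p p<x (begin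
      fromℕ y ^ℚ suc b-1                   ≡⟨ fromℕ-^ y (suc b-1) ⟨
      fromℕ (y ^ suc b-1)                  ≤⟨ fromℕ-mono-≤ (≤-trans yᵇ≤nᵃ (^-monoˡ-≤ a H≤n)) ⟩
      fromℕ (n ^ a)                        ∎) (fromℕ-mono-< 1≤y) (begin-strict
      q                                    <⟨ q<Ky ⟩
      fromℕ (K * y)                        ≤⟨ fromℕ-mono-≤ (*-monoˡ-≤ y (m≤n*m K 2)) ⟩
      fromℕ (2 * K * y)                    ≡⟨ trans (fromℕ-* (2 * K) y) (cong (ℚ._* fromℕ y) (sym (4K½ K))) ⟩
      fromℕ (4 * K) ℚ.* ½ ℚ.* fromℕ y      ≡⟨ ℚ.*-assoc (fromℕ (4 * K)) ½ (fromℕ y) ⟩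
      fromℕ (4 * K) ℚ.* (½ ℚ.* fromℕ y)    ∎)

  WellSeparated-O : .{{_ : NonZero K}} → IsO[n^ x ] (sᶜ (WellSeparated K x))
  WellSeparated-O = fromℕ (4 * K) , fromℕ-mono-< (>-nonZero⁻¹ (4 * K) {{m*n≢0 4 K}}) , 0 ,
    λ n _ ((G , G∈ , G≤n) , b) → s≤4K·pow {G} G≤n (G∈ G (id , id , λ _ _ → refl)) b

grid-WellSeparated : ∀ d n x {Ψ} (g : ExtremalGrid d n Ψ) → (∀ y k → Ψ y k → RealPowerBound x y k) →
  let open ExtremalGrid g in WellSeparated (gridConstant d) x (Grid.grid d m L)
grid-WellSeparated d n x g imp H H⊆ =
  let open ExtremalGrid g
      open Grid d m L
      X , balanced , y , 1≤y , X≤ , bound = separators (induced⇒Embedding Step positions step? step-irrefl {H} H⊆)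
  in X , balanced , y , 1≤y , X≤ , [ inj₁ , inj₂ ∘ imp y (order H) ]′ bound

-- The hypothesis a * suc d ≤ b * d says that a / b is at most the
-- exponent d / (d + 1) of the unsubdivided grid.
module _ (d : ℕ) .{{_ : NonZero d}} (x : ℝ) (x<1 : ∀ {p a} → lower x p → ↥ p ≡ ℤ.+ a → a ≤ ↧ₙ p × a * suc d ≤ ↧ₙ p * d) where

  private
    D = suc d
    -- `D * 2 ^ d` is the ratio of `size` to `m ^ d`, and 6 comes from `grid-separator-large`.
    C = 6 * (D * 2 ^ d)
    instance
      C≢0 : NonZero C
      C≢0 = m*n≢0 6 (D * 2 ^ d) {{record {}}} {{m*n≢0 D (2 ^ d) {{record {}}} {{m^n≢0 2 d}}}}

  1/C : ℚ
  1/C = ℤ.+ 1 ℚ./ C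

  1/C*C : 1/C ℚ.* fromℕ C ≡ 1ℚ
  1/C*C = reciprocal C

  0<1/C : 0ℚ ℚ.< 1/C
  0<1/C = /-mono-< {0} {1} {1} {C} (s≤s z≤n)

  s-grid : ∀ {n Ψ} (g : ExtremalGrid d n Ψ) {t q} → t ℚ.≤ fromℕ (ExtremalGrid.size g) → q ℚ.< 1/C ℚ.* t →
    below (s (Grid.grid d (ExtremalGrid.m g) (ExtremalGrid.L g))) q
  s-grid g {t} t≤ q< = (1/C ℚ.* t , λ (X , balanced) q′< → ℚ.<-≤-trans q′< (begin
    1/C ℚ.* t                                     ≤⟨ ℚ.*-monoˡ-≤-nonNeg 1/C {{ℚ.nonNegative (ℚ.<⇒≤ 0<1/C)}} t≤ ⟩
    1/C ℚ.* fromℕ size                            ≤⟨ ℚ.*-monoˡ-≤-nonNeg 1/C {{ℚ.nonNegative (ℚ.<⇒≤ 0<1/C)}} (fromℕ-mono-≤ (size≤ X balanced)) ⟩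
    1/C ℚ.* fromℕ (C * ∣ X ∣)                     ≡⟨ cong (1/C ℚ.*_) (fromℕ-* C ∣ X ∣) ⟩
    1/C ℚ.* (fromℕ C ℚ.* fromℕ ∣ X ∣)             ≡⟨ ℚ.*-assoc 1/C (fromℕ C) (fromℕ ∣ X ∣) ⟨
    1/C ℚ.* fromℕ C ℚ.* fromℕ ∣ X ∣               ≡⟨ trans (cong (ℚ._* fromℕ ∣ X ∣) 1/C*C) (ℚ.*-identityˡ _) ⟩
    fromℕ ∣ X ∣                                   ∎)) , q<
    where
    open ℚ.≤-Reasoning
    open ExtremalGrid g
    regroup : ∀ D t x → D * t * (6 * x) ≡ 6 * (D * t) * x
    regroup = solve-∀
    size≤ : ∀ X → IsBalancedSeparator (Grid.grid d m L) X → size ≤ C * ∣ X ∣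
    size≤ X balanced = ≤-trans (*-monoʳ-≤ (D * 2 ^ d) (grid-separator-large d m L X balanced)) (≤-reflexive (regroup D (2 ^ d) ∣ X ∣))

  -- Being below `pow n x` is witnessed by a single exponent `p`, so a grid made for that `p`
  -- suffices. The threshold `D` makes room for the unit grid.
  WellSeparated-Ω : IsΩ[n^ x ] (sᶜ (WellSeparated (gridConstant d) x))
  WellSeparated-Ω = 1/C , 0<1/C , D , λ n D≤n → λ { {q} ((t , (t′ , 0≤t′ , p , p<x , bound) , t<t′) , q<) →
    let _ , g , imp , t′≤ = root-grid n D≤n p p<x 0≤t′ bound
        open ExtremalGrid g
    in (Grid.grid d m L , grid-WellSeparated d n x g imp , small) ,
       s-grid g t′≤ (ℚ.<-trans q< (ℚ.*-monoʳ-<-pos 1/C {{ℚ.positive 0<1/C}} t<t′)) }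
    where
    -- Exponents `p ≤ 0` give only `t ≤ 1`. The bound is taken empty because subgraphs of the unit
    -- grid have constant separators.
    trivial : ∀ n → D ≤ n → ∀ b-1 {t} → t ^ℚ suc b-1 ℚ.≤ 1ℚ →
      ∃[ Ψ ] Σ[ g ∈ ExtremalGrid d n Ψ ] ((∀ y k → Ψ y k → RealPowerBound x y k) × t ℚ.≤ fromℕ (ExtremalGrid.size g))
    trivial n D≤n b-1 tᵇ≤1 = (λ _ _ → ⊥) , unit-grid d n D≤n , (λ _ _ ()) ,
      root≤ 1 (ExtremalGrid.size (unit-grid d n {λ _ _ → ⊥} D≤n)) (suc b-1) tᵇ≤1 (subst (_< ExtremalGrid.size (unit-grid d n {λ _ _ → ⊥} D≤n) ^ suc b-1) (^-zeroˡ (suc b-1))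
        (^-monoˡ-< (suc b-1) (≤-trans (s≤s (>-nonZero⁻¹ d))
          (≤-trans (m≤m*n D (2 ^ d) {{m^n≢0 2 d}}) (m≤m*n (D * 2 ^ d) (1 ^ d) {{m^n≢0 1 d}})))))
    root-grid : ∀ n → D ≤ n → ∀ p → lower x p → ∀ {t} → 0ℚ ℚ.≤ t → RootBound n p t →
      ∃[ Ψ ] Σ[ g ∈ ExtremalGrid d n Ψ ] ((∀ y k → Ψ y k → RealPowerBound x y k) × t ℚ.≤ fromℕ (ExtremalGrid.size g))
    root-grid n D≤n p@(mkℚ (ℤ.+ suc a) b-1 _) p<x 0≤t bound =
      let a≤b , aD≤bd = x<1 p<x refl
          g , small-power = extremal-grid d n (suc a) (suc b-1) a≤b aD≤bd D≤n
      in _ , g , (λ _ _ yᵇ≤kᵃ → p , p<x , suc a , refl , yᵇ≤kᵃ) , root≤ (n ^ suc a) (ExtremalGrid.size g) (suc b-1) bound small-power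
    root-grid n D≤n (mkℚ (ℤ.+ 0) b-1 _) _ 0≤t bound = trivial n D≤n b-1 bound
    root-grid n D≤n (mkℚ -[1+ a ] b-1 _) _ {t} 0≤t bound = trivial n D≤n b-1 (ℚ.≤-trans
      (subst (ℚ._≤ t ^ℚ suc b-1 ℚ.* fromℕ (n ^ suc a)) (ℚ.*-identityʳ _)
        (ℚ.*-monoˡ-≤-nonNeg (t ^ℚ suc b-1) {{ℚ.nonNegative (0≤^ (suc b-1) 0≤t)}}
          (fromℕ-mono-≤ {1} (m^n>0 n {{>-nonZero (≤-trans (s≤s z≤n) D≤n)}} (suc a)))))
      bound)

12≤gridConstant : ∀ d .{{_ : NonZero d}} → 12 ≤ gridConstant d
12≤gridConstant d = *-monoʳ-≤ 6 (*-mono-≤ (s≤s (>-nonZero⁻¹ d)) (m^n>0 2 (suc d)))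

triangle-WellSeparated : ∀ d .{{_ : NonZero d}} x → WellSeparated (gridConstant d) x (Clique.subdividedClique 3 1)
triangle-WellSeparated d x H H⊆ = small-order (RealPowerBound x) H (≤-trans
  (order≤ Step positions (induced⇒Embedding Step positions step? step-irrefl {H} H⊆))
  (≤-trans (m≤m+n 9 3) (12≤gridConstant d)))
  where open Clique 3 1

clique-WellSeparated : ∀ d .{{_ : NonZero d}} x {p a e} → lower x p → ↥ p ≡ ℤ.+ a → ↧ₙ p ≡ a + e →
  ∀ j .{{_ : NonZero j}} → WellSeparated (gridConstant d) x (Clique.subdividedClique (j ^ a) (j ^ e))
clique-WellSeparated d x {p} {a} {e} p<x ↥p ↧p j H H⊆ =
  let X , balanced , y , 1≤y , X≤ , bound = clique-small-separator (j ^ a) (j ^ e) a (a + e) {{m^n≢0 j a}} {{m^n≢0 j e}}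
        (clique-sparse a e j) {H = H} (≤-trans (m≤m+n 7 5) (12≤gridConstant d))
        (induced⇒Embedding Step positions step? step-irrefl {H} H⊆)
  in X , balanced , y , 1≤y , X≤ ,
    [ inj₁ , (λ yᵇ≤nᵃ → inj₂ (p , p<x , a , ↥p , subst (λ b → y ^ b ≤ order H ^ a) (sym ↧p) yᵇ≤nᵃ)) ]′ bound
  where open Clique (j ^ a) (j ^ e)

-- Exponents excluded by dense minors

≤-numerator : ∀ c → 0ℚ ℚ.< c → ∃[ n ] c ℚ.≤ fromℕ n
≤-numerator c@(mkℚ (ℤ.+ n) d-1 _) 0<c = n , (begin
  c                            ≡⟨ ℚ.*-identityʳ c ⟨
  c ℚ.* fromℕ 1                ≤⟨ ℚ.*-monoˡ-≤-nonNeg c {{ℚ.nonNegative (ℚ.<⇒≤ 0<c)}} (fromℕ-mono-≤ {1} {suc d-1} (s≤s z≤n)) ⟩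
  c ℚ.* fromℕ (suc d-1)        ≡⟨ clear-denominator c refl ⟩
  fromℕ n                      ∎)
  where open ℚ.≤-Reasoning
≤-numerator c@(mkℚ -[1+ _ ] _ _) 0<c = contradiction (ℚ.negative⁻¹ c) (ℚ.<-asym 0<c)

quarter*4 : ∀ k → (ℤ.+ k ℚ./ 4) ℚ.* fromℕ 4 ≡ fromℕ k
quarter*4 k = ℚ.toℚᵘ-injective (begin
  ℚ.toℚᵘ ((ℤ.+ k ℚ./ 4) ℚ.* fromℕ 4)                 ≈⟨ ℚ.toℚᵘ-homo-* (ℤ.+ k ℚ./ 4) (fromℕ 4) ⟩
  ℚ.toℚᵘ (ℤ.+ k ℚ./ 4) ℚᵘ.* ℚ.toℚᵘ (fromℕ 4)         ≈⟨ ℚᵘ.*-congʳ {ℚ.toℚᵘ (fromℕ 4)} (ℚ.toℚᵘ-fromℚᵘ (ℚᵘ.mkℚᵘ (ℤ.+ k) 3)) ⟩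
  ℚᵘ.mkℚᵘ (ℤ.+ k) 3 ℚᵘ.* ℚᵘ.mkℚᵘ (ℤ.+ 4) 0           ≈⟨ ℚᵘ.*≡* (ℤ.*-identityʳ _) ⟩
  ℚᵘ.mkℚᵘ (ℤ.+ k) 0                                  ≈⟨ fromℕ≃ k ⟨
  ℚ.toℚᵘ (fromℕ k)                                   ∎)
  where open ℚᵘ.≃-Reasoning

-- `E` is uniform: an integer above the implied constant, times the 4 that undoes the quarter in
-- `complete-density`. The exponent `p` still varies with `r`.
dense-minor-root : ∀ 𝒢 B P → IsO[n^ B ] (∇ᶜ 𝒢) → upper B P → ∃[ N ] ∃[ E ] (∀ k L r .{{_ : NonZero L}} →
  N ≤ r → L ≤ r → 3 ≤ k → 𝒢 (Clique.subdividedClique k L) →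
  ∃[ t ] ∃[ p ] (0ℚ ℚ.≤ t × p ℚ.< P × RootBound r p t × fromℕ k ℚ.≤ fromℕ E ℚ.* t))
dense-minor-root 𝒢 B P (c , 0<c , N , bound) B<P = N , num * 4 , root
  where
  open ℚ.≤-Reasoning
  num = proj₁ (≤-numerator c 0<c)
  root : ∀ k L r .{{_ : NonZero L}} → N ≤ r → L ≤ r → 3 ≤ k → 𝒢 (Clique.subdividedClique k L) →
    ∃[ t ] ∃[ p ] (0ℚ ℚ.≤ t × p ℚ.< P × RootBound r p t × fromℕ k ℚ.≤ fromℕ (num * 4) ℚ.* t)
  root k@(suc _) L r N≤r L≤r 3≤k G∈ =
    let (t₀ , (t , 0≤t , p , p<B , rooted) , t₀<t) , below-ct₀ =
          bound r N≤r ((Clique.subdividedClique k L , G∈) , (complete k , clique-minor k L L≤r , record {}) , complete-density k 3≤k)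
    in t , p , 0≤t , lower<upper B p<B B<P , rooted , (begin
      fromℕ k                              ≡⟨ quarter*4 k ⟨
      (ℤ.+ k ℚ./ 4) ℚ.* fromℕ 4            ≤⟨ ℚ.*-monoʳ-≤-nonNeg (fromℕ 4) (ℚ.<⇒≤ below-ct₀) ⟩
      c ℚ.* t₀ ℚ.* fromℕ 4                 ≤⟨ ℚ.*-monoʳ-≤-nonNeg (fromℕ 4) (ℚ.*-monoˡ-≤-nonNeg c {{ℚ.nonNegative (ℚ.<⇒≤ 0<c)}} (ℚ.<⇒≤ t₀<t)) ⟩
      c ℚ.* t ℚ.* fromℕ 4                  ≤⟨ ℚ.*-monoʳ-≤-nonNeg (fromℕ 4) (ℚ.*-monoʳ-≤-nonNeg t {{ℚ.nonNegative 0≤t}} (proj₂ (≤-numerator c 0<c))) ⟩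
      fromℕ num ℚ.* t ℚ.* fromℕ 4          ≡⟨ trans (ℚ.*-assoc (fromℕ num) t (fromℕ 4)) (cong (fromℕ num ℚ.*_) (ℚ.*-comm t (fromℕ 4))) ⟩
      fromℕ num ℚ.* (fromℕ 4 ℚ.* t)        ≡⟨ ℚ.*-assoc (fromℕ num) (fromℕ 4) t ⟨
      fromℕ num ℚ.* fromℕ 4 ℚ.* t          ≡⟨ cong (ℚ._* t) (fromℕ-* num 4) ⟨
      fromℕ (num * 4) ℚ.* t                ∎)

^-swap : ∀ x m n → (x ^ m) ^ n ≡ (x ^ n) ^ m
^-swap x m n = trans (^-*-assoc x m n) (trans (cong (x ^_) (*-comm m n)) (sym (^-*-assoc x n m)))

-- Trades the varying `p` for a fixed larger exponent, which is sound as `r ≥ 1`. A negative `p`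
-- even yields `k ≤ E`.
raise-exponent : ∀ {r k E A B-1 t p} .{c : Coprime A (suc B-1)} .{{_ : NonZero r}} → 0ℚ ℚ.≤ t →
  p ℚ.< mkℚ (ℤ.+ A) B-1 (λ {d} → c {d}) → RootBound r p t → fromℕ k ℚ.≤ fromℕ E ℚ.* t → k ^ suc B-1 ≤ E ^ suc B-1 * r ^ A
raise-exponent {r} {k} {E} {A} {B-1} {p = mkℚ (ℤ.+ a) b-1 c′} 0≤t p<P rooted k≤Et = ^-cancelˡ-≤ b (begin
  (k ^ B) ^ b                  ≡⟨ ^-swap k B b ⟩
  (k ^ b) ^ B                  ≤⟨ ^-monoˡ-≤ B (root⇒power {r} {k} {E} {a} {b-1} {c = λ {d} → c′ {d}} 0≤t k≤Et rooted) ⟩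
  (E ^ b * r ^ a) ^ B          ≡⟨ trans (^-distribʳ-* (E ^ b) (r ^ a) B) (cong₂ _*_ (^-swap E b B) (^-*-assoc r a B)) ⟩
  (E ^ B) ^ b * r ^ (a * B)    ≤⟨ *-monoʳ-≤ ((E ^ B) ^ b) (^-monoʳ-≤ r (<⇒≤ aB<Ab)) ⟩
  (E ^ B) ^ b * r ^ (A * b)    ≡⟨ trans (^-distribʳ-* (E ^ B) (r ^ A) b) (cong ((E ^ B) ^ b *_) (^-*-assoc r A b)) ⟨
  (E ^ B * r ^ A) ^ b          ∎)
  where
  open ≤-Reasoning
  b = suc b-1
  B = suc B-1
  aB<Ab : a * B < A * b
  aB<Ab = ℤ.drop‿+<+ (subst₂ ℤ._<_ (sym (ℤ.pos-* a B)) (sym (ℤ.pos-* A b)) (ℚ.drop-*<* p<P))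
raise-exponent {r} {k} {E} {A} {B-1} {p = mkℚ -[1+ a ] b-1 c′} 0≤t _ rooted k≤Et = ≤-trans
  (^-monoˡ-≤ (suc B-1) (^-cancelˡ-≤ (suc b-1) {k} {E} (≤-trans (m≤m*n (k ^ suc b-1) (r ^ suc a) {{m^n≢0 r (suc a)}}) (root⇒inverse-power {r} {k} {E} {a} {b-1} {c = λ {d} → c′ {d}} 0≤t k≤Et rooted))))
  (m≤m*n (E ^ suc B-1) (r ^ A) {{m^n≢0 r A}})

raise-negative-exponent : ∀ {r k E A B-1 t p} .{c : Coprime (suc A) (suc B-1)} .{{_ : NonZero r}} .{{_ : NonZero k}} → 0ℚ ℚ.≤ t →
  p ℚ.< mkℚ -[1+ A ] B-1 (λ {d} → c {d}) → RootBound r p t → fromℕ k ℚ.≤ fromℕ E ℚ.* t → r ^ suc A ≤ E ^ suc B-1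
raise-negative-exponent {p = mkℚ (ℤ.+ a) b-1 _} {c} _ p<P _ _ =
  contradiction (ℚ.nonNegative⁻¹ (mkℚ (ℤ.+ a) b-1 _)) (ℚ-<⇒≱ (ℚ.<-trans p<P (ℚ.negative⁻¹ (mkℚ -[1+ _ ] _ _))))
raise-negative-exponent {r} {k} {E} {A} {B-1} {p = mkℚ -[1+ a ] b-1 c′} 0≤t p<P rooted k≤Et = ^-cancelˡ-≤ b (begin
  (r ^ suc A) ^ b              ≡⟨ ^-*-assoc r (suc A) b ⟩
  r ^ (suc A * b)              ≤⟨ ^-monoʳ-≤ r (<⇒≤ (s≤s (ℤ.drop‿-<- (ℚ.drop-*<* p<P)))) ⟩
  r ^ (suc a * B)              ≡⟨ ^-*-assoc r (suc a) B ⟨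
  (r ^ suc a) ^ B              ≤⟨ ^-monoˡ-≤ B (m≤n*m (r ^ suc a) (k ^ b) {{m^n≢0 k b}}) ⟩
  (k ^ b * r ^ suc a) ^ B      ≤⟨ ^-monoˡ-≤ B (root⇒inverse-power {r} {k} {E} {a} {b-1} {c = λ {d} → c′ {d}} 0≤t k≤Et rooted) ⟩
  (E ^ b) ^ B                  ≡⟨ ^-swap E b B ⟩
  (E ^ B) ^ b                  ∎)
  where
  open ≤-Reasoning
  b = suc b-1
  B = suc B-1

-- The triangle is a minor at every depth `r ≥ 1`, so the density cannot tend to 0.
negative-exponent-impossible : ∀ 𝒢 B {A B-1} .{c : Coprime (suc A) (suc B-1)} → 𝒢 (Clique.subdividedClique 3 1) →
  IsO[n^ B ] (∇ᶜ 𝒢) → ¬ upper B (mkℚ -[1+ A ] B-1 (λ {d} → c {d}))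
negative-exponent-impossible 𝒢 B {A} {B-1} {c} triangle∈ isO B<P =
  let N , E , root = dense-minor-root 𝒢 B _ isO B<P
      r = suc (N + E ^ suc B-1)
      t , p , 0≤t , p<P , rooted , k≤Et = root 3 1 r (≤-trans (m≤m+n N _) (n≤1+n _)) (s≤s z≤n) ≤-refl triangle∈
      r^ : r ^ suc A ≤ E ^ suc B-1
      r^ = raise-negative-exponent {r} {3} {E} {c = c} 0≤t p<P rooted k≤Et
  in <⇒≱ (s≤s (m≤n+m (E ^ suc B-1) N)) (≤-trans (m≤m*n r (r ^ A) {{m^n≢0 r A}}) r^)

-- For `k = j ^ a` and `r = j ^ e`, the strict inequality between integer exponents gains a whole
-- factor `j`, and `j` is chosen to exceed the constant `E ^ suc B-1`.
small-exponent-impossible : ∀ 𝒢 B {A B-1 a e} .{c : Coprime A (suc B-1)} .{{_ : NonZero a}} .{{_ : NonZero e}} →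
  (∀ j .{{_ : NonZero j}} → 𝒢 (Clique.subdividedClique (j ^ a) (j ^ e))) → A * e < a * suc B-1 →
  IsO[n^ B ] (∇ᶜ 𝒢) → ¬ upper B (mkℚ (ℤ.+ A) B-1 (λ {d} → c {d}))
small-exponent-impossible 𝒢 B {A} {B-1} {a} {e} {c} cliques∈ Ae<aB isO B<P =
  let N , E , root = dense-minor-root 𝒢 B _ isO B<P
      j = 3 + (N + E ^ suc B-1)
      j≤j^ : ∀ i .{{_ : NonZero i}} → j ≤ j ^ i
      j≤j^ i = ≤-trans (≤-reflexive (sym (^-identityʳ j))) (^-monoʳ-≤ j {1} {i} (>-nonZero⁻¹ i))
      r = j ^ e
      t , p , 0≤t , p<P , rooted , k≤Et = root (j ^ a) r r {{m^n≢0 j e}}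
        (≤-trans (≤-trans (m≤m+n N _) (m≤n+m _ 3)) (j≤j^ e)) ≤-refl (≤-trans (m≤m+n 3 _) (j≤j^ a)) (cliques∈ j)
  in contradiction (raise-exponent {r} {j ^ a} {E} {c = c} {{m^n≢0 j e}} 0≤t p<P rooted k≤Et) (<⇒≱ (begin-strict
    E ^ suc B-1 * r ^ A        <⟨ *-monoˡ-< (r ^ A) {{m^n≢0 r A {{m^n≢0 j e}}}} (s≤s (≤-trans (m≤n+m (E ^ suc B-1) N) (m≤n+m _ 2))) ⟩
    j * r ^ A                  ≡⟨ cong (j *_) (^-*-assoc j e A) ⟩
    j ^ suc (e * A)            ≤⟨ ^-monoʳ-≤ j (≤-trans (≤-reflexive (cong suc (*-comm e A))) Ae<aB) ⟩
    j ^ (a * suc B-1)          ≡⟨ ^-*-assoc j a (suc B-1) ⟨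
    (j ^ a) ^ suc B-1          ∎))
  where open ≤-Reasoning

1-1- : ∀ t → 1ℚ ℚ.- (1ℚ ℚ.- t) ≡ t
1-1- = solve 1 (λ t → con 1ℚ :- (con 1ℚ :- t) := t) refl
  where open +-*-Solver

-- The dimension parameter is the denominator `d` of a positive rational `q₀ = n / d` below `ε`.
-- Clearing denominators in `p < 1 - q₀` gives `n * b + a * d < b * d`, and `n ≥ 1` does the rest.
exponents-below-1 : ∀ ε q₀ p {a} → 0ℚ ℚ.< q₀ → lower ε q₀ → lower (1- ε) p → ↥ p ≡ ℤ.+ a →
  a < ↧ₙ p × a * suc (↧ₙ q₀) ≤ ↧ₙ p * ↧ₙ q₀
exponents-below-1 ε q₀@(mkℚ (ℤ.+ n) d-1 _) p@(mkℚ _ b-1 _) {a} 0<q₀ q₀<ε p<1-ε refl =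
  *-cancelʳ-< d a b (≤-<-trans (m≤n+m (a * d) (n * b)) cleared) ,
  (begin
    a * suc d                  ≡⟨ *-suc a d ⟩
    a + a * d                  ≤⟨ +-monoˡ-≤ (a * d) (<⇒≤ (*-cancelʳ-< d a b (≤-<-trans (m≤n+m (a * d) (n * b)) cleared))) ⟩
    b + a * d                  ≤⟨ +-monoˡ-≤ (a * d) (m≤n*m b n {{n≢0}}) ⟩
    n * b + a * d              ≤⟨ <⇒≤ cleared ⟩
    b * d                      ∎)
  where
  open ≤-Reasoning
  b = suc b-1
  d = suc d-1
  n≢0 : NonZero n
  n≢0 = >-nonZero (fromℕ-cancel-< {0} {n} (subst (0ℚ ℚ.<_) (clear-denominator q₀ refl)
    (subst (ℚ._< q₀ ℚ.* fromℕ d) (ℚ.*-zeroˡ (fromℕ d)) (ℚ.*-monoˡ-<-pos (fromℕ d) {{ℚ.positive (fromℕ-mono-< {0} {d} (s≤s z≤n))}} 0<q₀))))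
  q₀<1-p : q₀ ℚ.< 1ℚ ℚ.- p
  q₀<1-p = lower<upper ε q₀<ε p<1-ε
  scale : ∀ q p d b → q ℚ.* d ℚ.* b ℚ.+ p ℚ.* b ℚ.* d ≡ (q ℚ.+ p) ℚ.* (b ℚ.* d)
  scale = solve 4 (λ q p d b → q :* d :* b :+ p :* b :* d := (q :+ p) :* (b :* d)) refl
    where open +-*-Solver
  cancel : ∀ p → 1ℚ ℚ.- p ℚ.+ p ≡ 1ℚ
  cancel = solve 1 (λ p → con 1ℚ :- p :+ p := con 1ℚ) refl
    where open +-*-Solver
  cleared : n * b + a * d < b * d
  cleared = fromℕ-cancel-< (subst₂ ℚ._<_
    (trans (sym (scale q₀ p (fromℕ d) (fromℕ b))) (trans (cong₂ (λ x y → x ℚ.* fromℕ b ℚ.+ y ℚ.* fromℕ d) (clear-denominator q₀ refl) (clear-denominator p refl))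
      (trans (cong₂ ℚ._+_ (sym (fromℕ-* n b)) (sym (fromℕ-* a d))) (sym (fromℕ-+ (n * b) (a * d))))))
    (trans (ℚ.*-identityˡ _) (sym (fromℕ-* b d)))
    (ℚ.*-monoˡ-<-pos (fromℕ b ℚ.* fromℕ d)
      {{subst ℚ.Positive (fromℕ-* b d) (ℚ.positive (fromℕ-mono-< {0} {b * d} (s≤s z≤n)))}}
      (subst (q₀ ℚ.+ p ℚ.<_) (cancel p) (ℚ.+-monoˡ-< p q₀<1-p))))
exponents-below-1 ε q₀@(mkℚ -[1+ _ ] _ _) _ 0<q₀ _ _ _ = contradiction (ℚ.negative⁻¹ q₀) (ℚ.<-asym 0<q₀)

-- The hypothesis is `P < p / (1 - p)` without division, and `p / (1 - p)` equals `a / e`.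
cross-multiply : ∀ {P p A a e} → ↥ P ≡ ℤ.+ A → ↥ p ≡ ℤ.+ a → ↧ₙ p ≡ a + e → P ℚ.* (1ℚ ℚ.- p) ℚ.< p → A * e < a * ↧ₙ P
cross-multiply {P@(mkℚ _ B-1 _)} {p@(mkℚ _ b-1 _)} {A} {a} {e} refl refl ↧p P<p = +-cancelʳ-< (A * a) _ _ (begin-strict
  A * e + A * a          ≡⟨ regroup A e a ⟩
  A * (a + e)            ≡⟨ cong (A *_) ↧p ⟨
  A * b                  <⟨ cleared ⟩
  a * B + A * a          ∎)
  where
  open ≤-Reasoning
  b = suc b-1
  B = suc B-1
  regroup : ∀ A e a → A * e + A * a ≡ A * (a + e)
  regroup = solve-∀
  moveˡ : ∀ P p B b → (P ℚ.* (1ℚ ℚ.- p) ℚ.+ P ℚ.* p) ℚ.* (b ℚ.* B) ≡ P ℚ.* B ℚ.* b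
  moveˡ = solve 4 (λ P p B b → (P :* (con 1ℚ :- p) :+ P :* p) :* (b :* B) := P :* B :* b) refl
    where open +-*-Solver
  moveʳ : ∀ P p B b → (p ℚ.+ P ℚ.* p) ℚ.* (b ℚ.* B) ≡ p ℚ.* b ℚ.* B ℚ.+ P ℚ.* B ℚ.* (p ℚ.* b)
  moveʳ = solve 4 (λ P p B b → (p :+ P :* p) :* (b :* B) := p :* b :* B :+ P :* B :* (p :* b)) refl
    where open +-*-Solver
  cleared : A * b < a * B + A * a
  cleared = fromℕ-cancel-< (subst₂ ℚ._<_
    (trans (moveˡ P p (fromℕ B) (fromℕ b)) (trans (cong (ℚ._* fromℕ b) (clear-denominator P refl)) (sym (fromℕ-* A b))))
    (trans (moveʳ P p (fromℕ B) (fromℕ b)) (trans (cong₂ (λ x y → x ℚ.* fromℕ B ℚ.+ y ℚ.* x) (clear-denominator p refl) (clear-denominator P refl))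
      (trans (cong₂ ℚ._+_ (sym (fromℕ-* a B)) (sym (fromℕ-* A a))) (sym (fromℕ-+ (a * B) (A * a))))))
    (ℚ.*-monoˡ-<-pos (fromℕ b ℚ.* fromℕ B)
      {{subst ℚ.Positive (fromℕ-* b B) (ℚ.positive (fromℕ-mono-< {0} {b * B} (s≤s z≤n)))}}
      (ℚ.+-monoˡ-< (P ℚ.* p) P<p)))

<1/-1 : ∀ {P u} t .{{_ : ℚ.Positive t}} → P ℚ.< u ℚ.- 1ℚ → u ℚ.< (ℚ.1/ t) {{ℚ.pos⇒nonZero t}} → P ℚ.* t ℚ.< 1ℚ ℚ.- t
<1/-1 {P} {u} t P<u-1 u<1/t = subst₂ ℚ._<_ (left P t) refl (ℚ.+-monoˡ-< (ℚ.- t) (begin-strict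
  (P ℚ.+ 1ℚ) ℚ.* t                        <⟨ ℚ.*-monoˡ-<-pos t (subst (P ℚ.+ 1ℚ ℚ.<_) (cancel u) (ℚ.+-monoˡ-< 1ℚ P<u-1)) ⟩
  u ℚ.* t                                 <⟨ ℚ.*-monoˡ-<-pos t u<1/t ⟩
  (ℚ.1/ t) {{ℚ.pos⇒nonZero t}} ℚ.* t      ≡⟨ ℚ.*-inverseˡ t {{ℚ.pos⇒nonZero t}} ⟩
  1ℚ                                      ∎))
  where
  open ℚ.≤-Reasoning
  left : ∀ P t → (P ℚ.+ 1ℚ) ℚ.* t ℚ.- t ≡ P ℚ.* t
  left = solve 2 (λ P t → (P :+ con 1ℚ) :* t :- t := P :* t) refl
    where open +-*-Solver
  cancel : ∀ u → u ℚ.- 1ℚ ℚ.+ 1ℚ ≡ u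
  cancel = solve 1 (λ u → u :- con 1ℚ :+ con 1ℚ := u) refl
    where open +-*-Solver

-- A rational `t` above `ε` supplies the exponent `p = 1 - t` below `1 - ε`, for which `p / (1 - p)`
-- is `1 / t - 1`, hence above `P`.
admissible-bound : ∀ ε → 0ℝ <ℝ ε → ε ≤ℝ 1ℝ → ∀ B → Admissible ε B → ∀ {t u} (t>0 : ℚ.Positive t) → upper ε t →
  u ℚ.< (ℚ.1/ t) {{ℚ.pos⇒nonZero t {{t>0}}}} → ∀ {P} → P ℚ.< u ℚ.- 1ℚ → ¬ upper B P
admissible-bound ε (q₀ , 0<q₀ , q₀<ε) ε≤1 B admissible {t} {u} t>0 ε<t u<1/t {P} P<u-1 = by-sign P (<1/-1 t {{t>0}} P<u-1 u<1/t)
  where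
  x = 1- ε
  d = ↧ₙ q₀
  K = gridConstant d
  𝒢 = WellSeparated K x

  x≥0 : ∀ {q} → q ℚ.< 0ℚ → lower x q
  x≥0 {q} q<0 = [ (λ 1<ε → contradiction (ε≤1 1<ε) (ℚ.<-irrefl refl)) , id ]′
    (located ε (ℚ.+-monoʳ-< 1ℚ (ℚ.neg-antimono-< q<0)))

  isO : IsO[n^ B ] (∇ᶜ 𝒢)
  isO = admissible 𝒢 (WellSeparated-hereditary K x)
    ( WellSeparated-O K x x≥0 {{m*n≢0 6 (suc d * 2 ^ suc d) {{record {}}} {{m*n≢0 (suc d) (2 ^ suc d) {{record {}}} {{m^n≢0 2 (suc d)}}}}}}
    , WellSeparated-Ω d x λ {p} p<x ↥p → let a<b , bound = exponents-below-1 ε q₀ p 0<q₀ q₀<ε p<x ↥p in <⇒≤ a<b , bound)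

  by-exponent : ∀ {A B-1} .{c : Coprime A (suc B-1)} → let P = mkℚ (ℤ.+ A) B-1 (λ {d} → c {d}) in
    ∀ p → lower x p → 0ℚ ℚ.< p → P ℚ.* (1ℚ ℚ.- p) ℚ.< p → ¬ upper B P
  by-exponent {A} {B-1} {c} p@(mkℚ (ℤ.+ suc a) b-1 _) p<x _ P<p =
    small-exponent-impossible 𝒢 B {A} {B-1} {suc a} {e} {c} {{record {}}} {{>-nonZero (m<n⇒0<n∸m a<b)}}
      (clique-WellSeparated d x {p} {suc a} {e} p<x refl ↧p) (cross-multiply {mkℚ (ℤ.+ A) B-1 (λ {d} → c {d})} {p} refl refl ↧p P<p) isO
    where
    a<b : suc a < suc b-1
    a<b = proj₁ (exponents-below-1 ε q₀ p 0<q₀ q₀<ε p<x refl)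
    e = suc b-1 ∸ suc a
    ↧p : suc b-1 ≡ suc a + e
    ↧p = sym (m+[n∸m]≡n (<⇒≤ a<b))
  by-exponent p@(mkℚ (ℤ.+ 0) b-1 _) _ 0<p _ = contradiction (subst (0ℚ ℚ.<_) (ℚ.↥p≡0⇒p≡0 p refl) 0<p) (ℚ.<-irrefl refl)
  by-exponent p@(mkℚ -[1+ _ ] _ _) _ 0<p _ = contradiction (ℚ.negative⁻¹ p) (ℚ.<-asym 0<p)

  by-sign : ∀ P → P ℚ.* t ℚ.< 1ℚ ℚ.- t → ¬ upper B P
  -- For negative `P` the exponent `1 - t` need not be positive, as when `ε` is 1, so the triangle
  -- replaces the large complete graphs.
  by-sign (mkℚ -[1+ A ] B-1 c) _ = negative-exponent-impossible 𝒢 B {c = c} (triangle-WellSeparated d x) isO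
  by-sign P@(mkℚ (ℤ.+ A) B-1 c) Pt<1-t = by-exponent {c = c} (1ℚ ℚ.- t) (subst (upper ε) (sym (1-1- t)) ε<t)
    (ℚ.≤-<-trans (0≤* (ℚ.nonNegative⁻¹ P) (ℚ.<⇒≤ (ℚ.positive⁻¹ t {{t>0}}))) Pt<1-t)
    (subst (λ s → P ℚ.* s ℚ.< 1ℚ ℚ.- t) (sym (1-1- t)) Pt<1-t)

lemma11 : (ε : ℝ) → 0ℝ <ℝ ε → ε ≤ℝ 1ℝ → inv ε -ℚ 1ℚ Defs.≤ B[ ε ]
lemma11 ε 0<ε ε≤1 {q} ((u , (t , t>0 , ε<t) , u<1/t) , q<u-1) = (u ℚ.- 1ℚ , below-every-B) , q<u-1
  where
  below-every-B : ((B , _) : Σ[ B ∈ ℝ ] Admissible ε B) → fromℚ̄ (u ℚ.- 1ℚ) Defs.≤ ⌊ B ⌋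
  below-every-B (B , admissible) q<T =
    let P , q<P , P<T = ℚ.<-dense q<T
    -- Locatedness of `B` between `q` and `P` turns the refutation of `upper B P` into the positive
    -- statement `lower B q`.
    in [ id , (λ B<P → contradiction B<P (admissible-bound ε 0<ε ε≤1 B admissible t>0 ε<t u<1/t P<T)) ]′ (located B q<P)
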